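{- For any board $B\subseteq[m]\times[n]$ and any integer $d\ge 0$, the function $\mathfrak m_d(B,q)$ of the prime power $q$ is polynomial modulo $(q-1)^{d+6}$, with integer coefficients. That is, there is a polynomial $P\in\mathbb Z[x]$ of degree at most $d+5$ such that $$\mathfrak m_d(B,q)\equiv P(q-1)\pmod{(q-1)^{d+6}}\qquad\text{for all prime powers } q.$$
   Context: Notation: $[n]=\{1,\dots,n\}$. A board is a subset $B\subseteq[m]\times[n]$. For a prime power $q>1$, $\mathfrak m_d(B,q)$ is the number of $m\times n$ matrices over $\mathbb F_q$ of rank $d$ whose support (set of positions of nonzero entries) is contained in $B$. -}

module Defs where

open import Algebra.Apartness.Bundles using (HeytingField; HeytingCommutativeRing)
open import Algebra.Bundles using (CommutativeRing)
import Algebra.Properties.Semiring.Sum as SemiringSum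
open import Data.Fin.Base using (Fin; zero; suc)
open import Data.Fin.Properties using (all?; _≟_)
open import Data.Fin.Subset using (Subset; _∈_; _∉_; ∣_∣)
open import Data.Fin.Subset.Properties using (_∈?_; anySubset?)
open import Data.Integer.Base as ℤ using (ℤ; 0ℤ)
open import Data.List.Base using (List; []; _∷_; [_]; map; foldr; filter; length; allFin; cartesianProductWith)
open import Data.Nat.Base using (ℕ; zero; suc; _≤_; _<_; _^_)
open import Data.Nat.Primality using (Prime)
import Data.Nat.Properties as ℕ
open import Data.Product.Base using (_×_; _,_; ∃-syntax)
open import Data.Vec.Functional as Vector using (Vector)
open import Function.Base using (_∘_)
open import Function.Bundles using (Inverse)
open import Level using (0ℓ) renaming (suc to lsuc)
open import Relation.Binary.PropositionalEquality as ≡ using (_≡_)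
open import Relation.Nullary using (¬_; Dec)
open import Relation.Nullary.Decidable using (¬?; _×-dec_; _→-dec_; map′; decidable-stable)
open import Relation.Unary using (Decidable)

PrimePower : ℕ → Set
PrimePower q = ∃[ p ] ∃[ k ] Prime p × 0 < k × q ≡ p ^ k

-- (i , j) belongs to the board B when j ∈ B i.
Board : ℕ → ℕ → Set
Board m n = Vector (Subset n) m

-- Coefficient lists, constant term first; trailing zeros are allowed.
Polynomial : Set
Polynomial = List ℤ

coeff : Polynomial → ℕ → ℤ
coeff []      _       = 0ℤ
coeff (a ∷ p) zero    = a
coeff (a ∷ p) (suc i) = coeff p i

DegreeAtMost : ℕ → Polynomial → Set
DegreeAtMost k p = ∀ i → k < i → coeff p i ≡ 0ℤ

⟦_⟧ : Polynomial → ℤ → ℤ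
⟦ p ⟧ x = foldr (λ a v → a ℤ.+ x ℤ.* v) 0ℤ p

-- A field with q elements.  The carrier is a setoid, so "q elements" means
-- q classes for _≈_; finiteness makes _≈_ decidable, and x # y is then
-- equivalent to ¬ x ≈ y, so this is a field in the usual sense.
record FiniteField (q : ℕ) : Set (lsuc 0ℓ) where
  field
    heytingField : HeytingField 0ℓ 0ℓ 0ℓ

  commutativeRing : CommutativeRing 0ℓ 0ℓ
  commutativeRing =
    HeytingCommutativeRing.commutativeRing
      (HeytingField.heytingCommutativeRing heytingField)

  open CommutativeRing commutativeRing public

  field
    enumeration : Inverse (≡.setoid (Fin q)) setoid

vectors : {A : Set} → List A → ∀ n → List (Vector A n)
vectors xs zero    = [ Vector.[] ]
vectors xs (suc n) = cartesianProductWith Vector._∷_ xs (vectors xs n)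

module _ {q : ℕ} (F : FiniteField q) where

  open FiniteField F hiding (zero)
  open SemiringSum semiring using (sum; sum-cong-≋; sum-syntax)
  open Inverse enumeration using (to; from; from-cong; strictlyInverseˡ)

  Matrix : ℕ → ℕ → Set
  Matrix m n = Vector (Vector Carrier n) m

  SupportedOn : ∀ {m n} → Board m n → Matrix m n → Set
  SupportedOn B A = ∀ i j → ¬ (A i j ≈ 0#) → j ∈ B i

  -- The columns of A with index in S are linearly independent: a relation
  -- among them is a vector c of coefficients vanishing outside S.
  IndependentColumns : ∀ {m n} → Matrix m n → Subset n → Set
  IndependentColumns {m} {n} A S =
    ∀ (c : Vector Carrier n) →
    (∀ j → j ∉ S → c j ≈ 0#) →
    (∀ i → ∑[ j < n ] (c j * A i j) ≈ 0#) →
    ∀ j → c j ≈ 0#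

  HasRank : ∀ {m n} → ℕ → Matrix m n → Set
  HasRank r A =
    (∃[ S ] IndependentColumns A S × ∣ S ∣ ≡ r) ×
    (∀ S → IndependentColumns A S → ∣ S ∣ ≤ r)

  _≈?_ : ∀ x y → Dec (x ≈ y)
  x ≈? y = map′
    (λ e → trans (sym (strictlyInverseˡ x))
             (trans (reflexive (≡.cong to e)) (strictlyInverseˡ y)))
    from-cong
    (from x ≟ from y)

  allVector? : ∀ n {P : Vector Carrier n → Set} →
               (∀ {u v} → (∀ i → u i ≈ v i) → P u → P v) →
               Decidable P → Dec (∀ v → P v)
  allVector? zero resp P? =
    map′ (λ p v → resp (λ ()) p) (λ f → f Vector.[]) (P? Vector.[])
  allVector? (suc n) resp P? =
    map′ (λ f v → resp (λ { zero    → strictlyInverseˡ (v zero)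
                          ; (suc i) → refl })
                       (f (from (v zero)) (v ∘ suc)))
         (λ f i v → f (to i Vector.∷ v))
         (all? λ i → allVector? n
           (λ u≈v → resp (λ { zero → refl ; (suc j) → u≈v j }))
           (λ v → P? (to i Vector.∷ v)))

  supportedOn? : ∀ {m n} (B : Board m n) → Decidable (SupportedOn B)
  supportedOn? B A =
    all? λ i → all? λ j → ¬? (A i j ≈? 0#) →-dec (j ∈? B i)

  independentColumns? : ∀ {m n} (A : Matrix m n) → Decidable (IndependentColumns A)
  independentColumns? {m} {n} A S = allVector? n
    (λ u≈v h out rel j → trans (sym (u≈v j)) (h
      (λ k k∉S → trans (u≈v k) (out k k∉S))
      (λ i → trans (sum-cong-≋ (λ k → *-congʳ (u≈v k))) (rel i)) j))
    (λ c → (all? λ j → ¬? (j ∈? S) →-dec (c j ≈? 0#)) →-dec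
           ((all? λ i → sum (λ j → c j * A i j) ≈? 0#) →-dec
           (all? λ j → c j ≈? 0#)))

  allSubset? : ∀ {n} {P : Subset n → Set} → Decidable P → Dec (∀ S → P S)
  allSubset? P? = map′
    (λ ¬∃¬ S → decidable-stable (P? S) (λ ¬p → ¬∃¬ (S , ¬p)))
    (λ f (S , ¬p) → ¬p (f S))
    (¬? (anySubset? (¬? ∘ P?)))

  hasRank? : ∀ {m n} r → Decidable (HasRank {m} {n} r)
  hasRank? r A =
    anySubset? (λ S → independentColumns? A S ×-dec (∣ S ∣ ℕ.≟ r)) ×-dec
    allSubset? (λ S → independentColumns? A S →-dec (∣ S ∣ ℕ.≤? r))

  -- Every m × n matrix occurs exactly once up to entrywise _≈_.
  matrices : ∀ m n → List (Matrix m n)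
  matrices m n = vectors (vectors (map to (allFin q)) n) m

  𝔪 : ∀ {m n} → ℕ → Board m n → ℕ
  𝔪 {m} {n} d B =
    length (filter (λ A → supportedOn? B A ×-dec hasRank? d A) (matrices m n))

module Submission where

-- Sort the matrices by their exact support.  Rank is additive over the connected components of
-- the support, so the counts of the components convolve, and it suffices to treat a connected
-- support with m nonempty rows and n nonempty columns.  The torus of row and column scalings makes
-- the number of matrices of rank r divisible by (q − 1)^(m + n − 1); since r ≤ m, this vanishes
-- modulo (q − 1)^(r + 6) once n ≥ 7.  If n ≤ 6, the number is (q − 1)^m times a polynomial: by
-- double counting of the pairs (A , U) with U a k-dimensional subspace of ker A, for all k, it
-- reduces to a sum over the subspaces U of Kⁿ of a function of the matroid of U, and U is built
-- up one coordinate at a time.  The number of extensions of at most five vectors by a vector with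
-- prescribed incidences to their spans depends only on their matroid, because an intersection of
-- spans of flats is then already an intersection of at most two of them.

open import Algebra.Apartness.Bundles using (HeytingField)
open import Algebra.Bundles using (CommutativeRing)
open import Algebra.Morphism.Structures using (IsRingMonomorphism)
import Algebra.Morphism.RingMonomorphism as RingMonomorphism
import Algebra.Properties.Semiring.Sum as SemiringSum
open import Algebra.Structures using (IsCommutativeRing)
open import Data.Bool.Base using (Bool; true; false; if_then_else_; T; _∧_)
open import Data.Bool.Properties using (∧-conicalˡ; ∧-conicalʳ)
open import Data.Fin.Base using (Fin; zero; suc; punchIn)
open import Data.Fin.Permutation using (permutation)
open import Data.Fin.Properties using (any?; punchInᵢ≢i) renaming (_≟_ to _≟F_)
open import Data.Fin.Subset using (Subset; Nonempty; _∪_; _∩_; ∁; ∣_∣; ⊥) renaming (_∉_ to _∉ˢ_)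
open import Data.Fin.Subset.Properties using (nonempty?; Empty-unique; ∩-comm)
import Data.Integer.Base as ℤ
import Data.Integer.Properties as ℤ
open import Data.Integer.Base using (ℤ; 0ℤ; 1ℤ)
open import Data.Integer.Divisibility.Signed using (_∣_; divides; ∣m∣n⇒∣m+n; ∣-trans; *-monoʳ-∣)
open import Data.Integer.Tactic.RingSolver using (solve-∀)
open import Data.List.Base as List using (List; []; _∷_; _++_; map; filter; foldr; length; allFin; cartesianProductWith; take; drop)
open import Data.List.Membership.Propositional using (_∈_; find)
open import Data.List.Membership.Propositional.Properties using (∈-filter⁻; ∈-map⁻; ∈-cartesianProductWith⁻; ∈-∃++)
open import Data.List.Properties using (++-identityʳ; map-++; length-++; length-map; length-tabulate)
open import Data.List.Relation.Binary.Permutation.Propositional as ↭ using (_↭_)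
open import Data.List.Relation.Binary.Permutation.Propositional.Properties using (↭-length) renaming (shift to ↭-shift)
open import Data.List.Relation.Unary.All as All using (All; []; _∷_; all?)
import Data.List.Relation.Unary.All.Properties as All
open import Data.List.Relation.Unary.Any as Any using (here; there)
open import Data.Nat.Base as ℕ using (ℕ; zero; suc; _≤_; _<_; z≤n; s≤s)
import Data.Nat.Properties as ℕ
import Data.Nat.Tactic.RingSolver as ℕ-Solver
open import Data.Nat.Induction using (<-rec)
open import Data.Product.Base using (_×_; _,_; ∃-syntax; proj₁; proj₂)
open import Data.Sum.Base using (_⊎_; inj₁; inj₂)
open import Data.Unit.Base using (⊤; tt)
open import Data.Vec.Base as Vec using (Vec; []; _∷_; zipWith; lookup; replicate; tabulate; toList; _[_]≔_; here; there)
open import Data.Vec.Functional as Vector using (Vector; removeAt)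
open import Data.Vec.Properties using (≡-dec; lookup-zipWith; lookup-replicate; lookup∘tabulate; lookup∘update; lookup⇒[]=; []=⇒lookup)
open import Data.Vec.Relation.Binary.Pointwise.Inductive using (Pointwise; []; _∷_)
open import Data.Vec.Relation.Unary.All as VecAll using ([]; _∷_)
open import Defs
open import Function.Base using (_∘_; id)
open import Function.Bundles using (Inverse; mk⇔)
open import Relation.Binary.Definitions using (tri<; tri≈; tri>)
open import Relation.Binary.PropositionalEquality hiding ([_])
open import Relation.Nullary using (¬_; Dec; yes; no; contradiction; does)
open import Relation.Nullary.Decidable using (¬?; _×-dec_; _⊎-dec_; map′; dec-true; dec-false; does-⇔)
open import Relation.Unary using (Decidable)
open ≡-Reasoning

-- The constant 6 is where two limits meet. Seven columns bring the exponent of the torus to m + 6,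
-- and m is at least r. Six columns are the last case for an exact count, since the coordinate added
-- last then extends at most five vectors.
--
-- Convolution over components forces relative precision. With x = q - 1, a count of rank r is kept
-- as x^r P modulo x^(r + 6); for factors of ranks i and j the errors then combine to x^(i + j + 6).
-- This is why the count with few columns must be a multiple of x^m, m at least r, with a polynomial
-- cofactor, and not merely a polynomial in q.
--
-- One polynomial has to serve every field of every order. Each count therefore occurs twice: as a
-- sum over a given field, and as a `Polynomial` computed from combinatorial data that never mention
-- q; the lemmas with ⟦ ⟧ in their names equate the value of the second at q - 1 with the first.
--
-- Dimensions are compared by counting elements: cardinalities of subspaces are powers of q, and
-- equal powers have equal exponents.

module Sums where

  open import Data.Integer.Base using (+_; _+_; _-_; _*_; _^_; -_)
  open SemiringSum ℤ.+-*-semiring using (sum; sum-cong-≗; sum-permute; sum-remove; sum-replicate-zero)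

  -- Polynomials as coefficient lists

  infixl 6 _⊕_
  infixl 7 _⊗_

  _⊕_ : Polynomial → Polynomial → Polynomial
  []      ⊕ r       = r
  (a ∷ p) ⊕ []      = a ∷ p
  (a ∷ p) ⊕ (b ∷ r) = a + b ∷ p ⊕ r

  _⊗_ : Polynomial → Polynomial → Polynomial
  []      ⊗ r = []
  (a ∷ p) ⊗ r = map (a *_) r ⊕ (0ℤ ∷ p ⊗ r)

  const : ℤ → Polynomial
  const a = a ∷ []

  ⟦⊕⟧ : ∀ p r x → ⟦ p ⊕ r ⟧ x ≡ ⟦ p ⟧ x + ⟦ r ⟧ x
  ⟦⊕⟧ []      r       x = sym (ℤ.+-identityˡ _)
  ⟦⊕⟧ (a ∷ p) []      x = sym (ℤ.+-identityʳ (⟦ a ∷ p ⟧ x))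
  ⟦⊕⟧ (a ∷ p) (b ∷ r) x rewrite ⟦⊕⟧ p r x = lemma a b x (⟦ p ⟧ x) (⟦ r ⟧ x)
    where
    lemma : ∀ a b x u v → (a + b) + x * (u + v) ≡ (a + x * u) + (b + x * v)
    lemma = solve-∀

  ⟦map⟧ : ∀ a p x → ⟦ map (a *_) p ⟧ x ≡ a * ⟦ p ⟧ x
  ⟦map⟧ a []      x = sym (ℤ.*-zeroʳ a)
  ⟦map⟧ a (b ∷ p) x rewrite ⟦map⟧ a p x = lemma a b x (⟦ p ⟧ x)
    where
    lemma : ∀ a b x u → a * b + x * (a * u) ≡ a * (b + x * u)
    lemma = solve-∀

  ⟦⊗⟧ : ∀ p r x → ⟦ p ⊗ r ⟧ x ≡ ⟦ p ⟧ x * ⟦ r ⟧ x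
  ⟦⊗⟧ []      r x = sym (ℤ.*-zeroˡ (⟦ r ⟧ x))
  ⟦⊗⟧ (a ∷ p) r x rewrite ⟦⊕⟧ (map (a *_) r) (0ℤ ∷ p ⊗ r) x | ⟦map⟧ a r x | ⟦⊗⟧ p r x =
    lemma a x (⟦ p ⟧ x) (⟦ r ⟧ x)
    where
    lemma : ∀ a x u v → a * v + (0ℤ + x * (u * v)) ≡ (a + x * u) * v
    lemma = solve-∀

  ⟦const⟧ : ∀ a x → ⟦ const a ⟧ x ≡ a
  ⟦const⟧ = lemma
    where
    lemma : ∀ a x → a + x * 0ℤ ≡ a
    lemma = solve-∀

  -- q as a polynomial in q − 1
  𝐪 : Polynomial
  𝐪 = 1ℤ ∷ 1ℤ ∷ []

  ⟦𝐪⟧ : ∀ q → ⟦ 𝐪 ⟧ (q - 1ℤ) ≡ q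
  ⟦𝐪⟧ = lemma
    where
    lemma : ∀ q → 1ℤ + (q - 1ℤ) * (1ℤ + (q - 1ℤ) * 0ℤ) ≡ q
    lemma = solve-∀

  infixr 8 _↑_
  _↑_ : Polynomial → ℕ → Polynomial
  p ↑ zero  = const 1ℤ
  p ↑ suc n = p ⊗ p ↑ n

  ⟦↑⟧ : ∀ p n x → ⟦ p ↑ n ⟧ x ≡ ⟦ p ⟧ x ^ n
  ⟦↑⟧ p zero    x = ⟦const⟧ 1ℤ x
  ⟦↑⟧ p (suc n) x rewrite ⟦⊗⟧ p (p ↑ n) x | ⟦↑⟧ p n x = refl

  ⟦𝐪↑⟧ : ∀ q n → ⟦ 𝐪 ↑ n ⟧ (q - 1ℤ) ≡ q ^ n
  ⟦𝐪↑⟧ q n rewrite ⟦↑⟧ 𝐪 n (q - 1ℤ) | ⟦𝐪⟧ q = refl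

  -- This is (q^n - 1)/(q - 1), written in powers of q - 1. It is the source of the factor q - 1
  -- that each nonempty row contributes.
  geometric : ℕ → Polynomial
  geometric zero    = []
  geometric (suc n) = const 1ℤ ⊕ 𝐪 ⊗ geometric n

  ⟦geometric⟧ : ∀ q n → (q - 1ℤ) * ⟦ geometric n ⟧ (q - 1ℤ) ≡ q ^ n - 1ℤ
  ⟦geometric⟧ q zero    = ℤ.*-zeroʳ (q - 1ℤ)
  ⟦geometric⟧ q (suc n) = begin
    x * ⟦ const 1ℤ ⊕ 𝐪 ⊗ geometric n ⟧ x ≡⟨ cong (x *_) (trans (⟦⊕⟧ (const 1ℤ) (𝐪 ⊗ geometric n) x) (cong₂ _+_ (⟦const⟧ 1ℤ x) (trans (⟦⊗⟧ 𝐪 (geometric n) x) (cong (_* g) (⟦𝐪⟧ q))))) ⟩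
    x * (1ℤ + q * g) ≡⟨ lemma q g ⟩
    x + q * (x * g) ≡⟨ cong (λ z → x + q * z) (⟦geometric⟧ q n) ⟩
    x + q * (q ^ n - 1ℤ) ≡⟨ lemma′ q (q ^ n) ⟩
    q * q ^ n - 1ℤ ∎
    where
    x = q - 1ℤ
    g = ⟦ geometric n ⟧ x
    lemma : ∀ q g → (q - 1ℤ) * (1ℤ + q * g) ≡ (q - 1ℤ) + q * ((q - 1ℤ) * g)
    lemma = solve-∀
    lemma′ : ∀ q p → (q - 1ℤ) + q * (p - 1ℤ) ≡ q * p - 1ℤ
    lemma′ = solve-∀

  polyProduct : ∀ {A : Set} → List A → (A → Polynomial) → Polynomial
  polyProduct []       p = const 1ℤ
  polyProduct (a ∷ as) p = p a ⊗ polyProduct as p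

  ⟦take⟧ : ∀ k p x → ⟦ p ⟧ x ≡ ⟦ take k p ⟧ x + x ^ k * ⟦ drop k p ⟧ x
  ⟦take⟧ zero    p       x = sym (trans (ℤ.+-identityˡ _) (ℤ.*-identityˡ _))
  ⟦take⟧ (suc k) []      x = sym (trans (ℤ.+-identityˡ _) (ℤ.*-zeroʳ (x ^ suc k)))
  ⟦take⟧ (suc k) (a ∷ p) x rewrite ⟦take⟧ k p x = lemma a x (⟦ take k p ⟧ x) (x ^ k) (⟦ drop k p ⟧ x)
    where
    lemma : ∀ a x t y d → a + x * (t + y * d) ≡ (a + x * t) + (x * y) * d
    lemma = solve-∀

  coeff-take : ∀ k p i → k ≤ i → coeff (take k p) i ≡ 0ℤ
  coeff-take zero    p       i       _         = refl
  coeff-take (suc k) []      i       _         = refl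
  coeff-take (suc k) (a ∷ p) (suc i) (s≤s k≤i) = coeff-take k p i k≤i

  ⟦shift⟧ : ∀ k p x → ⟦ List.replicate k 0ℤ ++ p ⟧ x ≡ x ^ k * ⟦ p ⟧ x
  ⟦shift⟧ zero    p x = sym (ℤ.*-identityˡ _)
  ⟦shift⟧ (suc k) p x rewrite ⟦shift⟧ k p x = lemma x (x ^ k) (⟦ p ⟧ x)
    where
    lemma : ∀ x y z → 0ℤ + x * (y * z) ≡ (x * y) * z
    lemma = solve-∀

  -- Finite sums over lists

  Σ⟨_⟩ : ∀ {A : Set} → List A → (A → ℤ) → ℤ
  Σ⟨ [] ⟩     f = 0ℤ
  Σ⟨ a ∷ as ⟩ f = f a + Σ⟨ as ⟩ f

  Π⟨_⟩ : ∀ {A : Set} → List A → (A → ℤ) → ℤ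
  Π⟨ [] ⟩     f = 1ℤ
  Π⟨ a ∷ as ⟩ f = f a * Π⟨ as ⟩ f

  module _ {A : Set} where

    Σ-cong-∈ : ∀ (as : List A) {f g} → (∀ {a} → a ∈ as → f a ≡ g a) → Σ⟨ as ⟩ f ≡ Σ⟨ as ⟩ g
    Σ-cong-∈ []       e = refl
    Σ-cong-∈ (a ∷ as) e = cong₂ _+_ (e (here refl)) (Σ-cong-∈ as (e ∘ there))

    Σ-cong : ∀ (as : List A) {f g} → (∀ a → f a ≡ g a) → Σ⟨ as ⟩ f ≡ Σ⟨ as ⟩ g
    Σ-cong as e = Σ-cong-∈ as (λ {a} _ → e a)

    Σ-0 : ∀ (as : List A) → Σ⟨ as ⟩ (λ _ → 0ℤ) ≡ 0ℤ
    Σ-0 []       = refl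
    Σ-0 (a ∷ as) = trans (ℤ.+-identityˡ _) (Σ-0 as)

    Σ-+ : ∀ (as : List A) f g → Σ⟨ as ⟩ (λ a → f a + g a) ≡ Σ⟨ as ⟩ f + Σ⟨ as ⟩ g
    Σ-+ []       f g = refl
    Σ-+ (a ∷ as) f g rewrite Σ-+ as f g = lemma (f a) (g a) (Σ⟨ as ⟩ f) (Σ⟨ as ⟩ g)
      where
      lemma : ∀ a b c d → (a + b) + (c + d) ≡ (a + c) + (b + d)
      lemma = solve-∀

    Σ-*ˡ : ∀ (as : List A) c f → Σ⟨ as ⟩ (λ a → c * f a) ≡ c * Σ⟨ as ⟩ f
    Σ-*ˡ []       c f = sym (ℤ.*-zeroʳ c)
    Σ-*ˡ (a ∷ as) c f rewrite Σ-*ˡ as c f = sym (ℤ.*-distribˡ-+ c _ _)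

    Σ-*ʳ : ∀ (as : List A) c f → Σ⟨ as ⟩ (λ a → f a * c) ≡ Σ⟨ as ⟩ f * c
    Σ-*ʳ as c f = begin
      Σ⟨ as ⟩ (λ a → f a * c) ≡⟨ Σ-cong as (λ a → ℤ.*-comm (f a) c) ⟩
      Σ⟨ as ⟩ (λ a → c * f a) ≡⟨ Σ-*ˡ as c f ⟩
      c * Σ⟨ as ⟩ f ≡⟨ ℤ.*-comm c _ ⟩
      Σ⟨ as ⟩ f * c ∎

    Σ-neg : ∀ (as : List A) f → Σ⟨ as ⟩ (λ a → - f a) ≡ - Σ⟨ as ⟩ f
    Σ-neg []       f = refl
    Σ-neg (a ∷ as) f rewrite Σ-neg as f = sym (ℤ.neg-distrib-+ (f a) _)

    Σ-++ : ∀ (as bs : List A) f → Σ⟨ as ++ bs ⟩ f ≡ Σ⟨ as ⟩ f + Σ⟨ bs ⟩ f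
    Σ-++ []       bs f = sym (ℤ.+-identityˡ _)
    Σ-++ (a ∷ as) bs f rewrite Σ-++ as bs f = sym (ℤ.+-assoc (f a) _ _)

    Σ-map : ∀ {B : Set} (h : B → A) bs f → Σ⟨ map h bs ⟩ f ≡ Σ⟨ bs ⟩ (f ∘ h)
    Σ-map h []       f = refl
    Σ-map h (b ∷ bs) f = cong₂ _+_ {x = f (h b)} refl (Σ-map h bs f)

    Σ-∣ : ∀ (as : List A) {f} k → (∀ {a} → a ∈ as → k ∣ f a) → k ∣ Σ⟨ as ⟩ f
    Σ-∣ []       k d = divides 0ℤ (sym (ℤ.*-zeroˡ k))
    Σ-∣ (a ∷ as) k d = ∣m∣n⇒∣m+n (d (here refl)) (Σ-∣ as k (d ∘ there))

    Σ-tabulate : ∀ {n} (h : Fin n → A) f → Σ⟨ List.tabulate h ⟩ f ≡ sum (f ∘ h)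
    Σ-tabulate {zero}  h f = refl
    Σ-tabulate {suc n} h f = cong₂ _+_ {x = f (h zero)} refl (Σ-tabulate (h ∘ suc) f)

  Σ-const : ∀ {A : Set} (as : List A) c → Σ⟨ as ⟩ (λ _ → c) ≡ + length as * c
  Σ-const []       c = sym (ℤ.*-zeroˡ c)
  Σ-const (a ∷ as) c rewrite Σ-const as c = lemma c (+ length as)
    where
    lemma : ∀ c l → c + l * c ≡ (1ℤ + l) * c
    lemma = solve-∀

  Σ-comm : ∀ {A B : Set} (as : List A) (bs : List B) (f : A → B → ℤ) →
        Σ⟨ as ⟩ (λ a → Σ⟨ bs ⟩ (f a)) ≡ Σ⟨ bs ⟩ (λ b → Σ⟨ as ⟩ (λ a → f a b))
  Σ-comm []       bs f = sym (Σ-0 bs)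
  Σ-comm (a ∷ as) bs f rewrite Σ-comm as bs f = sym (Σ-+ bs (f a) _)

  Σ-× : ∀ {A B C : Set} (g : A → B → C) as bs (f : C → ℤ) →
        Σ⟨ cartesianProductWith g as bs ⟩ f ≡ Σ⟨ as ⟩ (λ a → Σ⟨ bs ⟩ (f ∘ g a))
  Σ-× g []       bs f = refl
  Σ-× g (a ∷ as) bs f = trans (Σ-++ (map (g a) bs) _ f) (cong₂ _+_ (Σ-map (g a) bs f) (Σ-× g as bs f))

  _⊠_ : ∀ {A : Set} {n} → List A → List (Vec A n) → List (Vec A (suc n))
  as ⊠ vs = cartesianProductWith _∷_ as vs

  power : ∀ {A : Set} → List A → ∀ n → List (Vec A n)
  power as zero    = [] ∷ []
  power as (suc n) = as ⊠ (power as n)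

  -- Indicators, and sums over Fin q

  [_] : ∀ {P : Set} → Dec P → ℤ
  [ d ] = if does d then 1ℤ else 0ℤ

  module _ {P : Set} where

    []-yes : (d : Dec P) → P → [ d ] ≡ 1ℤ
    []-yes d p rewrite dec-true d p = refl

    []-no : (d : Dec P) → ¬ P → [ d ] ≡ 0ℤ
    []-no d ¬p rewrite dec-false d ¬p = refl

    []-cong : ∀ {Q : Set} (d : Dec P) (e : Dec Q) → (P → Q) → (Q → P) → [ d ] ≡ [ e ]
    []-cong d (yes q) f g = []-yes d (g q)
    []-cong d (no ¬q) f g = []-no d (¬q ∘ f)

    []-× : ∀ {Q : Set} (d : Dec P) (e : Dec Q) → [ d ×-dec e ] ≡ [ d ] * [ e ]
    []-× (yes p) (yes q) = refl
    []-× (yes p) (no ¬q) = refl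
    []-× (no ¬p) e       = sym (ℤ.*-zeroˡ [ e ])

    []-¬ : (d : Dec P) → [ ¬? d ] + [ d ] ≡ 1ℤ
    []-¬ (yes p) = refl
    []-¬ (no ¬p) = refl

  Σ-filter : ∀ {A : Set} {P : A → Set} (P? : Decidable P) as (f : A → ℤ) →
        Σ⟨ filter P? as ⟩ f ≡ Σ⟨ as ⟩ (λ a → [ P? a ] * f a)
  Σ-filter P? []       f = refl
  Σ-filter P? (a ∷ as) f with P? a
  ... | yes _ = cong₂ _+_ (sym (ℤ.*-identityˡ (f a))) (Σ-filter P? as f)
  ... | no _  = trans (Σ-filter P? as f) (sym (trans (cong (_+ Σ⟨ as ⟩ (λ a → [ P? a ] * f a)) (ℤ.*-zeroˡ (f a))) (ℤ.+-identityˡ _)))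

  length-filter : ∀ {A : Set} {P : A → Set} (P? : Decidable P) as →
                  + length (filter P? as) ≡ Σ⟨ as ⟩ (λ a → [ P? a ])
  length-filter P? as = begin
    + length (filter P? as) ≡⟨ ℤ.*-identityʳ _ ⟨
    + length (filter P? as) * 1ℤ ≡⟨ Σ-const (filter P? as) 1ℤ ⟨
    Σ⟨ filter P? as ⟩ (λ _ → 1ℤ) ≡⟨ Σ-filter P? as _ ⟩
    Σ⟨ as ⟩ (λ a → [ P? a ] * 1ℤ) ≡⟨ Σ-cong as (λ a → ℤ.*-identityʳ [ P? a ]) ⟩
    Σ⟨ as ⟩ (λ a → [ P? a ]) ∎

  Σ-delta : ∀ {q} (a : Fin q) (f : Fin q → ℤ) → Σ⟨ allFin q ⟩ (λ c → [ c ≟F a ] * f c) ≡ f a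
  Σ-delta {suc q} a f = begin
    Σ⟨ allFin _ ⟩ t ≡⟨ Σ-tabulate id t ⟩
    sum t ≡⟨ sum-remove {i = a} t ⟩
    t a + sum (removeAt t a) ≡⟨ cong₂ _+_ (trans (cong (_* f a) ([]-yes (a ≟F a) refl)) (ℤ.*-identityˡ (f a)))
        (trans (sum-cong-≗ (λ i → trans (cong (_* f (punchIn a i)) ([]-no (punchIn a i ≟F a) (punchInᵢ≢i a i))) (ℤ.*-zeroˡ (f (punchIn a i))))) (sum-replicate-zero q)) ⟩
    f a + 0ℤ ≡⟨ ℤ.+-identityʳ _ ⟩
    f a ∎
    where
    t : Fin (suc q) → ℤ
    t c = [ c ≟F a ] * f c

  Σ-unique : ∀ {q} {P : Fin q → Set} (P? : Decidable P) (a : Fin q) → P a → (∀ c → P c → c ≡ a) →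
             ∀ (f : Fin q → ℤ) → Σ⟨ allFin q ⟩ (λ c → [ P? c ] * f c) ≡ f a
  Σ-unique P? a pa uniq f = trans
    (Σ-cong (allFin _) (λ c → cong (_* f c) ([]-cong (P? c) (c ≟F a) (uniq c) (λ { refl → pa }))))
    (Σ-delta a f)

  Σ-permute : ∀ {q} (g h : Fin q → Fin q) → (∀ c → g (h c) ≡ c) → (∀ c → h (g c) ≡ c) →
              ∀ (f : Fin q → ℤ) → Σ⟨ allFin q ⟩ (f ∘ g) ≡ Σ⟨ allFin q ⟩ f
  Σ-permute g h gh hg f = begin
    Σ⟨ allFin _ ⟩ (f ∘ g) ≡⟨ Σ-tabulate id (f ∘ g) ⟩
    sum (f ∘ g) ≡⟨ sum-permute f (permutation g h gh hg) ⟨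
    sum f ≡⟨ Σ-tabulate id f ⟨
    Σ⟨ allFin _ ⟩ f ∎

open Sums

-- Finite fields, vectors and subspaces

-- The carrier is `Fin q` with propositional equality, so that vectors have decidable equality and a
-- sum over the field is a sum over `allFin q`. `Transport.transport` brings a `FiniteField q` into
-- this form.
record Field (q : ℕ) : Set where
  infixl 6 _+_
  infixl 7 _*_
  infix  8 -_
  field
    _+_ _*_           : Fin q → Fin q → Fin q
    -_                : Fin q → Fin q
    0# 1#             : Fin q
    isCommutativeRing : IsCommutativeRing _≡_ _+_ _*_ -_ 0# 1#
    inverse           : ∀ {a} → a ≢ 0# → ∃[ b ] b * a ≡ 1#
    1≢0               : 1# ≢ 0#

  commutativeRing : CommutativeRing _ _
  commutativeRing = record { isCommutativeRing = isCommutativeRing }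

module Linear {q : ℕ} (F : Field q) where

  open Field F public
  open CommutativeRing commutativeRing public
    using (+-identityˡ; +-identityʳ; +-comm; +-assoc; *-identityˡ; *-identityʳ; *-comm; *-assoc; zeroˡ; zeroʳ; -‿inverseˡ; -‿inverseʳ; distribˡ; distribʳ; commutativeSemiring; ring)
  open import Algebra.Properties.Ring ring using (-‿involutive)
  open import Algebra.Solver.Ring.NaturalCoefficients.Default commutativeSemiring using (solve; _:=_; _:+_; _:*_)

  K : Set
  K = Fin q

  _≟ᴷ_ : (a b : K) → Dec (a ≡ b)
  _≟ᴷ_ = _≟F_

  V : ℕ → Set
  V n = Vec K n

  _≟ⱽ_ : ∀ {n} (v w : V n) → Dec (v ≡ w)
  _≟ⱽ_ = ≡-dec _≟F_

  𝟎 : ∀ {n} → V n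
  𝟎 = replicate _ 0#

  +-*-neg : ∀ a c b → a + c * b + - c * b ≡ a
  +-*-neg a c b = begin
    a + c * b + - c * b ≡⟨ solve 4 (λ a c d b → a :+ c :* b :+ d :* b := a :+ (c :+ d) :* b) refl a c (- c) b ⟩
    a + (c + - c) * b ≡⟨ cong (λ z → a + z * b) (-‿inverseʳ c) ⟩
    a + 0# * b ≡⟨ cong (a +_) (zeroˡ b) ⟩
    a + 0# ≡⟨ +-identityʳ a ⟩
    a ∎

  +-neg-* : ∀ a c b → a + - c * b + c * b ≡ a
  +-neg-* a c b = subst (λ z → a + - c * b + z * b ≡ a) (-‿involutive c) (+-*-neg a (- c) b)

  *-cancelˡ-0 : ∀ {a b} → a ≢ 0# → a * b ≡ 0# → b ≡ 0#
  *-cancelˡ-0 {a} {b} a≢0 e with inverse a≢0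
  ... | a⁻¹ , a⁻¹a≡1 = begin
    b ≡⟨ *-identityˡ b ⟨
    1# * b ≡⟨ cong (_* b) a⁻¹a≡1 ⟨
    a⁻¹ * a * b ≡⟨ *-assoc a⁻¹ a b ⟩
    a⁻¹ * (a * b) ≡⟨ cong (a⁻¹ *_) e ⟩
    a⁻¹ * 0# ≡⟨ zeroʳ a⁻¹ ⟩
    0# ∎

  -1≢0 : - 1# ≢ 0#
  -1≢0 e = 1≢0 (trans (sym (+-identityʳ 1#)) (trans (cong (1# +_) (sym e)) (-‿inverseʳ 1#)))

  -- Vectors: the single operation v ∔ c ∙ w = v + c w suffices.

  infixl 6 _∔_∙_
  _∔_∙_ : ∀ {n} → V n → K → V n → V n
  v ∔ c ∙ w = zipWith (λ a b → a + c * b) v w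

  ∔-∙-neg : ∀ {n} (v : V n) c w → v ∔ c ∙ w ∔ - c ∙ w ≡ v
  ∔-∙-neg []      c []      = refl
  ∔-∙-neg (a ∷ v) c (b ∷ w) = cong₂ _∷_ (+-*-neg a c b) (∔-∙-neg v c w)

  ∔-neg-∙ : ∀ {n} (v : V n) c w → v ∔ - c ∙ w ∔ c ∙ w ≡ v
  ∔-neg-∙ []      c []      = refl
  ∔-neg-∙ (a ∷ v) c (b ∷ w) = cong₂ _∷_ (+-neg-* a c b) (∔-neg-∙ v c w)

  ∔-0 : ∀ {n} (v w : V n) → v ∔ 0# ∙ w ≡ v
  ∔-0 []      []      = refl
  ∔-0 (a ∷ v) (b ∷ w) = cong₂ _∷_ (trans (cong (a +_) (zeroˡ b)) (+-identityʳ a)) (∔-0 v w)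

  ∔-𝟎 : ∀ {n} (v : V n) c → v ∔ c ∙ 𝟎 ≡ v
  ∔-𝟎 []      c = refl
  ∔-𝟎 (a ∷ v) c = cong₂ _∷_ (trans (cong (a +_) (zeroʳ c)) (+-identityʳ a)) (∔-𝟎 v c)

  𝟎-∔ : ∀ {n} (v : V n) → 𝟎 ∔ 1# ∙ v ≡ v
  𝟎-∔ []      = refl
  𝟎-∔ (a ∷ v) = cong₂ _∷_ (trans (+-identityˡ _) (*-identityˡ a)) (𝟎-∔ v)

  ∔-self : ∀ {n} (v : V n) → v ∔ - 1# ∙ v ≡ 𝟎
  ∔-self []      = refl
  ∔-self (a ∷ v) = cong₂ _∷_
    (trans (cong (_+ - 1# * a) (sym (*-identityˡ a)))
      (trans (sym (distribʳ a 1# (- 1#))) (trans (cong (_* a) (-‿inverseʳ 1#)) (zeroˡ a))))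
    (∔-self v)

  ∔-swap : ∀ {n} (v : V n) a x b y → v ∔ a ∙ x ∔ b ∙ y ≡ v ∔ b ∙ y ∔ a ∙ x
  ∔-swap []      a []      b []      = refl
  ∔-swap (c ∷ v) a (d ∷ x) b (e ∷ y) = cong₂ _∷_
    (solve 5 (λ c a d b e → c :+ a :* d :+ b :* e := c :+ b :* e :+ a :* d) refl c a d b e)
    (∔-swap v a x b y)

  ∔-nest : ∀ {n} (v : V n) c w b x → v ∔ c ∙ (w ∔ b ∙ x) ≡ v ∔ c ∙ w ∔ c * b ∙ x
  ∔-nest []      c []      b []      = refl
  ∔-nest (d ∷ v) c (e ∷ w) b (f ∷ x) = cong₂ _∷_
    (solve 5 (λ d c e b f → d :+ c :* (e :+ b :* f) := d :+ c :* e :+ c :* b :* f) refl d c e b f)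
    (∔-nest v c w b x)

  ∔-merge : ∀ {n} (v : V n) a b x → v ∔ a ∙ x ∔ b ∙ x ≡ v ∔ (a + b) ∙ x
  ∔-merge []      a b []      = refl
  ∔-merge (d ∷ v) a b (e ∷ x) = cong₂ _∷_
    (solve 4 (λ d a b e → d :+ a :* e :+ b :* e := d :+ (a :+ b) :* e) refl d a b e)
    (∔-merge v a b x)

  dot : ∀ {n} → V n → V n → K
  dot []      []      = 0#
  dot (a ∷ v) (b ∷ w) = a * b + dot v w

  dot-∔ : ∀ {n} (u v : V n) c w → dot u (v ∔ c ∙ w) ≡ dot u v + c * dot u w
  dot-∔ []      []      c []      = sym (trans (+-identityˡ _) (zeroʳ c))
  dot-∔ (x ∷ u) (a ∷ v) c (b ∷ w) rewrite dot-∔ u v c w =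
    solve 6 (λ x a c b s t → x :* (a :+ c :* b) :+ (s :+ c :* t) := x :* a :+ s :+ c :* (x :* b :+ t))
      refl x a c b (dot u v) (dot u w)

  dot-𝟎 : ∀ {n} (u : V n) → dot u 𝟎 ≡ 0#
  dot-𝟎 []      = refl
  dot-𝟎 (a ∷ u) = trans (cong₂ _+_ (zeroʳ a) (dot-𝟎 u)) (+-identityˡ 0#)

  scalars : List K
  scalars = allFin q

  vecs : ∀ n → List (V n)
  vecs n = power scalars n

  Σ-∷ : ∀ n (f : V (suc n) → ℤ) →
        Σ⟨ vecs (suc n) ⟩ f ≡ Σ⟨ scalars ⟩ (λ c → Σ⟨ vecs n ⟩ (λ v → f (c ∷ v)))
  Σ-∷ n = Σ-× _∷_ scalars (vecs n)

  Σ-translate : ∀ n (c : K) (u : V n) (f : V n → ℤ) →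
        Σ⟨ vecs n ⟩ (λ v → f (v ∔ c ∙ u)) ≡ Σ⟨ vecs n ⟩ f
  Σ-translate zero    c []      f = refl
  Σ-translate (suc n) c (b ∷ u) f = begin
    Σ⟨ vecs (suc n) ⟩ (λ v → f (v ∔ c ∙ (b ∷ u))) ≡⟨ Σ-∷ n _ ⟩
    Σ⟨ scalars ⟩ (λ a → Σ⟨ vecs n ⟩ (λ v → f (a + c * b ∷ v ∔ c ∙ u))) ≡⟨ Σ-cong scalars (λ a → Σ-translate n c u _) ⟩
    Σ⟨ scalars ⟩ (λ a → Σ⟨ vecs n ⟩ (λ v → f (a + c * b ∷ v))) ≡⟨ Σ-permute (λ a → a + c * b) (λ a → a + - c * b) (λ a → +-neg-* a c b) (λ a → +-*-neg a c b) (λ a → Σ⟨ vecs n ⟩ (λ v → f (a ∷ v))) ⟩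
    Σ⟨ scalars ⟩ (λ a → Σ⟨ vecs n ⟩ (λ v → f (a ∷ v))) ≡⟨ Σ-∷ n f ⟨
    Σ⟨ vecs (suc n) ⟩ f ∎

  any-vector? : ∀ n {P : V n → Set} → Decidable P → Dec (∃[ v ] P v)
  any-vector? zero    P? with P? []
  ... | yes p = yes ([] , p)
  ... | no ¬p = no λ { ([] , p) → ¬p p }
  any-vector? (suc n) P? with any? (λ c → any-vector? n (λ v → P? (c ∷ v)))
  ... | yes (c , v , p) = yes (c ∷ v , p)
  ... | no ¬p           = no λ { (c ∷ v , p) → ¬p (c , v , p) }

  -- Subspaces

  record Subspace (n : ℕ) : Set₁ where
    infix 4 _∋_ _∋?_
    field
      _∋_    : V n → Set
      _∋?_   : Decidable _∋_
      zero∈  : _∋_ 𝟎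
      closed : ∀ c {v w} → _∋_ v → _∋_ w → _∋_ (v ∔ c ∙ w)

    cancel : ∀ c {v w} → _∋_ w → _∋_ (v ∔ c ∙ w) → _∋_ v
    cancel c {v} {w} w∈ vw∈ = subst _∋_ (∔-∙-neg v c w) (closed (- c) vw∈ w∈)

    scale : ∀ c {v} → _∋_ v → _∋_ (𝟎 ∔ c ∙ v)
    scale c = closed c zero∈

    unscale : ∀ {c v} → c ≢ 0# → _∋_ (𝟎 ∔ c ∙ v) → _∋_ v
    unscale {c} {v} c≢0 cv∈ with inverse c≢0
    ... | b , bc≡1 = subst _∋_ eq (scale b cv∈)
      where
      eq : 𝟎 ∔ b ∙ (𝟎 ∔ c ∙ v) ≡ v
      eq = begin
        𝟎 ∔ b ∙ (𝟎 ∔ c ∙ v) ≡⟨ ∔-nest 𝟎 b 𝟎 c v ⟩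
        𝟎 ∔ b ∙ 𝟎 ∔ b * c ∙ v ≡⟨ cong₂ (λ z s → z ∔ s ∙ v) (∔-𝟎 𝟎 b) bc≡1 ⟩
        𝟎 ∔ 1# ∙ v ≡⟨ 𝟎-∔ v ⟩
        v ∎

  open Subspace public

  card : ∀ {n} → Subspace n → ℤ
  card {n} U = Σ⟨ vecs n ⟩ (λ v → [ _∋?_ U v ])

  _⋒_ : ∀ {n} → Subspace n → Subspace n → Subspace n
  U ⋒ W = record
    { _∋_    = λ v → U ∋ v × W ∋ v
    ; _∋?_   = λ v → (U ∋? v) ×-dec (W ∋? v)
    ; zero∈  = zero∈ U , zero∈ W
    ; closed = λ c (u , w) (u′ , w′) → closed U c u u′ , closed W c w w′
    }

  card-cong : ∀ {n} (U W : Subspace n) → (∀ {v} → U ∋ v → W ∋ v) → (∀ {v} → W ∋ v → U ∋ v) → card U ≡ card W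
  card-cong {n} U W f g = Σ-cong (vecs n) (λ v → []-cong (U ∋? v) (W ∋? v) f g)

  -- Counting pairs (u , w) by their sum: every element of U + W has card (U ∩ W) representations.
  card-modular : ∀ {n} (U W S : Subspace n) →
    (∀ {v} → S ∋ v → ∃[ u ] U ∋ u × W ∋ (v ∔ - 1# ∙ u)) →
    (∀ {u w} → U ∋ u → W ∋ w → S ∋ (w ∔ 1# ∙ u)) →
    card (U ⋒ W) ℤ.* card S ≡ card U ℤ.* card W
  card-modular {n} U W S split sum∈ = sym (begin
    card U ℤ.* card W ≡⟨ Σ-*ʳ vs (card W) _ ⟨
    Σ⟨ vs ⟩ (λ u → [ U ∋? u ] ℤ.* card W) ≡⟨ Σ-cong vs (λ u → cong ([ U ∋? u ] ℤ.*_) (sym (Σ-translate n (- 1#) u _))) ⟩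
    Σ⟨ vs ⟩ (λ u → [ U ∋? u ] ℤ.* Σ⟨ vs ⟩ (λ v → [ W ∋? (v ∔ - 1# ∙ u) ])) ≡⟨ Σ-cong vs (λ u → sym (Σ-*ˡ vs [ U ∋? u ] (λ v → [ W ∋? (v ∔ - 1# ∙ u) ]))) ⟩
    Σ⟨ vs ⟩ (λ u → Σ⟨ vs ⟩ (λ v → g v u)) ≡⟨ Σ-comm vs vs _ ⟩
    Σ⟨ vs ⟩ (λ v → Σ⟨ vs ⟩ (g v)) ≡⟨ Σ-cong vs fibre ⟩
    Σ⟨ vs ⟩ (λ v → card (U ⋒ W) ℤ.* [ S ∋? v ]) ≡⟨ Σ-*ˡ vs (card (U ⋒ W)) _ ⟩
    card (U ⋒ W) ℤ.* card S ∎)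
    where
    vs = vecs n
    g : V n → V n → ℤ
    g v u = [ U ∋? u ] ℤ.* [ W ∋? (v ∔ - 1# ∙ u) ]
    fibre : ∀ v → Σ⟨ vs ⟩ (g v) ≡ card (U ⋒ W) ℤ.* [ S ∋? v ]
    fibre v with S ∋? v
    ... | no v∉S = trans (trans (Σ-cong vs vanish) (Σ-0 vs)) (sym (ℤ.*-zeroʳ (card (U ⋒ W))))
      where
      vanish : ∀ u → g v u ≡ 0ℤ
      vanish u = trans (sym ([]-× (U ∋? u) (W ∋? (v ∔ - 1# ∙ u))))
        ([]-no ((U ∋? u) ×-dec (W ∋? (v ∔ - 1# ∙ u)))
        (λ (u∈ , w∈) → v∉S (subst (S ∋_) (∔-neg-∙ v 1# u) (sum∈ u∈ w∈))))
    ... | yes v∈S with split v∈S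
    -- One representation of v is known; translating the summation variable by u identifies all of
    -- them with U ∩ W.
    ... | u , u∈ , w∈ = trans (trans (sym (Σ-translate n 1# u (g v))) (Σ-cong vs shift)) (sym (ℤ.*-identityʳ (card (U ⋒ W))))
      where
      w = v ∔ - 1# ∙ u
      eq : ∀ z → v ∔ - 1# ∙ (z ∔ 1# ∙ u) ≡ w ∔ - 1# ∙ z
      eq z = begin
        v ∔ - 1# ∙ (z ∔ 1# ∙ u) ≡⟨ ∔-nest v (- 1#) z 1# u ⟩
        v ∔ - 1# ∙ z ∔ - 1# * 1# ∙ u ≡⟨ cong (λ s → v ∔ - 1# ∙ z ∔ s ∙ u) (*-identityʳ (- 1#)) ⟩
        v ∔ - 1# ∙ z ∔ - 1# ∙ u ≡⟨ ∔-swap v (- 1#) z (- 1#) u ⟩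
        w ∔ - 1# ∙ z ∎
      from-shift : ∀ z → W ∋ (w ∔ - 1# ∙ z) → W ∋ z
      from-shift z p = unscale W -1≢0 (subst (W ∋_) lem (closed W (- 1#) p w∈))
        where
        lem : w ∔ - 1# ∙ z ∔ - 1# ∙ w ≡ 𝟎 ∔ - 1# ∙ z
        lem = trans (∔-swap w (- 1#) z (- 1#) w) (cong (_∔ - 1# ∙ z) (∔-self w))
      shift : ∀ z → g v (z ∔ 1# ∙ u) ≡ [ (U ⋒ W) ∋? z ]
      shift z = trans (sym ([]-× (U ∋? (z ∔ 1# ∙ u)) (W ∋? (v ∔ - 1# ∙ (z ∔ 1# ∙ u)))))
        ([]-cong ((U ∋? (z ∔ 1# ∙ u)) ×-dec (W ∋? (v ∔ - 1# ∙ (z ∔ 1# ∙ u)))) ((U ⋒ W) ∋? z)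
        (λ (a , b) → cancel U 1# u∈ a , from-shift z (subst (W ∋_) (eq z) b))
        (λ (a , b) → closed U 1# a u∈ , subst (W ∋_) (sym (eq z)) (closed W (- 1#) w∈ b)))

  -- The difference of the two points is (a - b) x, and a nonzero multiple of x would put x into L.
  translate-unique : ∀ {n} (L : Subspace n) {x} → ¬ L ∋ x → ∀ v {a b} → L ∋ (v ∔ a ∙ x) → L ∋ (v ∔ b ∙ x) → a ≡ b
  translate-unique L {x} x∉ v {a} {b} p r with (a + - 1# * b) ≟ᴷ 0#
  ... | yes e = trans (sym (+-neg-* a 1# b)) (trans (cong (_+ 1# * b) e) (trans (+-identityˡ _) (*-identityˡ b)))
  ... | no ne = contradiction (unscale L ne (subst (L ∋_) eq (closed L (- 1#) p r))) x∉
    where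
    eq : v ∔ a ∙ x ∔ - 1# ∙ (v ∔ b ∙ x) ≡ 𝟎 ∔ (a + - 1# * b) ∙ x
    eq = begin
      v ∔ a ∙ x ∔ - 1# ∙ (v ∔ b ∙ x) ≡⟨ ∔-nest (v ∔ a ∙ x) (- 1#) v b x ⟩
      v ∔ a ∙ x ∔ - 1# ∙ v ∔ - 1# * b ∙ x ≡⟨ cong (_∔ - 1# * b ∙ x) (trans (∔-swap v a x (- 1#) v) (cong (_∔ a ∙ x) (∔-self v))) ⟩
      𝟎 ∔ a ∙ x ∔ - 1# * b ∙ x ≡⟨ ∔-merge 𝟎 a (- 1# * b) x ⟩
      𝟎 ∔ (a + - 1# * b) ∙ x ∎

  Σ-translates : ∀ {n} (L : Subspace n) {x} → ¬ L ∋ x → ∀ v (d : Dec (∃[ c ] L ∋ (v ∔ c ∙ x))) →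
        Σ⟨ scalars ⟩ (λ c → [ L ∋? (v ∔ c ∙ x) ]) ≡ [ d ]
  Σ-translates L {x} x∉ v (no ∄c) = trans (Σ-cong scalars (λ c → []-no (L ∋? (v ∔ c ∙ x)) (λ p → ∄c (c , p)))) (Σ-0 scalars)
  Σ-translates L {x} x∉ v (yes (c , p)) = trans (Σ-cong scalars (λ c → sym (ℤ.*-identityʳ [ L ∋? (v ∔ c ∙ x) ])))
    (Σ-unique (λ c → L ∋? (v ∔ c ∙ x)) c p (λ b r → translate-unique L x∉ v r p) (λ _ → 1ℤ))

-- Gaussian binomials, dimension and echelon forms

-- The q-binomial coefficient as a polynomial in q - 1. Of the two q-Pascal recursions this is the
-- one that follows `echelons`: the first column is either free or a pivot.
gaussian : ℕ → ℕ → Polynomial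
gaussian zero    zero    = const 1ℤ
gaussian zero    (suc k) = []
gaussian (suc l) zero    = gaussian l zero
gaussian (suc l) (suc k) = 𝐪 ↑ suc k ⊗ gaussian l (suc k) ⊕ gaussian l k

⟦gaussian⟧-> : ∀ l k x → l < k → ⟦ gaussian l k ⟧ x ≡ 0ℤ
⟦gaussian⟧-> zero    (suc k) x _         = refl
⟦gaussian⟧-> (suc l) (suc k) x (s≤s l<k) = begin
  ⟦ 𝐪 ↑ suc k ⊗ gaussian l (suc k) ⊕ gaussian l k ⟧ x ≡⟨ ⟦⊕⟧ (𝐪 ↑ suc k ⊗ gaussian l (suc k)) _ x ⟩
  ⟦ 𝐪 ↑ suc k ⊗ gaussian l (suc k) ⟧ x ℤ.+ ⟦ gaussian l k ⟧ x ≡⟨ cong₂ ℤ._+_ (⟦⊗⟧ (𝐪 ↑ suc k) _ x) (⟦gaussian⟧-> l k x l<k) ⟩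
  ⟦ 𝐪 ↑ suc k ⟧ x ℤ.* ⟦ gaussian l (suc k) ⟧ x ℤ.+ 0ℤ ≡⟨ ℤ.+-identityʳ _ ⟩
  ⟦ 𝐪 ↑ suc k ⟧ x ℤ.* ⟦ gaussian l (suc k) ⟧ x ≡⟨ cong (⟦ 𝐪 ↑ suc k ⟧ x ℤ.*_) (⟦gaussian⟧-> l (suc k) x (ℕ.m<n⇒m<1+n l<k)) ⟩
  ⟦ 𝐪 ↑ suc k ⟧ x ℤ.* 0ℤ ≡⟨ ℤ.*-zeroʳ (⟦ 𝐪 ↑ suc k ⟧ x) ⟩
  0ℤ ∎

⟦gaussian⟧-≡ : ∀ l x → ⟦ gaussian l l ⟧ x ≡ 1ℤ
⟦gaussian⟧-≡ zero    x = ⟦const⟧ 1ℤ x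
⟦gaussian⟧-≡ (suc l) x = begin
  ⟦ 𝐪 ↑ suc l ⊗ gaussian l (suc l) ⊕ gaussian l l ⟧ x ≡⟨ ⟦⊕⟧ (𝐪 ↑ suc l ⊗ gaussian l (suc l)) _ x ⟩
  ⟦ 𝐪 ↑ suc l ⊗ gaussian l (suc l) ⟧ x ℤ.+ ⟦ gaussian l l ⟧ x ≡⟨ cong₂ ℤ._+_ (⟦⊗⟧ (𝐪 ↑ suc l) _ x) (⟦gaussian⟧-≡ l x) ⟩
  ⟦ 𝐪 ↑ suc l ⟧ x ℤ.* ⟦ gaussian l (suc l) ⟧ x ℤ.+ 1ℤ ≡⟨ cong (λ z → ⟦ 𝐪 ↑ suc l ⟧ x ℤ.* z ℤ.+ 1ℤ) (⟦gaussian⟧-> l (suc l) x ℕ.≤-refl) ⟩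
  ⟦ 𝐪 ↑ suc l ⟧ x ℤ.* 0ℤ ℤ.+ 1ℤ ≡⟨ cong (ℤ._+ 1ℤ) (ℤ.*-zeroʳ (⟦ 𝐪 ↑ suc l ⟧ x)) ⟩
  1ℤ ∎

private
  pos-^ : ∀ q n → (ℤ.+ q) ℤ.^ n ≡ ℤ.+ (q ℕ.^ n)
  pos-^ q zero    = refl
  pos-^ q (suc n) = trans (cong ((ℤ.+ q) ℤ.*_) (pos-^ q n)) (sym (ℤ.pos-* q _))

module Dimension {q : ℕ} (F : Field q) where

  open Linear F public

  𝒒 : ℤ
  𝒒 = ℤ.+ q

  1<q : 1 < q
  1<q = lemma 1≢0
    where
    lemma : ∀ {n} {a b : Fin n} → a ≢ b → 1 < n
    lemma {suc zero}    {zero} {zero} a≢b = contradiction refl a≢b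
    lemma {suc (suc n)} _ = s≤s (s≤s z≤n)

  -- Dimension formulas are derived through this: equate cardinalities, written as powers of q, and
  -- compare exponents.
  ^-injective : ∀ a b → 𝒒 ℤ.^ a ≡ 𝒒 ℤ.^ b → a ≡ b
  ^-injective a b e with ℕ.<-cmp a b
  ... | tri≈ _ a≡b _ = a≡b
  ... | tri< a<b _ _ = contradiction (ℤ.+-injective (trans (sym (pos-^ q a)) (trans e (pos-^ q b)))) (ℕ.<⇒≢ (ℕ.^-monoʳ-< q 1<q a<b))
  ... | tri> _ _ b<a = contradiction (ℤ.+-injective (trans (sym (pos-^ q b)) (trans (sym e) (pos-^ q a)))) (ℕ.<⇒≢ (ℕ.^-monoʳ-< q 1<q b<a))

  ^-cancelʳ : ∀ n {a b} → a ℤ.* 𝒒 ℤ.^ n ≡ b ℤ.* 𝒒 ℤ.^ n → a ≡ b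
  ^-cancelʳ n {a} {b} e = ℤ.*-cancelʳ-≡ a b (𝒒 ℤ.^ n) ⦃ subst ℤ.NonZero (sym (pos-^ q n)) (ℕ.m^n≢0 q n ⦃ ℕ.>-nonZero (ℕ.<-trans (s≤s z≤n) 1<q) ⦄) ⦄ e

  Σ-scalars-const : ∀ c → Σ⟨ scalars ⟩ (λ _ → c) ≡ 𝒒 ℤ.* c
  Σ-scalars-const c = trans (Σ-const scalars c) (cong (λ n → (ℤ.+ n) ℤ.* c) (length-tabulate {n = q} id))
    where open import Data.List.Properties using (length-tabulate)

  Σ-vectors-const : ∀ n c → Σ⟨ vecs n ⟩ (λ _ → c) ≡ 𝒒 ℤ.^ n ℤ.* c
  Σ-vectors-const zero    c = trans (ℤ.+-identityʳ c) (sym (ℤ.*-identityˡ c))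
  Σ-vectors-const (suc n) c = begin
    Σ⟨ vecs (suc n) ⟩ (λ _ → c) ≡⟨ Σ-∷ n _ ⟩
    Σ⟨ scalars ⟩ (λ _ → Σ⟨ vecs n ⟩ (λ _ → c)) ≡⟨ Σ-scalars-const _ ⟩
    𝒒 ℤ.* Σ⟨ vecs n ⟩ (λ _ → c) ≡⟨ cong (𝒒 ℤ.*_) (Σ-vectors-const n c) ⟩
    𝒒 ℤ.* (𝒒 ℤ.^ n ℤ.* c) ≡⟨ ℤ.*-assoc 𝒒 (𝒒 ℤ.^ n) c ⟨
    𝒒 ℤ.^ suc n ℤ.* c ∎

  -- Subspaces of Kⁿ of dimension d as row spaces of echelon matrices; the d × n matrix is
  -- listed by its columns, and a pivot column adds a new first coordinate.

  pivot : ∀ {d n} → Vec (V d) n → Vec (V (suc d)) (suc n)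
  pivot X = (1# ∷ 𝟎) ∷ Vec.map (0# ∷_) X

  echelons : ∀ d n → List (Vec (V d) n)
  echelons zero    zero    = [] ∷ []
  echelons (suc d) zero    = []
  echelons zero    (suc n) = (vecs zero) ⊠ (echelons zero n)
  echelons (suc d) (suc n) = (vecs (suc d)) ⊠ (echelons (suc d) n) ++ map pivot (echelons d n)

  rows : ∀ {d n} → Vec (V d) n → Vec (V n) d
  rows []      = replicate _ []
  rows (φ ∷ X) = zipWith _∷_ φ (rows X)

  rows-map-0 : ∀ {d n} (X : Vec (V d) n) → rows (Vec.map (0# ∷_) X) ≡ 𝟎 ∷ rows X
  rows-map-0 []      = refl
  rows-map-0 (φ ∷ X) rewrite rows-map-0 X = refl

  data Supported : ∀ {n} → Subset n → V n → Set where
    []  : Supported [] []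
    on  : ∀ {n} {S : Subset n} {v a} → Supported S v → Supported (true ∷ S) (a ∷ v)
    off : ∀ {n} {S : Subset n} {v} → Supported S v → Supported (false ∷ S) (0# ∷ v)

  e₀ : ∀ {n} → V (suc n)
  e₀ = 1# ∷ 𝟎

  head-change : ∀ {n} a b (v : V n) → (a ∷ v) ∔ (b + - a) ∙ e₀ ≡ b ∷ v
  head-change a b v = cong₂ _∷_
    (trans (cong (a +_) (*-identityʳ _)) (trans (+-comm a _) (trans (+-assoc b (- a) a) (trans (cong (b +_) (-‿inverseˡ a)) (+-identityʳ b)))))
    (∔-𝟎 v _)

  head-∙ : ∀ {n} a (v : V n) → (0# ∷ v) ∔ a ∙ e₀ ≡ a ∷ v
  head-∙ a v = cong₂ _∷_ (trans (+-identityˡ _) (*-identityʳ a)) (∔-𝟎 v a)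

  head-unique : ∀ {n} (L : Subspace (suc n)) → ¬ L ∋ e₀ → ∀ {a b v} → L ∋ (a ∷ v) → L ∋ (b ∷ v) → a ≡ b
  head-unique L e₀∉ {a} {b} {v} p r = translate-unique L e₀∉ (0# ∷ v) (subst (L ∋_) (sym (head-∙ a v)) p) (subst (L ∋_) (sym (head-∙ b v)) r)

  module _ {n} (L : Subspace (suc n)) where

    -- If `e₀` lies in L, then L is the sum of the line of `e₀` and this subspace; otherwise
    -- dropping the first coordinate maps L bijectively onto `tails`. `dimension` recurses along
    -- this dichotomy.
    tail-of-0 : Subspace n
    tail-of-0 = record
      { _∋_    = λ v → L ∋ (0# ∷ v)
      ; _∋?_   = λ v → L ∋? (0# ∷ v)
      ; zero∈  = zero∈ L
      ; closed = λ c {v} {w} v∈ w∈ → subst (λ a → L ∋ (a ∷ v ∔ c ∙ w)) (trans (+-identityˡ _) (zeroʳ c)) (closed L c v∈ w∈)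
      }

    tails : Subspace n
    tails = record
      { _∋_    = λ v → ∃[ a ] L ∋ (a ∷ v)
      ; _∋?_   = λ v → any? (λ a → L ∋? (a ∷ v))
      ; zero∈  = 0# , zero∈ L
      ; closed = λ c (a , v∈) (b , w∈) → a + c * b , closed L c v∈ w∈
      }

  Σ-head : ∀ {n} (L : Subspace (suc n)) → ¬ L ∋ e₀ → ∀ v → Σ⟨ scalars ⟩ (λ a → [ L ∋? (a ∷ v) ]) ≡ [ tails L ∋? v ]
  Σ-head L e₀∉ v with tails L ∋? v
  ... | no ∄a = trans (Σ-cong scalars (λ a → []-no (L ∋? (a ∷ v)) (λ p → ∄a (a , p)))) (Σ-0 scalars)
  ... | yes (a , p) = trans (Σ-cong scalars (λ c → sym (ℤ.*-identityʳ [ L ∋? (c ∷ v) ])))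
        (Σ-unique (λ c → L ∋? (c ∷ v)) a p (λ c r → head-unique L e₀∉ r p) (λ _ → 1ℤ))

  [all?]-∷ : ∀ {A : Set} {P : A → Set} (P? : Decidable P) {n} x (xs : Vec A n) → [ VecAll.all? P? (x ∷ xs) ] ≡ [ P? x ] ℤ.* [ VecAll.all? P? xs ]
  [all?]-∷ P? x xs = trans ([]-cong (VecAll.all? P? (x ∷ xs)) (P? x ×-dec VecAll.all? P? xs) VecAll.uncons (λ (p , ps) → p ∷ ps)) ([]-× (P? x) (VecAll.all? P? xs))

  -- As `e₀` is not in L, a vector of `tails L` has exactly one first coordinate that puts it into
  -- L, so at most one column φ contributes.
  Σ-heads : ∀ {d n} (L : Subspace (suc n)) → ¬ L ∋ e₀ → ∀ (R : Vec (V n) d) →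
        Σ⟨ vecs d ⟩ (λ φ → [ VecAll.all? (L ∋?_) (zipWith _∷_ φ R) ]) ≡ [ VecAll.all? (tails L ∋?_) R ]
  Σ-heads L e₀∉ []      = refl
  Σ-heads {suc d} L e₀∉ (r ∷ R) = begin
    Σ⟨ vecs (suc d) ⟩ (λ φ → [ VecAll.all? (L ∋?_) (zipWith _∷_ φ (r ∷ R)) ])
      ≡⟨ Σ-∷ d _ ⟩
    Σ⟨ scalars ⟩ (λ a → Σ⟨ vecs d ⟩ (λ φ → [ VecAll.all? (L ∋?_) ((a ∷ r) ∷ zipWith _∷_ φ R) ]))
      ≡⟨ Σ-cong scalars (λ a → trans (Σ-cong (vecs d) (λ φ → [all?]-∷ (L ∋?_) (a ∷ r) (zipWith _∷_ φ R)))
        (trans (Σ-*ˡ (vecs d) [ L ∋? (a ∷ r) ] (λ φ → [ VecAll.all? (L ∋?_) (zipWith _∷_ φ R) ])) (cong ([ L ∋? (a ∷ r) ] ℤ.*_) (Σ-heads L e₀∉ R)))) ⟩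
    Σ⟨ scalars ⟩ (λ a → [ L ∋? (a ∷ r) ] ℤ.* [ VecAll.all? (tails L ∋?_) R ])
      ≡⟨ Σ-*ʳ scalars [ VecAll.all? (tails L ∋?_) R ] (λ a → [ L ∋? (a ∷ r) ]) ⟩
    Σ⟨ scalars ⟩ (λ a → [ L ∋? (a ∷ r) ]) ℤ.* [ VecAll.all? (tails L ∋?_) R ]
      ≡⟨ cong (ℤ._* [ VecAll.all? (tails L ∋?_) R ]) (Σ-head L e₀∉ r) ⟩
    [ tails L ∋? r ] ℤ.* [ VecAll.all? (tails L ∋?_) R ]
      ≡⟨ [all?]-∷ (tails L ∋?_) r R ⟨
    [ VecAll.all? (tails L ∋?_) (r ∷ R) ] ∎

  -- `complement` indexes a coordinate subspace meeting L only in 0. For the kernel of a matrix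
  -- these are independent columns, as many as the rank, which later links `rk` to `HasRank`.
  -- `echelons≡` counts the d-dimensional subspaces of L through their echelon matrices.
  record Dim {n} (L : Subspace n) : Set where
    field
      complement  : Subset n
      dim         : ℕ
      ∣∣+dim      : ∣ complement ∣ ℕ.+ dim ≡ n
      card≡       : card L ≡ 𝒒 ℤ.^ dim
      transversal : ∀ {v} → L ∋ v → Supported complement v → v ≡ 𝟎
      echelons≡   : ∀ d → Σ⟨ echelons d n ⟩ (λ X → [ VecAll.all? (L ∋?_) (rows X) ]) ≡ ⟦ gaussian dim d ⟧ (𝒒 ℤ.- 1ℤ)

  private
    all-with-e₀ : ∀ {d n} (L : Subspace (suc n)) → L ∋ e₀ → ∀ (φ : V d) (R : Vec (V n) d) →
        [ VecAll.all? (L ∋?_) (zipWith _∷_ φ R) ] ≡ [ VecAll.all? (tail-of-0 L ∋?_) R ]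
    all-with-e₀ L e₀∈ φ R = []-cong (VecAll.all? (L ∋?_) (zipWith _∷_ φ R)) (VecAll.all? (tail-of-0 L ∋?_) R) (to φ R) (from φ R)
      where
      change : ∀ a b v → L ∋ (a ∷ v) → L ∋ (b ∷ v)
      change a b v p = subst (L ∋_) (head-change a b v) (closed L (b + - a) p e₀∈)
      to : ∀ {d} (φ : V d) R → VecAll.All (L ∋_) (zipWith _∷_ φ R) → VecAll.All (tail-of-0 L ∋_) R
      to []      []      []       = []
      to (a ∷ φ) (r ∷ R) (p ∷ ps) = change a 0# r p ∷ to φ R ps
      from : ∀ {d} (φ : V d) R → VecAll.All (tail-of-0 L ∋_) R → VecAll.All (L ∋_) (zipWith _∷_ φ R)
      from []      []      []       = []
      from (a ∷ φ) (r ∷ R) (p ∷ ps) = change 0# a r p ∷ from φ R ps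

  Σ-free : ∀ d n (f : Vec (V d) (suc n) → ℤ) →
    Σ⟨ (vecs d) ⊠ (echelons d n) ⟩ f ≡ Σ⟨ echelons d n ⟩ (λ X → Σ⟨ vecs d ⟩ (λ φ → f (φ ∷ X)))
  Σ-free d n f = trans (Σ-× _∷_ (vecs d) (echelons d n) f) (Σ-comm (vecs d) (echelons d n) _)

  Σ-echelons : ∀ d n (f : Vec (V (suc d)) (suc n) → ℤ) →
    Σ⟨ echelons (suc d) (suc n) ⟩ f ≡ Σ⟨ echelons (suc d) n ⟩ (λ X → Σ⟨ vecs (suc d) ⟩ (λ φ → f (φ ∷ X))) ℤ.+ Σ⟨ echelons d n ⟩ (f ∘ pivot)
  Σ-echelons d n f = trans (Σ-++ ((vecs (suc d)) ⊠ (echelons (suc d) n)) (map pivot (echelons d n)) f)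
    (cong₂ ℤ._+_ (Σ-free (suc d) n f) (Σ-map pivot (echelons d n) f))

  dimension : ∀ {n} (L : Subspace n) → Dim L
  dimension {zero} L = record
    { complement  = []
    ; dim         = 0
    ; ∣∣+dim      = refl
    ; card≡       = trans (ℤ.+-identityʳ [ L ∋? [] ]) ([]-yes (L ∋? []) (zero∈ L))
    ; transversal = λ { {[]} _ _ → refl }
    ; echelons≡   = λ { zero → sym (⟦const⟧ 1ℤ (𝒒 ℤ.- 1ℤ)) ; (suc d) → refl }
    }
  dimension {suc n} L with L ∋? e₀
  ... | yes e₀∈ = record
    { complement  = false ∷ D.complement
    ; dim         = suc D.dim
    ; ∣∣+dim      = trans (ℕ.+-suc ∣ D.complement ∣ D.dim) (cong suc D.∣∣+dim)
    ; card≡       = card′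
    ; transversal = λ { v∈ (off s) → cong (0# ∷_) (D.transversal v∈ s) }
    ; echelons≡   = count
    }
    where
    L₀ = tail-of-0 L
    module D = Dim (dimension L₀)
    card′ : card L ≡ 𝒒 ℤ.^ suc D.dim
    card′ = begin
      card L ≡⟨ Σ-∷ n _ ⟩
      Σ⟨ scalars ⟩ (λ a → Σ⟨ vecs n ⟩ (λ v → [ L ∋? (a ∷ v) ])) ≡⟨ Σ-cong scalars (λ a → Σ-cong (vecs n) (λ v →
        []-cong (L ∋? (a ∷ v)) (L₀ ∋? v)
        (λ p → subst (L ∋_) (head-change a 0# v) (closed L (0# + - a) p e₀∈))
        (λ p → subst (L ∋_) (head-change 0# a v) (closed L (a + - 0#) p e₀∈)))) ⟩
      Σ⟨ scalars ⟩ (λ _ → card L₀) ≡⟨ Σ-scalars-const _ ⟩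
      𝒒 ℤ.* card L₀ ≡⟨ cong (𝒒 ℤ.*_) D.card≡ ⟩
      𝒒 ℤ.^ suc D.dim ∎
    g : ∀ {d m} (L : Subspace m) → Vec (V d) m → ℤ
    g L X = [ VecAll.all? (L ∋?_) (rows X) ]
    -- With `e₀` in L the first entries of the d rows are arbitrary, whence the factor q^d.
    free : ∀ d → Σ⟨ echelons d n ⟩ (λ X → Σ⟨ vecs d ⟩ (λ φ → g L (φ ∷ X))) ≡ 𝒒 ℤ.^ d ℤ.* ⟦ gaussian D.dim d ⟧ (𝒒 ℤ.- 1ℤ)
    free d = begin
      Σ⟨ echelons d n ⟩ (λ X → Σ⟨ vecs d ⟩ (λ φ → g L (φ ∷ X))) ≡⟨ Σ-cong (echelons d n) (λ X → trans (Σ-cong (vecs d) (λ φ → all-with-e₀ L e₀∈ φ (rows X))) (Σ-vectors-const d _)) ⟩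
      Σ⟨ echelons d n ⟩ (λ X → 𝒒 ℤ.^ d ℤ.* g L₀ X) ≡⟨ Σ-*ˡ (echelons d n) (𝒒 ℤ.^ d) (g L₀) ⟩
      𝒒 ℤ.^ d ℤ.* Σ⟨ echelons d n ⟩ (g L₀) ≡⟨ cong (𝒒 ℤ.^ d ℤ.*_) (D.echelons≡ d) ⟩
      𝒒 ℤ.^ d ℤ.* ⟦ gaussian D.dim d ⟧ (𝒒 ℤ.- 1ℤ) ∎
    pivots : ∀ d (X : Vec (V d) n) → g L (pivot X) ≡ g L₀ X
    pivots d X rewrite rows-map-0 X = begin
      [ VecAll.all? (L ∋?_) (e₀ ∷ zipWith _∷_ 𝟎 (rows X)) ] ≡⟨ [all?]-∷ (L ∋?_) e₀ (zipWith _∷_ 𝟎 (rows X)) ⟩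
      [ L ∋? e₀ ] ℤ.* [ VecAll.all? (L ∋?_) (zipWith _∷_ 𝟎 (rows X)) ] ≡⟨ cong₂ ℤ._*_ ([]-yes (L ∋? e₀) e₀∈) (all-with-e₀ L e₀∈ 𝟎 (rows X)) ⟩
      1ℤ ℤ.* g L₀ X ≡⟨ ℤ.*-identityˡ (g L₀ X) ⟩
      g L₀ X ∎
    count : ∀ d → Σ⟨ echelons d (suc n) ⟩ (g L) ≡ ⟦ gaussian (suc D.dim) d ⟧ (𝒒 ℤ.- 1ℤ)
    count zero    = trans (Σ-free zero n (g L)) (trans (free zero) (ℤ.*-identityˡ _))
    count (suc d) = begin
      Σ⟨ echelons (suc d) (suc n) ⟩ (g L)
        ≡⟨ trans (Σ-echelons d n (g L)) (cong₂ ℤ._+_ (free (suc d)) (trans (Σ-cong (echelons d n) (pivots d)) (D.echelons≡ d))) ⟩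
      𝒒 ℤ.^ suc d ℤ.* ⟦ gaussian D.dim (suc d) ⟧ x ℤ.+ ⟦ gaussian D.dim d ⟧ x
        ≡⟨ cong (λ z → z ℤ.* ⟦ gaussian D.dim (suc d) ⟧ x ℤ.+ ⟦ gaussian D.dim d ⟧ x) (⟦𝐪↑⟧ 𝒒 (suc d)) ⟨
      ⟦ 𝐪 ↑ suc d ⟧ x ℤ.* ⟦ gaussian D.dim (suc d) ⟧ x ℤ.+ ⟦ gaussian D.dim d ⟧ x
        ≡⟨ cong (ℤ._+ ⟦ gaussian D.dim d ⟧ x) (⟦⊗⟧ (𝐪 ↑ suc d) (gaussian D.dim (suc d)) x) ⟨
      ⟦ 𝐪 ↑ suc d ⊗ gaussian D.dim (suc d) ⟧ x ℤ.+ ⟦ gaussian D.dim d ⟧ x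
        ≡⟨ ⟦⊕⟧ (𝐪 ↑ suc d ⊗ gaussian D.dim (suc d)) (gaussian D.dim d) x ⟨
      ⟦ gaussian (suc D.dim) (suc d) ⟧ x ∎
      where x = 𝒒 ℤ.- 1ℤ
  ... | no e₀∉ = record
    { complement  = true ∷ D.complement
    ; dim         = D.dim
    ; ∣∣+dim      = cong suc D.∣∣+dim
    ; card≡       = card′
    ; transversal = λ { {a ∷ v} v∈ (on s) → transversal′ a v v∈ (D.transversal (a , v∈) s) }
    ; echelons≡   = count
    }
    where
    L′ = tails L
    module D = Dim (dimension L′)
    transversal′ : ∀ a v → L ∋ (a ∷ v) → v ≡ 𝟎 → a ∷ v ≡ 𝟎
    transversal′ a v v∈ refl = cong (_∷ 𝟎) (head-unique L e₀∉ v∈ (zero∈ L))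
    card′ : card L ≡ 𝒒 ℤ.^ D.dim
    card′ = begin
      card L ≡⟨ Σ-∷ n _ ⟩
      Σ⟨ scalars ⟩ (λ a → Σ⟨ vecs n ⟩ (λ v → [ L ∋? (a ∷ v) ])) ≡⟨ Σ-comm scalars (vecs n) _ ⟩
      Σ⟨ vecs n ⟩ (λ v → Σ⟨ scalars ⟩ (λ a → [ L ∋? (a ∷ v) ])) ≡⟨ Σ-cong (vecs n) (Σ-head L e₀∉) ⟩
      card L′ ≡⟨ D.card≡ ⟩
      𝒒 ℤ.^ D.dim ∎
    g : ∀ {d m} (L : Subspace m) → Vec (V d) m → ℤ
    g L X = [ VecAll.all? (L ∋?_) (rows X) ]
    free : ∀ d → Σ⟨ echelons d n ⟩ (λ X → Σ⟨ vecs d ⟩ (λ φ → g L (φ ∷ X))) ≡ ⟦ gaussian D.dim d ⟧ (𝒒 ℤ.- 1ℤ)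
    free d = trans (Σ-cong (echelons d n) (λ X → Σ-heads L e₀∉ (rows X))) (D.echelons≡ d)
    -- The new row of `pivot X` is `e₀` itself, which is not in L.
    pivots : ∀ d (X : Vec (V d) n) → g L (pivot X) ≡ 0ℤ
    pivots d X rewrite rows-map-0 X = []-no (VecAll.all? (L ∋?_) (e₀ ∷ zipWith _∷_ 𝟎 (rows X))) (λ { (p ∷ _) → e₀∉ p })
    count : ∀ d → Σ⟨ echelons d (suc n) ⟩ (g L) ≡ ⟦ gaussian D.dim d ⟧ (𝒒 ℤ.- 1ℤ)
    count zero    = trans (Σ-free zero n (g L)) (free zero)
    count (suc d) = trans (Σ-echelons d n (g L))
      (trans (cong₂ ℤ._+_ (free (suc d)) (trans (Σ-cong (echelons d n) (pivots d)) (Σ-0 (echelons d n)))) (ℤ.+-identityʳ _))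

-- Matroid types of sequences of vectors

-- Boolean functions on the subsets of Fin n, as data so that equality is extensional.
Table : ℕ → Set
Table zero    = Bool
Table (suc n) = Table n × Table n

table : ∀ {n} → (Subset n → Bool) → Table n
table {zero}  f = f []
table {suc n} f = table (f ∘ (false ∷_)) , table (f ∘ (true ∷_))

at : ∀ {n} → Table n → Subset n → Bool
at b       []          = b
at (b , c) (false ∷ J) = at b J
at (b , c) (true ∷ J)  = at c J

at-table : ∀ {n} (f : Subset n → Bool) J → at (table f) J ≡ f J
at-table f []          = refl
at-table f (false ∷ J) = at-table (f ∘ (false ∷_)) J
at-table f (true ∷ J)  = at-table (f ∘ (true ∷_)) J

table-cong : ∀ {n} {f g : Subset n → Bool} → (∀ J → f J ≡ g J) → table f ≡ table g
table-cong {zero}  e = e []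
table-cong {suc n} e = cong₂ _,_ (table-cong (e ∘ (false ∷_))) (table-cong (e ∘ (true ∷_)))

-- The matroid type of a sequence of vectors: for each vector, which sets of its successors span it.
Type : ℕ → Set
Type zero    = ⊤
Type (suc n) = Table n × Type n

-- Greedy from the back: an element of J raises the rank unless the later elements of J already span
-- it. `card-span` confirms the value for types of actual vectors.
rank : ∀ {n} → Type n → Subset n → ℕ
rank t       []          = 0
rank (b , t) (false ∷ J) = rank t J
rank (b , t) (true ∷ J)  = if at b J then rank t J else suc (rank t J)

nullity : ∀ {n} → Type n → Subset n → ℕ
nullity t       []          = 0
nullity (b , t) (false ∷ J) = nullity t J
nullity (b , t) (true ∷ J)  = if at b J then suc (nullity t J) else nullity t J

rank+nullity : ∀ {n} (t : Type n) J → rank t J ℕ.+ nullity t J ≡ ∣ J ∣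
rank+nullity t       []          = refl
rank+nullity (b , t) (false ∷ J) = rank+nullity t J
rank+nullity (b , t) (true ∷ J) with at b J
... | true  = trans (ℕ.+-suc (rank t J) _) (cong suc (rank+nullity t J))
... | false = cong suc (rank+nullity t J)

closure : ∀ {n} → Type n → Subset n → Subset n
closure t J = tabulate (λ j → does (rank t (J [ j ]≔ true) ℕ.≟ rank t J))

-- Inclusion and distance of subsets

infix 4 _≼_
_≼_ : ∀ {n} → Subset n → Subset n → Set
a ≼ b = ∀ j → lookup a j ≡ true → lookup b j ≡ true

∩-≼ˡ : ∀ {n} (a b : Subset n) → a ∩ b ≼ a
∩-≼ˡ a b j p = ∧-conicalˡ (lookup a j) (lookup b j) (trans (sym (lookup-zipWith _ j a b)) p)

∩-≼ʳ : ∀ {n} (a b : Subset n) → a ∩ b ≼ b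
∩-≼ʳ a b j p = ∧-conicalʳ (lookup a j) (lookup b j) (trans (sym (lookup-zipWith _ j a b)) p)

∪-≼ˡ : ∀ {n} (a b : Subset n) → a ≼ a ∪ b
∪-≼ˡ (true ∷ a)  (_ ∷ b) zero    p = refl
∪-≼ˡ (_ ∷ a)     (_ ∷ b) (suc j) p = ∪-≼ˡ a b j p

∪-≼ʳ : ∀ {n} (a b : Subset n) → b ≼ a ∪ b
∪-≼ʳ (false ∷ a) (true ∷ b) zero    p = refl
∪-≼ʳ (true ∷ a)  (true ∷ b) zero    p = refl
∪-≼ʳ (_ ∷ a)     (_ ∷ b)    (suc j) p = ∪-≼ʳ a b j p

≼-insert : ∀ {n} (J : Subset n) j → J ≼ J [ j ]≔ true
≼-insert (_ ∷ J) zero    zero    p = refl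
≼-insert (_ ∷ J) zero    (suc i) p = p
≼-insert (_ ∷ J) (suc j) zero    p = p
≼-insert (_ ∷ J) (suc j) (suc i) p = ≼-insert J j i p

-- The cardinality of the difference of a and b; `distance` is therefore the Hamming distance.
excess : ∀ {n} → Subset n → Subset n → ℕ
excess []          []          = 0
excess (true ∷ a)  (false ∷ b) = suc (excess a b)
excess (true ∷ a)  (true ∷ b)  = excess a b
excess (false ∷ a) (_ ∷ b)     = excess a b

excess≡0 : ∀ {n} (a b : Subset n) → excess a b ≡ 0 → a ≼ a ∩ b
excess≡0 (true ∷ a)  (true ∷ b)  e zero    _ = refl
excess≡0 (true ∷ a)  (true ∷ b)  e (suc j) p = excess≡0 a b e j p
excess≡0 (false ∷ a) (_ ∷ b)     e (suc j) p = excess≡0 a b e j p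

excess≤1 : ∀ {n} (a b : Subset n) → excess a b ≤ 1 →
           a ≼ a ∩ b ⊎ ∃[ j ] (lookup b j ≡ false × a ≼ (a ∩ b) [ j ]≔ true)
excess≤1 []          []          _ = inj₁ (λ ())
excess≤1 (true ∷ a)  (false ∷ b) (s≤s e) = inj₂ (zero , refl , λ { zero _ → refl ; (suc j) p → excess≡0 a b (ℕ.n≤0⇒n≡0 e) j p })
excess≤1 (true ∷ a)  (true ∷ b)  e with excess≤1 a b e
... | inj₁ s             = inj₁ λ { zero _ → refl ; (suc j) p → s j p }
... | inj₂ (j , j∉b , s) = inj₂ (suc j , j∉b , λ { zero _ → refl ; (suc i) p → s i p })
excess≤1 (false ∷ a) (_ ∷ b)     e with excess≤1 a b e
... | inj₁ s             = inj₁ λ { (suc j) p → s j p }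
... | inj₂ (j , j∉b , s) = inj₂ (suc j , j∉b , λ { (suc i) p → s i p })

distance : ∀ {n} → Subset n → Subset n → ℕ
distance a b = excess a b ℕ.+ excess b a

private
  step : ∀ n {s t} → s ≤ 2 ℕ.* n → t ≡ 2 ℕ.+ s → t ≤ 2 ℕ.* suc n
  step n h e = ℕ.≤-trans (ℕ.≤-reflexive e) (ℕ.≤-trans (s≤s (s≤s h)) (ℕ.≤-reflexive (sym (ℕ.*-suc 2 n))))

  weaken : ∀ n {s} → s ≤ 2 ℕ.* n → s ≤ 2 ℕ.* suc n
  weaken n h = ℕ.≤-trans h (ℕ.*-monoʳ-≤ 2 (ℕ.n≤1+n n))

-- Each point separates at most two of the three pairs.
plotkin : ∀ {n} (a b c : Subset n) → distance a b ℕ.+ distance a c ℕ.+ distance b c ≤ 2 ℕ.* n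
plotkin {n} [] [] [] = z≤n
plotkin {suc n} (x ∷ a) (y ∷ b) (z ∷ c) = go x y z
  where
  ih = plotkin a b c
  ab = excess a b ; ba = excess b a ; ac = excess a c ; ca = excess c a ; bc = excess b c ; cb = excess c b
  regroup : ∀ i j k l m o ab ba ac ca bc cb → i ℕ.+ ab ℕ.+ (j ℕ.+ ba) ℕ.+ (k ℕ.+ ac ℕ.+ (l ℕ.+ ca)) ℕ.+ (m ℕ.+ bc ℕ.+ (o ℕ.+ cb)) ≡
    i ℕ.+ j ℕ.+ k ℕ.+ l ℕ.+ m ℕ.+ o ℕ.+ (ab ℕ.+ ba ℕ.+ (ac ℕ.+ ca) ℕ.+ (bc ℕ.+ cb))
  regroup = ℕ-Solver.solve-∀
  go : ∀ x y z → distance (x ∷ a) (y ∷ b) ℕ.+ distance (x ∷ a) (z ∷ c) ℕ.+ distance (y ∷ b) (z ∷ c) ≤ 2 ℕ.* suc n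
  go false false false = weaken n ih
  go false false true  = step n ih (regroup 0 0 0 1 0 1 ab ba ac ca bc cb)
  go false true  false = step n ih (regroup 0 1 0 0 1 0 ab ba ac ca bc cb)
  go false true  true  = step n ih (regroup 0 1 0 1 0 0 ab ba ac ca bc cb)
  go true  false false = step n ih (regroup 1 0 1 0 0 0 ab ba ac ca bc cb)
  go true  false true  = step n ih (regroup 1 0 0 0 0 1 ab ba ac ca bc cb)
  go true  true  false = step n ih (regroup 0 0 1 0 1 0 ab ba ac ca bc cb)
  go true  true  true  = weaken n ih

-- For flats this forces the spans to meet exactly in the span of the common elements (`span-near`).
-- It is a condition on sets alone, so it can be tested without knowing the field.
Near : ∀ {n} → Subset n → Subset n → Set
Near a b = excess a b ≤ 1 ⊎ excess b a ≤ 1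

near? : ∀ {n} (a b : Subset n) → Dec (Near a b)
near? a b = (excess a b ℕ.≤? 1) ⊎-dec (excess b a ℕ.≤? 1)

-- Three pairwise distances of at least 4 add up to 12, whereas `plotkin` allows at most 2 n, that
-- is 10 for five points.
¬near⇒4≤distance : ∀ {n} (a b : Subset n) → ¬ Near a b → 4 ≤ distance a b
¬near⇒4≤distance a b ¬near = ℕ.+-mono-≤ (ℕ.≰⇒> (¬near ∘ inj₁)) (ℕ.≰⇒> (¬near ∘ inj₂))

-- False for n = 6 (three disjoint pairs), as on the concurrent lines of the Fano plane: this is what limits
-- the exact count to six columns.
some-pair-near : ∀ {n} → n ≤ 5 → (a b c : Subset n) → ¬ Near a b → ¬ Near a c → Near b c
some-pair-near {n} n≤5 a b c ¬ab ¬ac with near? b c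
... | yes bc = bc
... | no ¬bc = contradiction (ℕ.≤-trans 12≤ (ℕ.≤-trans (plotkin a b c) (ℕ.*-monoʳ-≤ 2 n≤5))) (ℕ.<⇒≱ (ℕ.m≤m+n 11 1))
  where
  12≤ = ℕ.+-mono-≤ (ℕ.+-mono-≤ (¬near⇒4≤distance a b ¬ab) (¬near⇒4≤distance a c ¬ac)) (¬near⇒4≤distance b c ¬bc)

-- Intersections of flats and multilinear expansion

-- An intersection of spans of flats: of none, of one, or of two flats that are not Near.
data Meet (n : ℕ) : Set where
  whole : Meet n
  one   : Subset n → Meet n
  two   : Subset n → Subset n → Meet n

meet₁ : ∀ {n} → Subset n → Subset n → Meet n
meet₁ a c with near? a c
... | yes _ = one (a ∩ c)
... | no _  = two a c

-- In the last clause c is Near b if n ≤ 5; otherwise the value is junk.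
meet : ∀ {n} → Meet n → Subset n → Meet n
meet whole     c = one c
meet (one a)   c = meet₁ a c
meet (two a b) c with near? a c
... | yes _ = meet₁ (a ∩ c) b
... | no _  = meet₁ (b ∩ c) a

-- Each J is replaced by the flat it generates: `span-∩` needs a closed set to rule out a
-- contribution of the one element outside it.
meets : ∀ {n} → Type n → List (Subset n) → Meet n
meets t = foldr (λ J s → meet s (closure t J)) whole

-- The clause for `two` is the modular law, a ∪ b spanning the sum of the two spans. For types of
-- actual vectors the truncated subtraction is exact.
meetDimension : ∀ {n} → ℕ → Type n → Meet n → ℕ
meetDimension d t whole     = d
meetDimension d t (one a)   = rank t a
meetDimension d t (two a b) = rank t a ℕ.+ rank t b ℕ.∸ rank t (a ∪ b)

-- Multilinear expansion of a function of the truth values of finitely many conditions.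
expand : ∀ {S : Set} {n} → (Subset n → S) → (Table n → List S → Polynomial) → List S → Polynomial
expand {n = zero}  g k Js = k true (g [] ∷ Js) ⊕ const (ℤ.- 1ℤ) ⊗ k false (g [] ∷ Js) ⊕ k false Js
expand {n = suc n} g k Js = expand (g ∘ (false ∷_)) (λ b → expand (g ∘ (true ∷_)) (λ c → k (b , c))) Js

module _ {A S : Set} (as : List A) (M : S → A → Set) (M? : ∀ J → Decidable (M J)) (x : ℤ) where

  All? : ∀ Js a → Dec (All (λ J → M J a) Js)
  All? Js a = all? (λ J → M? J a) Js

  -- `Js` lists the conditions imposed so far. A condition M with indicator i turns h into i h(true)
  -- - i h(false) + h(false). No term imposes the negation of M, so it suffices to count the vectors
  -- satisfying a list of conditions simultaneously.
  ⟦expand⟧ : ∀ {n} (g : Subset n → S) (k : Table n → List S → Polynomial) (h : Table n → A → ℤ) →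
    (∀ b Js → ⟦ k b Js ⟧ x ≡ Σ⟨ as ⟩ (λ a → [ All? Js a ] ℤ.* h b a)) →
    ∀ Js → ⟦ expand g k Js ⟧ x ≡ Σ⟨ as ⟩ (λ a → [ All? Js a ] ℤ.* h (table (λ J → does (M? (g J) a))) a)
  ⟦expand⟧ {zero} g k h e Js = begin
    ⟦ k true Js′ ⊕ const (ℤ.- 1ℤ) ⊗ k false Js′ ⊕ k false Js ⟧ x
      ≡⟨ ⟦⊕⟧ (k true Js′ ⊕ const (ℤ.- 1ℤ) ⊗ k false Js′) (k false Js) x ⟩
    ⟦ k true Js′ ⊕ const (ℤ.- 1ℤ) ⊗ k false Js′ ⟧ x ℤ.+ ⟦ k false Js ⟧ x
      ≡⟨ cong (ℤ._+ ⟦ k false Js ⟧ x) (trans (⟦⊕⟧ (k true Js′) (const (ℤ.- 1ℤ) ⊗ k false Js′) x)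
        (cong (λ z → ⟦ k true Js′ ⟧ x ℤ.+ z) (trans (⟦⊗⟧ (const (ℤ.- 1ℤ)) (k false Js′) x) (cong (ℤ._* ⟦ k false Js′ ⟧ x) (⟦const⟧ (ℤ.- 1ℤ) x))))) ⟩
    ⟦ k true Js′ ⟧ x ℤ.+ (ℤ.- 1ℤ) ℤ.* ⟦ k false Js′ ⟧ x ℤ.+ ⟦ k false Js ⟧ x
      ≡⟨ cong₂ ℤ._+_ (cong₂ (λ u v → u ℤ.+ (ℤ.- 1ℤ) ℤ.* v) (e true Js′) (e false Js′)) (e false Js) ⟩
    Σ⟨ as ⟩ Y ℤ.+ (ℤ.- 1ℤ) ℤ.* Σ⟨ as ⟩ U ℤ.+ Σ⟨ as ⟩ W
      ≡⟨ cong (λ z → Σ⟨ as ⟩ Y ℤ.+ z ℤ.+ Σ⟨ as ⟩ W) (Σ-*ˡ as (ℤ.- 1ℤ) U) ⟨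
    Σ⟨ as ⟩ Y ℤ.+ Σ⟨ as ⟩ (λ a → (ℤ.- 1ℤ) ℤ.* U a) ℤ.+ Σ⟨ as ⟩ W
      ≡⟨ cong (ℤ._+ Σ⟨ as ⟩ W) (Σ-+ as Y _) ⟨
    Σ⟨ as ⟩ (λ a → Y a ℤ.+ (ℤ.- 1ℤ) ℤ.* U a) ℤ.+ Σ⟨ as ⟩ W
      ≡⟨ Σ-+ as (λ a → Y a ℤ.+ (ℤ.- 1ℤ) ℤ.* U a) W ⟨
    Σ⟨ as ⟩ (λ a → Y a ℤ.+ (ℤ.- 1ℤ) ℤ.* U a ℤ.+ W a)
      ≡⟨ Σ-cong as pointwise ⟩
    Σ⟨ as ⟩ (λ a → [ All? Js a ] ℤ.* h (does (M? (g []) a)) a) ∎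
    where
    Js′ = g [] ∷ Js
    Y U W : A → ℤ
    Y a = [ All? Js′ a ] ℤ.* h true a
    U a = [ All? Js′ a ] ℤ.* h false a
    W a = [ All? Js a ] ℤ.* h false a
    hit : ∀ i u w → i ℤ.* u ℤ.+ (ℤ.- 1ℤ) ℤ.* (i ℤ.* w) ℤ.+ i ℤ.* w ≡ i ℤ.* u
    hit = solve-∀
    miss : ∀ i u w → 0ℤ ℤ.* u ℤ.+ (ℤ.- 1ℤ) ℤ.* (0ℤ ℤ.* w) ℤ.+ i ℤ.* w ≡ i ℤ.* w
    miss = solve-∀
    pointwise : ∀ a → Y a ℤ.+ (ℤ.- 1ℤ) ℤ.* U a ℤ.+ W a ≡ [ All? Js a ] ℤ.* h (does (M? (g []) a)) a
    pointwise a with M? (g []) a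
    ... | yes m = hit [ All? Js a ] (h true a) (h false a)
    ... | no ¬m = miss [ All? Js a ] (h true a) (h false a)
  ⟦expand⟧ {suc n} g k h e Js =
    ⟦expand⟧ (g ∘ (false ∷_)) (λ b → expand (g ∘ (true ∷_)) (λ c → k (b , c)))
      (λ b a → h (b , table (λ J → does (M? (g (true ∷ J)) a))) a)
      (λ b → ⟦expand⟧ (g ∘ (true ∷_)) (λ c → k (b , c)) (λ c → h (b , c)) (λ c → e (b , c))) Js

-- Spans, and what the type determines about them

module Spans {q : ℕ} (F : Field q) where

  open Dimension F public

  Config : ℕ → ℕ → Set
  Config d n = Vec (V d) n

  combine : ∀ {d n} → V d → V n → Config d n → V d
  combine v []      []      = v
  combine v (a ∷ as) (x ∷ X) = combine (v ∔ a ∙ x) as X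

  -- The recursion consumes the generators in the same order as `combine` and `Type` do, so that the
  -- three can be compared by induction on the configuration.
  Span : ∀ {d n} → Config d n → Subset n → V d → Set
  Span []      []          v = v ≡ 𝟎
  Span (x ∷ X) (false ∷ J) v = Span X J v
  Span (x ∷ X) (true ∷ J)  v = ∃[ c ] Span X J (v ∔ c ∙ x)

  span? : ∀ {d n} (X : Config d n) J → Decidable (Span X J)
  span? []      []          v = v ≟ⱽ 𝟎
  span? (x ∷ X) (false ∷ J) v = span? X J v
  span? (x ∷ X) (true ∷ J)  v = any? (λ c → span? X J (v ∔ c ∙ x))

  0∈span : ∀ {d n} (X : Config d n) J → Span X J 𝟎
  0∈span []      []          = refl
  0∈span (x ∷ X) (false ∷ J) = 0∈span X J
  0∈span (x ∷ X) (true ∷ J)  = 0# , subst (Span X J) (sym (∔-0 𝟎 x)) (0∈span X J)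

  span-closed : ∀ {d n} (X : Config d n) J c {v w} → Span X J v → Span X J w → Span X J (v ∔ c ∙ w)
  span-closed []      []          c refl refl = ∔-𝟎 𝟎 c
  span-closed (x ∷ X) (false ∷ J) c s t = span-closed X J c s t
  span-closed (x ∷ X) (true ∷ J)  c {v} {w} (a , s) (b , t) = a + c * b , subst (Span X J) eq (span-closed X J c s t)
    where
    eq : v ∔ a ∙ x ∔ c ∙ (w ∔ b ∙ x) ≡ v ∔ c ∙ w ∔ (a + c * b) ∙ x
    eq = begin
      v ∔ a ∙ x ∔ c ∙ (w ∔ b ∙ x) ≡⟨ ∔-nest (v ∔ a ∙ x) c w b x ⟩
      v ∔ a ∙ x ∔ c ∙ w ∔ c * b ∙ x ≡⟨ cong (_∔ c * b ∙ x) (∔-swap v a x c w) ⟩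
      v ∔ c ∙ w ∔ a ∙ x ∔ c * b ∙ x ≡⟨ ∔-merge (v ∔ c ∙ w) a (c * b) x ⟩
      v ∔ c ∙ w ∔ (a + c * b) ∙ x ∎

  span : ∀ {d n} → Config d n → Subset n → Subspace d
  span X J = record { _∋_ = Span X J ; _∋?_ = span? X J ; zero∈ = 0∈span X J ; closed = span-closed X J }

  member∈span : ∀ {d n} (X : Config d n) J j → lookup J j ≡ true → Span X J (lookup X j)
  member∈span (x ∷ X) (true ∷ J)  zero    _ = - 1# , subst (Span X J) (sym (∔-self x)) (0∈span X J)
  member∈span (x ∷ X) (false ∷ J) (suc j) p = member∈span X J j p
  member∈span (x ∷ X) (true ∷ J)  (suc j) p = 0# , subst (Span X J) (sym (∔-0 _ x)) (member∈span X J j p)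

  span-least : ∀ {d n} (U : Subspace d) (X : Config d n) J → (∀ j → lookup J j ≡ true → U ∋ lookup X j) → ∀ {v} → Span X J v → U ∋ v
  span-least U []      []          h refl    = zero∈ U
  span-least U (x ∷ X) (false ∷ J) h s       = span-least U X J (h ∘ suc) s
  span-least U (x ∷ X) (true ∷ J)  h (c , s) = cancel U c (h zero refl) (span-least U X J (h ∘ suc) s)

  span-mono : ∀ {d n} (X : Config d n) {J L} → J ≼ L → ∀ {v} → Span X J v → Span X L v
  span-mono X {J} {L} J≼L = span-least (span X L) X J (λ j p → member∈span X L j (J≼L j p))

  span-insert : ∀ {d n} (X : Config d n) J j {v} → Span X (J [ j ]≔ true) v → ∃[ c ] Span X J (v ∔ c ∙ lookup X j)
  span-insert (x ∷ X) (false ∷ J) zero    s = s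
  span-insert (x ∷ X) (true ∷ J)  zero    s = 0# , subst (Span (x ∷ X) (true ∷ J)) (sym (∔-0 _ x)) s
  span-insert (x ∷ X) (false ∷ J) (suc j) s = span-insert X J j s
  span-insert (x ∷ X) (true ∷ J)  (suc j) {v} (b , s) with span-insert X J j s
  ... | c , t = c , b , subst (Span X J) (∔-swap v b x c (lookup X j)) t

  span-uninsert : ∀ {d n} (X : Config d n) J j {v} c → Span X J (v ∔ c ∙ lookup X j) → Span X (J [ j ]≔ true) v
  span-uninsert X J j c s = cancel (span X (J [ j ]≔ true)) c
    (member∈span X (J [ j ]≔ true) j (lookup∘update j J true))
    (span-mono X (≼-insert J j) s)

  -- A generator of a, even when it also lies in b, is charged to the summand u.
  span-∪ : ∀ {d n} (X : Config d n) a b {v} → Span X (a ∪ b) v → ∃[ u ] Span X a u × Span X b (v ∔ - 1# ∙ u)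
  span-∪ []      []          []          refl = 𝟎 , refl , ∔-𝟎 𝟎 _
  span-∪ (x ∷ X) (false ∷ a) (false ∷ b) s = span-∪ X a b s
  span-∪ (x ∷ X) (false ∷ a) (true ∷ b) {v} (c , s) with span-∪ X a b s
  ... | u , s₁ , s₂ = u , s₁ , c , subst (Span X b) (∔-swap v c x (- 1#) u) s₂
  span-∪ (x ∷ X) (true ∷ a)  (y ∷ b) {v} (c , s) with span-∪ X a b s
  ... | u , s₁ , s₂ = u ∔ - c ∙ x , (c , subst (Span X a) (sym (∔-neg-∙ u c x)) s₁) , pad y (subst (Span X b) (sym eq) s₂)
    where
    neg-neg : - 1# * - c ≡ c
    neg-neg = trans (sym (-‿distribˡ-* 1# (- c))) (trans (cong -_ (*-identityˡ (- c))) (-‿involutive c))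
      where open import Algebra.Properties.Ring ring using (-‿distribˡ-*; -‿involutive)
    eq : v ∔ - 1# ∙ (u ∔ - c ∙ x) ≡ v ∔ c ∙ x ∔ - 1# ∙ u
    eq = begin
      v ∔ - 1# ∙ (u ∔ - c ∙ x) ≡⟨ ∔-nest v (- 1#) u (- c) x ⟩
      v ∔ - 1# ∙ u ∔ - 1# * - c ∙ x ≡⟨ cong (v ∔ - 1# ∙ u ∔_∙ x) neg-neg ⟩
      v ∔ - 1# ∙ u ∔ c ∙ x ≡⟨ ∔-swap v (- 1#) u c x ⟩
      v ∔ c ∙ x ∔ - 1# ∙ u ∎
    pad : ∀ y {w} → Span X b w → Span (x ∷ X) (y ∷ b) w
    pad false s = s
    pad true  s = 0# , subst (Span X b) (sym (∔-0 _ x)) s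

  typeOf : ∀ {d n} → Config d n → Type n
  typeOf []      = tt
  typeOf (x ∷ X) = table (λ J → does (span? X J x)) , typeOf X

  supportedIn : ∀ {n} → Subset n → List (V n)
  supportedIn []          = [] ∷ []
  supportedIn (false ∷ T) = map (0# ∷_) (supportedIn T)
  supportedIn (true ∷ T)  = scalars ⊠ (supportedIn T)

  -- If x lies in the span of the later vectors of T, its coefficient is free, which is one unit of
  -- nullity. Otherwise at most one coefficient of x can be completed, by `Σ-translates`.
  Σ-relations : ∀ {d n} (X : Config d n) T v →
    Σ⟨ supportedIn T ⟩ (λ a → [ combine v a X ≟ⱽ 𝟎 ]) ≡ [ span? X T v ] ℤ.* 𝒒 ℤ.^ nullity (typeOf X) T
  Σ-relations []      []          v = trans (ℤ.+-identityʳ _) (sym (ℤ.*-identityʳ [ v ≟ⱽ 𝟎 ]))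
  Σ-relations (x ∷ X) (false ∷ T) v = trans (Σ-map (0# ∷_) (supportedIn T) _)
    (trans (Σ-cong (supportedIn T) (λ a → cong (λ w → [ combine w a X ≟ⱽ 𝟎 ]) (∔-0 v x))) (Σ-relations X T v))
  Σ-relations (x ∷ X) (true ∷ T)  v = trans start (finish (span? X T x) refl)
    where
    N = 𝒒 ℤ.^ nullity (typeOf X) T
    start : Σ⟨ supportedIn (true ∷ T) ⟩ (λ a → [ combine v a (x ∷ X) ≟ⱽ 𝟎 ]) ≡ Σ⟨ scalars ⟩ (λ c → [ span? X T (v ∔ c ∙ x) ]) ℤ.* N
    start = begin
      Σ⟨ supportedIn (true ∷ T) ⟩ (λ a → [ combine v a (x ∷ X) ≟ⱽ 𝟎 ]) ≡⟨ Σ-× _∷_ scalars (supportedIn T) _ ⟩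
      Σ⟨ scalars ⟩ (λ c → Σ⟨ supportedIn T ⟩ (λ a → [ combine (v ∔ c ∙ x) a X ≟ⱽ 𝟎 ])) ≡⟨ Σ-cong scalars (λ c → Σ-relations X T (v ∔ c ∙ x)) ⟩
      Σ⟨ scalars ⟩ (λ c → [ span? X T (v ∔ c ∙ x) ] ℤ.* N) ≡⟨ Σ-*ʳ scalars N _ ⟩
      Σ⟨ scalars ⟩ (λ c → [ span? X T (v ∔ c ∙ x) ]) ℤ.* N ∎
    at-type : at (table (λ J → does (span? X J x))) T ≡ does (span? X T x)
    at-type = at-table (λ J → does (span? X J x)) T
    finish : (s : Dec (Span X T x)) → does (span? X T x) ≡ does s →
        Σ⟨ scalars ⟩ (λ c → [ span? X T (v ∔ c ∙ x) ]) ℤ.* N ≡ [ span? (x ∷ X) (true ∷ T) v ] ℤ.* 𝒒 ℤ.^ nullity (typeOf (x ∷ X)) (true ∷ T)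
    finish (no x∉) e rewrite at-type | e = cong (ℤ._* N) (Σ-translates (span X T) x∉ v (span? (x ∷ X) (true ∷ T) v))
    finish (yes x∈) e rewrite at-type | e = begin
      Σ⟨ scalars ⟩ (λ c → [ span? X T (v ∔ c ∙ x) ]) ℤ.* N ≡⟨ cong (ℤ._* N) (Σ-cong scalars (λ c → []-cong (span? X T (v ∔ c ∙ x)) (span? (x ∷ X) (true ∷ T) v)
        (c ,_) (λ (b , s) → span-closed X T c (cancel (span X T) b x∈ s) x∈))) ⟩
      Σ⟨ scalars ⟩ (λ _ → i) ℤ.* N ≡⟨ cong (ℤ._* N) (trans (Σ-scalars-const i) (ℤ.*-comm 𝒒 i)) ⟩
      i ℤ.* 𝒒 ℤ.* N ≡⟨ ℤ.*-assoc i 𝒒 N ⟩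
      i ℤ.* (𝒒 ℤ.* N) ∎
      where i = [ span? (x ∷ X) (true ∷ T) v ]

  Σ-𝟎 : ∀ n → Σ⟨ vecs n ⟩ (λ v → [ v ≟ⱽ 𝟎 ]) ≡ 1ℤ
  Σ-𝟎 zero    = refl
  Σ-𝟎 (suc n) = begin
    Σ⟨ vecs (suc n) ⟩ (λ v → [ v ≟ⱽ 𝟎 ]) ≡⟨ Σ-∷ n _ ⟩
    Σ⟨ scalars ⟩ (λ c → Σ⟨ vecs n ⟩ (λ v → [ (c ∷ v) ≟ⱽ 𝟎 ])) ≡⟨ Σ-cong scalars (λ c → Σ-cong (vecs n) (λ v →
        trans ([]-cong ((c ∷ v) ≟ⱽ 𝟎) ((c ≟ᴷ 0#) ×-dec (v ≟ⱽ 𝟎)) (λ { refl → refl , refl }) (λ { (refl , refl) → refl })) ([]-× (c ≟ᴷ 0#) (v ≟ⱽ 𝟎)))) ⟩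
    Σ⟨ scalars ⟩ (λ c → Σ⟨ vecs n ⟩ (λ v → [ c ≟ᴷ 0# ] ℤ.* [ v ≟ⱽ 𝟎 ])) ≡⟨ Σ-cong scalars (λ c → Σ-*ˡ (vecs n) [ c ≟ᴷ 0# ] (λ v → [ v ≟ⱽ 𝟎 ])) ⟩
    Σ⟨ scalars ⟩ (λ c → [ c ≟ᴷ 0# ] ℤ.* Σ⟨ vecs n ⟩ (λ v → [ v ≟ⱽ 𝟎 ])) ≡⟨ Σ-delta 0# (λ _ → Σ⟨ vecs n ⟩ (λ v → [ v ≟ⱽ 𝟎 ])) ⟩
    Σ⟨ vecs n ⟩ (λ v → [ v ≟ⱽ 𝟎 ]) ≡⟨ Σ-𝟎 n ⟩
    1ℤ ∎

  Σ-combine : ∀ {d n} (a : V n) (X : Config d n) → Σ⟨ vecs d ⟩ (λ v → [ combine v a X ≟ⱽ 𝟎 ]) ≡ 1ℤ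
  Σ-combine {d} []       []      = Σ-𝟎 d
  Σ-combine {d} (a ∷ as) (x ∷ X) = trans (Σ-translate d a x _) (Σ-combine as X)

  Σ-supportedIn-1 : ∀ {n} (T : Subset n) → Σ⟨ supportedIn T ⟩ (λ _ → 1ℤ) ≡ 𝒒 ℤ.^ ∣ T ∣
  Σ-supportedIn-1 []          = refl
  Σ-supportedIn-1 (false ∷ T) = trans (Σ-map (0# ∷_) (supportedIn T) _) (Σ-supportedIn-1 T)
  Σ-supportedIn-1 (true ∷ T)  = trans (Σ-× _∷_ scalars (supportedIn T) _)
    (trans (Σ-scalars-const _) (cong (𝒒 ℤ.*_) (Σ-supportedIn-1 T)))

  -- Count the pairs (v, a) with a supported in J whose combination with v vanishes. Each a
  -- determines v, which gives q to the size of J; each v in the span has q^ν choices of a, ν the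
  -- nullity. Cancelling q^ν leaves the rank as exponent.
  card-span : ∀ {d n} (X : Config d n) J → card (span X J) ≡ 𝒒 ℤ.^ rank (typeOf X) J
  card-span {d} X J = ^-cancelʳ (nullity (typeOf X) J) (begin
    card (span X J) ℤ.* 𝒒 ℤ.^ ν ≡⟨ Σ-*ʳ vs (𝒒 ℤ.^ ν) _ ⟨
    Σ⟨ vs ⟩ (λ v → [ span? X J v ] ℤ.* 𝒒 ℤ.^ ν) ≡⟨ Σ-cong vs (Σ-relations X J) ⟨
    Σ⟨ vs ⟩ (λ v → Σ⟨ supportedIn J ⟩ (λ a → [ combine v a X ≟ⱽ 𝟎 ])) ≡⟨ Σ-comm vs (supportedIn J) _ ⟩
    Σ⟨ supportedIn J ⟩ (λ a → Σ⟨ vs ⟩ (λ v → [ combine v a X ≟ⱽ 𝟎 ])) ≡⟨ Σ-cong (supportedIn J) (λ a → Σ-combine a X) ⟩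
    Σ⟨ supportedIn J ⟩ (λ _ → 1ℤ) ≡⟨ Σ-supportedIn-1 J ⟩
    𝒒 ℤ.^ ∣ J ∣ ≡⟨ cong (𝒒 ℤ.^_) (rank+nullity (typeOf X) J) ⟨
    𝒒 ℤ.^ (rank (typeOf X) J ℕ.+ ν) ≡⟨ ℤ.^-distribˡ-+-* 𝒒 (rank (typeOf X) J) ν ⟩
    𝒒 ℤ.^ rank (typeOf X) J ℤ.* 𝒒 ℤ.^ ν ∎)
    where
    vs = vecs d
    ν = nullity (typeOf X) J

  module _ {d n} (X : Config d n) where

    private
      t = typeOf X

    rank-insert⇒ : ∀ J j → Span X J (lookup X j) → rank t (J [ j ]≔ true) ≡ rank t J
    rank-insert⇒ J j x∈ = ^-injective _ _ (begin
      𝒒 ℤ.^ rank t (J [ j ]≔ true) ≡⟨ card-span X (J [ j ]≔ true) ⟨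
      card (span X (J [ j ]≔ true)) ≡⟨ card-cong (span X (J [ j ]≔ true)) (span X J)
        (λ s → let (c , s′) = span-insert X J j s in cancel (span X J) c x∈ s′)
        (span-mono X (≼-insert J j)) ⟩
      card (span X J) ≡⟨ card-span X J ⟩
      𝒒 ℤ.^ rank t J ∎)

    -- Otherwise the span of J together with j consists of q disjoint translates of the span of J,
    -- and the rank would grow by one.
    rank-insert⇐ : ∀ J j → rank t (J [ j ]≔ true) ≡ rank t J → Span X J (lookup X j)
    rank-insert⇐ J j e with span? X J (lookup X j)
    ... | yes x∈ = x∈
    ... | no x∉ = contradiction (trans (sym e) (^-injective _ _ (begin
      𝒒 ℤ.^ rank t J′ ≡⟨ card-span X J′ ⟨
      card (span X J′) ≡⟨ Σ-cong vs extend ⟨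
      Σ⟨ vs ⟩ (λ v → Σ⟨ scalars ⟩ (λ c → [ span? X J (v ∔ c ∙ x) ])) ≡⟨ Σ-comm vs scalars _ ⟩
      Σ⟨ scalars ⟩ (λ c → Σ⟨ vs ⟩ (λ v → [ span? X J (v ∔ c ∙ x) ])) ≡⟨ Σ-cong scalars (λ c → Σ-translate d c x _) ⟩
      Σ⟨ scalars ⟩ (λ _ → card (span X J)) ≡⟨ Σ-scalars-const _ ⟩
      𝒒 ℤ.* card (span X J) ≡⟨ cong (𝒒 ℤ.*_) (card-span X J) ⟩
      𝒒 ℤ.^ suc (rank t J) ∎))) (ℕ.<⇒≢ ℕ.≤-refl)
      where
      J′ = J [ j ]≔ true
      x = lookup X j
      vs = vecs d
      extend : ∀ v → Σ⟨ scalars ⟩ (λ c → [ span? X J (v ∔ c ∙ x) ]) ≡ [ span? X J′ v ]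
      extend v = trans (Σ-translates (span X J) x∉ v d?)
        ([]-cong d? (span? X J′ v) (λ (c , p) → span-uninsert X J j c p) (span-insert X J j))
        where d? = any? (λ c → span? X J (v ∔ c ∙ x))

    Closed : Subset n → Set
    Closed a = ∀ j → Span X a (lookup X j) → lookup a j ≡ true

    private
      lookup-closure : ∀ J j → lookup (closure t J) j ≡ does (rank t (J [ j ]≔ true) ℕ.≟ rank t J)
      lookup-closure J j = lookup∘tabulate _ j

    ∈closure⇒ : ∀ J j → lookup (closure t J) j ≡ true → Span X J (lookup X j)
    ∈closure⇒ J j p = rank-insert⇐ J j (ℕ.≡ᵇ⇒≡ _ _ (subst T (trans (sym p) (lookup-closure J j)) tt))

    ∈closure⇐ : ∀ J j → Span X J (lookup X j) → lookup (closure t J) j ≡ true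
    ∈closure⇐ J j s = trans (lookup-closure J j) (dec-true (rank t (J [ j ]≔ true) ℕ.≟ rank t J) (rank-insert⇒ J j s))

    span-closure⇒ : ∀ J {v} → Span X (closure t J) v → Span X J v
    span-closure⇒ J = span-least (span X J) X (closure t J) (∈closure⇒ J)

    span-closure⇐ : ∀ J {v} → Span X J v → Span X (closure t J) v
    span-closure⇐ J = span-mono X (λ j p → ∈closure⇐ J j (member∈span X J j p))

    closure-closed : ∀ J → Closed (closure t J)
    closure-closed J j s = ∈closure⇐ J j (span-closure⇒ J s)

    ∩-closed : ∀ {a b} → Closed a → Closed b → Closed (a ∩ b)
    ∩-closed {a} {b} ca cb j s = trans (lookup-zipWith _ j a b)
      (cong₂ _∧_ (ca j (span-mono X (∩-≼ˡ a b) s)) (cb j (span-mono X (∩-≼ʳ a b) s)))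

    -- If u + c xⱼ ∈ span b with u ∈ span (a ∩ b) and xⱼ ∉ span b, then c = 0.
    span-∩ : ∀ {a b} → Closed b → excess a b ≤ 1 → ∀ {v} → Span X a v → Span X b v → Span X (a ∩ b) v
    span-∩ {a} {b} cb e {v} va vb with excess≤1 a b e
    ... | inj₁ a≼ = span-mono X a≼ va
    ... | inj₂ (j , j∉b , a≼) with span-insert X (a ∩ b) j (span-mono X a≼ va)
    ... | c , u∈ with c ≟ᴷ 0#
    ...   | yes refl = subst (Span X (a ∩ b)) (∔-0 v _) u∈
    ...   | no c≢0 = contradiction (trans (sym (cb j (unscale (span X b) c≢0 (subst (Span X b) eq (closed (span X b) (- 1#) (span-mono X (∩-≼ʳ a b) u∈) vb))))) j∉b) λ ()
      where
      eq : v ∔ c ∙ lookup X j ∔ - 1# ∙ v ≡ 𝟎 ∔ c ∙ lookup X j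
      eq = trans (∔-swap v c _ (- 1#) v) (cong (_∔ c ∙ lookup X j) (∔-self v))

    span-near : ∀ {a b} → Closed a → Closed b → Near a b → ∀ {v} → Span X a v → Span X b v → Span X (a ∩ b) v
    span-near ca cb (inj₁ e) va vb = span-∩ cb e va vb
    span-near {a} {b} ca cb (inj₂ e) {v} va vb = subst (λ s → Span X s v) (∩-comm b a) (span-∩ ca e vb va)
      where open import Data.Fin.Subset.Properties using (∩-comm)

    _∈ᴹ_ : V d → Meet n → Set
    v ∈ᴹ whole   = ⊤
    v ∈ᴹ one a   = Span X a v
    v ∈ᴹ two a b = Span X a v × Span X b v

    Flats : Meet n → Set
    Flats whole     = ⊤
    Flats (one a)   = Closed a
    Flats (two a b) = Closed a × Closed b × ¬ Near a b

    meet₁-flats : ∀ {a c} → Closed a → Closed c → Flats (meet₁ a c)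
    meet₁-flats {a} {c} ca cc with near? a c
    ... | yes _   = ∩-closed ca cc
    ... | no ¬near = ca , cc , ¬near

    meet₁⇒ : ∀ {a c v} → v ∈ᴹ meet₁ a c → Span X a v × Span X c v
    meet₁⇒ {a} {c} p with near? a c
    ... | yes _ = span-mono X (∩-≼ˡ a c) p , span-mono X (∩-≼ʳ a c) p
    ... | no _  = p

    meet₁⇐ : ∀ {a c v} → Closed a → Closed c → Span X a v → Span X c v → v ∈ᴹ meet₁ a c
    meet₁⇐ {a} {c} ca cc va vc with near? a c
    ... | yes near = span-near ca cc near va vc
    ... | no _     = va , vc

    meet-flats : ∀ s {c} → Flats s → Closed c → Flats (meet s c)
    meet-flats whole     _              cc = cc
    meet-flats (one a)   ca             cc = meet₁-flats ca cc
    meet-flats (two a b) {c} (ca , cb , _) cc with near? a c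
    ... | yes _ = meet₁-flats (∩-closed ca cc) cb
    ... | no _  = meet₁-flats (∩-closed cb cc) ca

    meet⇒ : ∀ s {c v} → v ∈ᴹ meet s c → v ∈ᴹ s × Span X c v
    meet⇒ whole         p = tt , p
    meet⇒ (one a)       p = meet₁⇒ p
    meet⇒ (two a b) {c} p with near? a c
    ... | yes _ = let (ac , vb) = meet₁⇒ {a ∩ c} {b} p in (span-mono X (∩-≼ˡ a c) ac , vb) , span-mono X (∩-≼ʳ a c) ac
    ... | no _  = let (bc , va) = meet₁⇒ {b ∩ c} {a} p in (va , span-mono X (∩-≼ˡ b c) bc) , span-mono X (∩-≼ʳ b c) bc

    -- The bound n ≤ 5 enters here. If neither b nor c is near a, then b and c are near each other
    -- and three spans reduce to two.
    meet⇐ : n ≤ 5 → ∀ s {c v} → Flats s → Closed c → v ∈ᴹ s → Span X c v → v ∈ᴹ meet s c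
    meet⇐ n≤5 whole         _                 cc _         vc = vc
    meet⇐ n≤5 (one a)       ca                cc va        vc = meet₁⇐ ca cc va vc
    meet⇐ n≤5 (two a b) {c} (ca , cb , ¬near) cc (va , vb) vc with near? a c
    ... | yes near = meet₁⇐ (∩-closed ca cc) cb (span-near ca cc near va vc) vb
    ... | no ¬ac   = meet₁⇐ (∩-closed cb cc) ca (span-near cb cc (some-pair-near n≤5 a b c ¬near ¬ac) vb vc) va

    meets-flats : ∀ Js → Flats (meets t Js)
    meets-flats []       = tt
    meets-flats (J ∷ Js) = meet-flats (meets t Js) (meets-flats Js) (closure-closed J)

    meets⇒ : ∀ Js {v} → v ∈ᴹ meets t Js → All (λ J → Span X J v) Js
    meets⇒ []       p = []
    meets⇒ (J ∷ Js) p = let (r , s) = meet⇒ (meets t Js) p in span-closure⇒ J s ∷ meets⇒ Js r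

    meets⇐ : n ≤ 5 → ∀ Js {v} → All (λ J → Span X J v) Js → v ∈ᴹ meets t Js
    meets⇐ n≤5 []       []       = tt
    meets⇐ n≤5 (J ∷ Js) (s ∷ ss) = meet⇐ n≤5 (meets t Js) (meets-flats Js) (closure-closed J) (meets⇐ n≤5 Js ss) (span-closure⇐ J s)

    ∈ᴹ? : ∀ s v → Dec (v ∈ᴹ s)
    ∈ᴹ? whole     v = yes tt
    ∈ᴹ? (one a)   v = span? X a v
    ∈ᴹ? (two a b) v = span? X a v ×-dec span? X b v

    card-meet : ∀ s → Σ⟨ vecs d ⟩ (λ v → [ ∈ᴹ? s v ]) ≡ 𝒒 ℤ.^ meetDimension d t s
    card-meet whole     = trans (Σ-vectors-const d 1ℤ) (ℤ.*-identityʳ _)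
    card-meet (one a)   = card-span X a
    card-meet (two a b) = trans D.card≡ (cong (𝒒 ℤ.^_) (trans (sym (ℕ.m+n∸n≡m D.dim (rank t (a ∪ b)))) (cong (ℕ._∸ rank t (a ∪ b)) dims)))
      where
      module D = Dim (dimension (span X a ⋒ span X b))
      dims : D.dim ℕ.+ rank t (a ∪ b) ≡ rank t a ℕ.+ rank t b
      dims = ^-injective _ _ (begin
        𝒒 ℤ.^ (D.dim ℕ.+ rank t (a ∪ b)) ≡⟨ ℤ.^-distribˡ-+-* 𝒒 D.dim (rank t (a ∪ b)) ⟩
        𝒒 ℤ.^ D.dim ℤ.* 𝒒 ℤ.^ rank t (a ∪ b) ≡⟨ cong₂ ℤ._*_ D.card≡ (card-span X (a ∪ b)) ⟨
        card (span X a ⋒ span X b) ℤ.* card (span X (a ∪ b)) ≡⟨ card-modular (span X a) (span X b) (span X (a ∪ b)) (span-∪ X a b)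
        (λ s r → closed (span X (a ∪ b)) 1# (span-mono X (∪-≼ʳ a b) r) (span-mono X (∪-≼ˡ a b) s)) ⟩
        card (span X a) ℤ.* card (span X b) ≡⟨ cong₂ ℤ._*_ (card-span X a) (card-span X b) ⟩
        𝒒 ℤ.^ rank t a ℤ.* 𝒒 ℤ.^ rank t b ≡⟨ ℤ.^-distribˡ-+-* 𝒒 (rank t a) (rank t b) ⟨
        𝒒 ℤ.^ (rank t a ℕ.+ rank t b) ∎)

-- Field-independent sums over extensions, echelon forms and relations

-- Σ_φ w (table of φ) over φ ∈ Kᵈ, for vectors of type t in Kᵈ
extensionSum : ∀ {n} → ℕ → Type n → (Table n → Polynomial) → Polynomial
extensionSum d t w = expand id (λ b Js → w b ⊗ 𝐪 ↑ meetDimension d t (meets t Js)) []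

-- This follows the recursion of `echelons`. A free column is an arbitrary extension of the later
-- ones; a pivot column lies outside every span of later columns, whence the constantly false table.
echelonSum : (d n : ℕ) → (Type n → Polynomial) → Polynomial
echelonSum zero    zero    w = w tt
echelonSum (suc d) zero    w = []
echelonSum zero    (suc n) w = echelonSum zero n (λ t → extensionSum zero t (λ b → w (b , t)))
echelonSum (suc d) (suc n) w = echelonSum (suc d) n (λ t → extensionSum (suc d) t (λ b → w (b , t))) ⊕ echelonSum d n (λ t → w (table (λ _ → false) , t))

-- The Möbius sum over T contained in s, where z T carries the sign -1 to the number of elements of
-- s missing from T.
altSum : ∀ {n} → Subset n → (Subset n → ℤ) → ℤ
altSum []          z = z []
altSum (false ∷ s) z = altSum s (z ∘ (false ∷_))
altSum (true ∷ s)  z = altSum s (z ∘ (true ∷_)) ℤ.- altSum s (z ∘ (false ∷_))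

altPoly : ∀ {n} → Subset n → (Subset n → Polynomial) → Polynomial
altPoly []          z = z []
altPoly (false ∷ s) z = altPoly s (z ∘ (false ∷_))
altPoly (true ∷ s)  z = altPoly s (z ∘ (true ∷_)) ⊕ const (ℤ.- 1ℤ) ⊗ altPoly s (z ∘ (false ∷_))

private
  +-neg1-* : ∀ a b → a ℤ.+ (ℤ.- 1ℤ) ℤ.* b ≡ a ℤ.- b
  +-neg1-* = solve-∀

⟦altPoly⟧ : ∀ {n} (s : Subset n) z x → ⟦ altPoly s z ⟧ x ≡ altSum s (λ T → ⟦ z T ⟧ x)
⟦altPoly⟧ []          z x = refl
⟦altPoly⟧ (false ∷ s) z x = ⟦altPoly⟧ s (z ∘ (false ∷_)) x
⟦altPoly⟧ (true ∷ s)  z x = begin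
  ⟦ p ⊕ const (ℤ.- 1ℤ) ⊗ r ⟧ x ≡⟨ ⟦⊕⟧ p (const (ℤ.- 1ℤ) ⊗ r) x ⟩
  ⟦ p ⟧ x ℤ.+ ⟦ const (ℤ.- 1ℤ) ⊗ r ⟧ x ≡⟨ cong (λ z → ⟦ p ⟧ x ℤ.+ z) (trans (⟦⊗⟧ (const (ℤ.- 1ℤ)) r x) (cong (ℤ._* ⟦ r ⟧ x) (⟦const⟧ (ℤ.- 1ℤ) x))) ⟩
  ⟦ p ⟧ x ℤ.+ (ℤ.- 1ℤ) ℤ.* ⟦ r ⟧ x ≡⟨ +-neg1-* (⟦ p ⟧ x) (⟦ r ⟧ x) ⟩
  ⟦ p ⟧ x ℤ.- ⟦ r ⟧ x ≡⟨ cong₂ ℤ._-_ (⟦altPoly⟧ s (z ∘ (true ∷_)) x) (⟦altPoly⟧ s (z ∘ (false ∷_)) x) ⟩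
  altSum (true ∷ s) (λ T → ⟦ z T ⟧ x) ∎
  where
  p = altPoly s (z ∘ (true ∷_))
  r = altPoly s (z ∘ (false ∷_))

altSum-cong : ∀ {n} (s : Subset n) {y z} → (∀ T → y T ≡ z T) → altSum s y ≡ altSum s z
altSum-cong []          e = e []
altSum-cong (false ∷ s) e = altSum-cong s (e ∘ (false ∷_))
altSum-cong (true ∷ s)  e = cong₂ ℤ._-_ (altSum-cong s (e ∘ (true ∷_))) (altSum-cong s (e ∘ (false ∷_)))

altSum-affine : ∀ {n} (s : Subset n) x z c →
  altSum s (λ T → x ℤ.* z T ℤ.+ c) ≡ x ℤ.* altSum s z ℤ.+ altSum s (λ _ → c)
altSum-affine []          x z c = refl
altSum-affine (false ∷ s) x z c = altSum-affine s x (z ∘ (false ∷_)) c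
altSum-affine (true ∷ s)  x z c = trans
  (cong₂ ℤ._-_ (altSum-affine s x (z ∘ (true ∷_)) c) (altSum-affine s x (z ∘ (false ∷_)) c))
  (lemma x (altSum s (z ∘ (true ∷_))) (altSum s (z ∘ (false ∷_))) (altSum s (λ _ → c)))
  where
  lemma : ∀ x a b k → (x ℤ.* a ℤ.+ k) ℤ.- (x ℤ.* b ℤ.+ k) ≡ x ℤ.* (a ℤ.- b) ℤ.+ (k ℤ.- k)
  lemma = solve-∀

-- Over the subsets of a nonempty set the signs cancel. This disposes of the 1 in q^ν = (q - 1) ⟦
-- `geometric` ν ⟧ + 1 and so leaves a multiple of q - 1 for each nonempty row.
altSum-const : ∀ {n} {s : Subset n} → Nonempty s → ∀ c → altSum s (λ _ → c) ≡ 0ℤ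
altSum-const {s = true ∷ s}  _                  c = ℤ.+-inverseʳ (altSum s (λ _ → c))
altSum-const {s = false ∷ s} (suc j , there j∈) c = altSum-const (j , j∈) c

-- 1/(q − 1) times the number of relations with support exactly s among vectors of type t
relationPoly : ∀ {n} → Subset n → Type n → Polynomial
relationPoly s t = altPoly s (λ T → geometric (nullity t T))

Σ< : ℕ → (ℕ → ℤ) → ℤ
Σ< zero    f = 0ℤ
Σ< (suc n) f = Σ< n f ℤ.+ f n

Σ<-select-≥ : ∀ n k (g : ℕ → ℤ) → n ≤ k → Σ< n (λ i → [ k ℕ.≟ i ] ℤ.* g i) ≡ 0ℤ
Σ<-select-≥ zero    k g _   = refl
Σ<-select-≥ (suc n) k g n<k = cong₂ ℤ._+_ (Σ<-select-≥ n k g (ℕ.<⇒≤ n<k))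
  (trans (cong (ℤ._* g n) ([]-no (k ℕ.≟ n) (ℕ.>⇒≢ n<k))) (ℤ.*-zeroˡ (g n)))

Σ<-select : ∀ n k (g : ℕ → ℤ) → k < n → Σ< n (λ i → [ k ℕ.≟ i ] ℤ.* g i) ≡ g k
Σ<-select (suc n) k g k<1+n with k ℕ.≟ n
... | yes refl = trans (cong₂ ℤ._+_ (Σ<-select-≥ n k g ℕ.≤-refl) (trans (cong (ℤ._* g k) ([]-yes (k ℕ.≟ k) refl)) (ℤ.*-identityˡ (g k)))) (ℤ.+-identityˡ (g k))
... | no k≢n   = trans (cong₂ ℤ._+_ (Σ<-select n k g (ℕ.≤∧≢⇒< (ℕ.≤-pred k<1+n) k≢n)) (trans (cong (ℤ._* g n) ([]-no (k ℕ.≟ n) k≢n)) (ℤ.*-zeroˡ (g n)))) (ℤ.+-identityʳ (g k))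

Σ<-cong : ∀ n {f g} → (∀ i → f i ≡ g i) → Σ< n f ≡ Σ< n g
Σ<-cong zero    e = refl
Σ<-cong (suc n) e = cong₂ ℤ._+_ (Σ<-cong n e) (e n)

Σ-Σ< : ∀ {A : Set} (as : List A) n (f : A → ℕ → ℤ) → Σ⟨ as ⟩ (λ a → Σ< n (f a)) ≡ Σ< n (λ i → Σ⟨ as ⟩ (λ a → f a i))
Σ-Σ< as zero    f = Σ-0 as
Σ-Σ< as (suc n) f = trans (Σ-+ as (λ a → Σ< n (f a)) _) (cong (ℤ._+ Σ⟨ as ⟩ (λ a → f a n)) (Σ-Σ< as n f))

-- Evaluating the sums over a given field

module Boards {q : ℕ} (F : Field q) where

  open Spans F public

  x : ℤ
  x = 𝒒 ℤ.- 1ℤ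

  -- After the expansion each term counts the vectors in an intersection of spans, and `card-meet`
  -- reads that number off the type.
  ⟦extensionSum⟧ : ∀ {d n} → n ≤ 5 → (X : Config d n) (w : Table n → Polynomial) →
    Σ⟨ vecs d ⟩ (λ φ → ⟦ w (table (λ J → does (span? X J φ))) ⟧ x) ≡ ⟦ extensionSum d (typeOf X) w ⟧ x
  ⟦extensionSum⟧ {d} {n} n≤5 X w = sym (trans
    (⟦expand⟧ (vecs d) (λ J φ → Span X J φ) (span? X) x id
      (λ b Js → w b ⊗ 𝐪 ↑ meetDimension d (typeOf X) (meets (typeOf X) Js)) (λ b _ → ⟦ w b ⟧ x) count [])
    (Σ-cong (vecs d) (λ φ → ℤ.*-identityˡ (⟦ w (table (λ J → does (span? X J φ))) ⟧ x))))
    where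
    in-all? = All? (vecs d) (λ J φ → Span X J φ) (span? X) x
    count : ∀ b Js → ⟦ w b ⊗ 𝐪 ↑ meetDimension d (typeOf X) (meets (typeOf X) Js) ⟧ x ≡
        Σ⟨ vecs d ⟩ (λ φ → [ in-all? Js φ ] ℤ.* ⟦ w b ⟧ x)
    count b Js = begin
      ⟦ w b ⊗ 𝐪 ↑ D ⟧ x ≡⟨ ⟦⊗⟧ (w b) (𝐪 ↑ D) x ⟩
      ⟦ w b ⟧ x ℤ.* ⟦ 𝐪 ↑ D ⟧ x ≡⟨ cong (⟦ w b ⟧ x ℤ.*_) (⟦𝐪↑⟧ 𝒒 D) ⟩
      ⟦ w b ⟧ x ℤ.* 𝒒 ℤ.^ D ≡⟨ ℤ.*-comm (⟦ w b ⟧ x) (𝒒 ℤ.^ D) ⟩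
      𝒒 ℤ.^ D ℤ.* ⟦ w b ⟧ x ≡⟨ cong (ℤ._* ⟦ w b ⟧ x) (card-meet X s) ⟨
      Σ⟨ vecs d ⟩ (λ φ → [ ∈ᴹ? X s φ ]) ℤ.* ⟦ w b ⟧ x ≡⟨ Σ-*ʳ (vecs d) (⟦ w b ⟧ x) _ ⟨
      Σ⟨ vecs d ⟩ (λ φ → [ ∈ᴹ? X s φ ] ℤ.* ⟦ w b ⟧ x) ≡⟨ Σ-cong (vecs d) (λ φ → cong (ℤ._* ⟦ w b ⟧ x)
        ([]-cong (∈ᴹ? X s φ) (in-all? Js φ) (meets⇒ X Js) (meets⇐ X n≤5 Js))) ⟩
      Σ⟨ vecs d ⟩ (λ φ → [ in-all? Js φ ] ℤ.* ⟦ w b ⟧ x) ∎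
      where
      s = meets (typeOf X) Js
      D = meetDimension d (typeOf X) s

  span-embed⇒ : ∀ {d n} (X : Config d n) J {a v} → Span (Vec.map (0# ∷_) X) J (a ∷ v) → a ≡ 0# × Span X J v
  span-embed⇒ []      []          refl    = refl , refl
  span-embed⇒ (y ∷ X) (false ∷ J) s       = span-embed⇒ X J s
  span-embed⇒ (y ∷ X) (true ∷ J) {a} (c , s) with span-embed⇒ X J s
  ... | e , s′ = trans (sym (trans (cong (a +_) (zeroʳ c)) (+-identityʳ a))) e , c , s′

  span-embed⇐ : ∀ {d n} (X : Config d n) J {v} → Span X J v → Span (Vec.map (0# ∷_) X) J (0# ∷ v)
  span-embed⇐ []      []          refl    = refl
  span-embed⇐ (y ∷ X) (false ∷ J) s       = span-embed⇐ X J s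
  span-embed⇐ (y ∷ X) (true ∷ J)  {v} (c , s) =
    c , subst (λ a → Span (Vec.map (0# ∷_) X) J (a ∷ v ∔ c ∙ y)) (sym (trans (+-identityˡ _) (zeroʳ c))) (span-embed⇐ X J s)

  typeOf-embed : ∀ {d n} (X : Config d n) → typeOf (Vec.map (0# ∷_) X) ≡ typeOf X
  typeOf-embed []      = refl
  typeOf-embed (y ∷ X) = cong₂ _,_
    (table-cong (λ J → does-⇔ (mk⇔ (proj₂ ∘ span-embed⇒ X J) (span-embed⇐ X J)) (span? (Vec.map (0# ∷_) X) J (0# ∷ y)) (span? X J y)))
    (typeOf-embed X)

  -- In the new coordinate the pivot column has 1 and every other column 0.
  typeOf-pivot : ∀ {d n} (X : Config d n) → typeOf (pivot X) ≡ (table (λ _ → false) , typeOf X)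
  typeOf-pivot X = cong₂ _,_
    (table-cong (λ J → dec-false (span? (Vec.map (0# ∷_) X) J e₀) (λ s → 1≢0 (proj₁ (span-embed⇒ X J s)))))
    (typeOf-embed X)

  -- Of at most six columns the first extends at most five others, which is the range of
  -- `⟦extensionSum⟧`.
  ⟦echelonSum⟧ : ∀ d n → n ≤ 6 → (w : Type n → Polynomial) → Σ⟨ echelons d n ⟩ (λ X → ⟦ w (typeOf X) ⟧ x) ≡ ⟦ echelonSum d n w ⟧ x
  ⟦echelonSum⟧ zero    zero    _         w = ℤ.+-identityʳ (⟦ w tt ⟧ x)
  ⟦echelonSum⟧ (suc d) zero    _         w = refl
  ⟦echelonSum⟧ zero    (suc n) (s≤s n≤5) w = trans (Σ-free zero n (λ X → ⟦ w (typeOf X) ⟧ x))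
    (trans (Σ-cong (echelons zero n) (λ X → ⟦extensionSum⟧ n≤5 X (λ b → w (b , typeOf X)))) (⟦echelonSum⟧ zero n (ℕ.m≤n⇒m≤1+n n≤5) (λ t → extensionSum zero t (λ b → w (b , t)))))
  ⟦echelonSum⟧ (suc d) (suc n) (s≤s n≤5) w = trans (Σ-echelons d n (λ X → ⟦ w (typeOf X) ⟧ x)) (trans
    (cong₂ ℤ._+_
      (trans (Σ-cong (echelons (suc d) n) (λ X → ⟦extensionSum⟧ n≤5 X (λ b → w (b , typeOf X)))) (⟦echelonSum⟧ (suc d) n n≤6 (λ t → extensionSum (suc d) t (λ b → w (b , t)))))
      (trans (Σ-cong (echelons d n) (λ X → cong (λ t → ⟦ w t ⟧ x) (typeOf-pivot X))) (⟦echelonSum⟧ d n n≤6 (λ t → w (table (λ _ → false) , t)))))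
    (sym (⟦⊕⟧ (echelonSum (suc d) n (λ t → extensionSum (suc d) t (λ b → w (b , t)))) (echelonSum d n (λ t → w (table (λ _ → false) , t))) x)))
    where n≤6 = ℕ.m≤n⇒m≤1+n n≤5

  -- From here on a board is the list of the exact supports of the rows.

  nonzero? : Decidable (λ (c : K) → c ≢ 0#)
  nonzero? c = ¬? (c ≟ᴷ 0#)

  units : List K
  units = filter nonzero? scalars

  Σ-scalars : ∀ (h : K → ℤ) → Σ⟨ scalars ⟩ h ≡ Σ⟨ units ⟩ h ℤ.+ h 0#
  Σ-scalars h = begin
    Σ⟨ scalars ⟩ h ≡⟨ Σ-cong scalars (λ c → split c (c ≟ᴷ 0#)) ⟩
    Σ⟨ scalars ⟩ (λ c → [ nonzero? c ] ℤ.* h c ℤ.+ [ c ≟ᴷ 0# ] ℤ.* h c) ≡⟨ Σ-+ scalars (λ c → [ nonzero? c ] ℤ.* h c) _ ⟩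
    Σ⟨ scalars ⟩ (λ c → [ nonzero? c ] ℤ.* h c) ℤ.+ Σ⟨ scalars ⟩ (λ c → [ c ≟ᴷ 0# ] ℤ.* h c) ≡⟨ cong₂ ℤ._+_ (sym (Σ-filter nonzero? scalars h)) (Σ-delta 0# h) ⟩
    Σ⟨ units ⟩ h ℤ.+ h 0# ∎
    where
    split : ∀ c (d : Dec (c ≡ 0#)) → h c ≡ [ ¬? d ] ℤ.* h c ℤ.+ [ d ] ℤ.* h c
    split c d = trans (sym (ℤ.*-identityˡ (h c))) (trans (cong (ℤ._* h c) (sym ([]-¬ d))) (ℤ.*-distribʳ-+ (h c) [ ¬? d ] [ d ]))

  -- Here the support is exactly s, whereas for `supportedIn` it is only contained in the given set.
  rowsOn : ∀ {n} → Subset n → List (V n)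
  rowsOn []          = [] ∷ []
  rowsOn (false ∷ s) = map (0# ∷_) (rowsOn s)
  rowsOn (true ∷ s)  = units ⊠ (rowsOn s)

  Matrices : ∀ {n} → List (Subset n) → List (List (V n))
  Matrices []      = [] ∷ []
  Matrices (s ∷ S) = cartesianProductWith _∷_ (rowsOn s) (Matrices S)

  Σ-altSum : ∀ {A : Set} {n} (as : List A) (s : Subset n) (z : A → Subset n → ℤ) →
    Σ⟨ as ⟩ (λ a → altSum s (z a)) ≡ altSum s (λ T → Σ⟨ as ⟩ (λ a → z a T))
  Σ-altSum as []          z = refl
  Σ-altSum as (false ∷ s) z = Σ-altSum as s (λ a → z a ∘ (false ∷_))
  Σ-altSum as (true ∷ s)  z = trans
    (Σ-+ as (λ a → altSum s (z a ∘ (true ∷_))) _)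
    (cong₂ ℤ._+_ (Σ-altSum as s (λ a → z a ∘ (true ∷_)))
      (trans (Σ-neg as (λ a → altSum s (z a ∘ (false ∷_)))) (cong ℤ.-_ (Σ-altSum as s (λ a → z a ∘ (false ∷_))))))

  inclusion-exclusion : ∀ {n} (s : Subset n) (h : V n → ℤ) → Σ⟨ rowsOn s ⟩ h ≡ altSum s (λ T → Σ⟨ supportedIn T ⟩ h)
  inclusion-exclusion []          h = refl
  inclusion-exclusion (false ∷ s) h = begin
    Σ⟨ map (0# ∷_) (rowsOn s) ⟩ h ≡⟨ Σ-map (0# ∷_) (rowsOn s) h ⟩
    Σ⟨ rowsOn s ⟩ (h ∘ (0# ∷_)) ≡⟨ inclusion-exclusion s (h ∘ (0# ∷_)) ⟩
    altSum s (λ T → Σ⟨ supportedIn T ⟩ (h ∘ (0# ∷_))) ≡⟨ altSum-cong s (λ T → Σ-map (0# ∷_) (supportedIn T) h) ⟨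
    altSum s (λ T → Σ⟨ supportedIn (false ∷ T) ⟩ h) ∎
  inclusion-exclusion (true ∷ s)  h = begin
    Σ⟨ units ⊠ (rowsOn s) ⟩ h ≡⟨ Σ-× _∷_ units (rowsOn s) h ⟩
    Σ⟨ units ⟩ g ≡⟨ ℤ.+-identityʳ (Σ⟨ units ⟩ g) ⟨
    Σ⟨ units ⟩ g ℤ.+ 0ℤ ≡⟨ cong (λ z → Σ⟨ units ⟩ g ℤ.+ z) (ℤ.+-inverseʳ (g 0#)) ⟨
    Σ⟨ units ⟩ g ℤ.+ (g 0# ℤ.- g 0#) ≡⟨ ℤ.+-assoc (Σ⟨ units ⟩ g) (g 0#) (ℤ.- g 0#) ⟨
    Σ⟨ units ⟩ g ℤ.+ g 0# ℤ.- g 0# ≡⟨ cong (ℤ._- g 0#) (Σ-scalars g) ⟨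
    Σ⟨ scalars ⟩ g ℤ.- g 0#
      ≡⟨ cong₂ ℤ._-_ (trans (Σ-cong scalars (λ c → inclusion-exclusion s (h ∘ (c ∷_)))) (trans (Σ-altSum scalars s (λ c T → Σ⟨ supportedIn T ⟩ (h ∘ (c ∷_))))
        (altSum-cong s (λ T → sym (Σ-× _∷_ scalars (supportedIn T) h)))))
        (trans (inclusion-exclusion s (h ∘ (0# ∷_))) (altSum-cong s (λ T → sym (Σ-map (0# ∷_) (supportedIn T) h)))) ⟩
    altSum (true ∷ s) (λ T → Σ⟨ supportedIn T ⟩ h) ∎
    where
    g : K → ℤ
    g c = Σ⟨ rowsOn s ⟩ (h ∘ (c ∷_))

  Σ-rowsOn-relations : ∀ {d n} (X : Config d n) {s} → Nonempty s →
    Σ⟨ rowsOn s ⟩ (λ a → [ combine 𝟎 a X ≟ⱽ 𝟎 ]) ≡ x ℤ.* ⟦ relationPoly s (typeOf X) ⟧ x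
  Σ-rowsOn-relations X {s} s≢∅ = begin
    Σ⟨ rowsOn s ⟩ (λ a → [ combine 𝟎 a X ≟ⱽ 𝟎 ]) ≡⟨ inclusion-exclusion s (λ a → [ combine 𝟎 a X ≟ⱽ 𝟎 ]) ⟩
    altSum s (λ T → Σ⟨ supportedIn T ⟩ (λ a → [ combine 𝟎 a X ≟ⱽ 𝟎 ])) ≡⟨ altSum-cong s term ⟩
    altSum s (λ T → x ℤ.* ⟦ geometric (nullity t T) ⟧ x ℤ.+ 1ℤ) ≡⟨ altSum-affine s x (λ T → ⟦ geometric (nullity t T) ⟧ x) 1ℤ ⟩
    x ℤ.* altSum s (λ T → ⟦ geometric (nullity t T) ⟧ x) ℤ.+ altSum s (λ _ → 1ℤ)
      ≡⟨ cong₂ ℤ._+_ (cong (x ℤ.*_) (sym (⟦altPoly⟧ s (λ T → geometric (nullity t T)) x))) (altSum-const s≢∅ 1ℤ) ⟩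
    x ℤ.* ⟦ relationPoly s t ⟧ x ℤ.+ 0ℤ ≡⟨ ℤ.+-identityʳ (x ℤ.* ⟦ relationPoly s t ⟧ x) ⟩
    x ℤ.* ⟦ relationPoly s t ⟧ x ∎
    where
    t = typeOf X
    p-1+1 : ∀ p → p ≡ p ℤ.- 1ℤ ℤ.+ 1ℤ
    p-1+1 = solve-∀
    term : ∀ T → Σ⟨ supportedIn T ⟩ (λ a → [ combine 𝟎 a X ≟ⱽ 𝟎 ]) ≡ x ℤ.* ⟦ geometric (nullity t T) ⟧ x ℤ.+ 1ℤ
    term T = begin
      Σ⟨ supportedIn T ⟩ (λ a → [ combine 𝟎 a X ≟ⱽ 𝟎 ]) ≡⟨ Σ-relations X T 𝟎 ⟩
      [ span? X T 𝟎 ] ℤ.* 𝒒 ℤ.^ nullity t T ≡⟨ cong (ℤ._* 𝒒 ℤ.^ nullity t T) ([]-yes (span? X T 𝟎) (0∈span X T)) ⟩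
      1ℤ ℤ.* 𝒒 ℤ.^ nullity t T ≡⟨ ℤ.*-identityˡ (𝒒 ℤ.^ nullity t T) ⟩
      𝒒 ℤ.^ nullity t T ≡⟨ p-1+1 (𝒒 ℤ.^ nullity t T) ⟩
      𝒒 ℤ.^ nullity t T ℤ.- 1ℤ ℤ.+ 1ℤ ≡⟨ cong (ℤ._+ 1ℤ) (⟦geometric⟧ 𝒒 (nullity t T)) ⟨
      x ℤ.* ⟦ geometric (nullity t T) ⟧ x ℤ.+ 1ℤ ∎

  -- Kernels, ranks and double counting

  Kernel : ∀ {n} → List (V n) → V n → Set
  Kernel A v = All (λ a → dot a v ≡ 0#) A

  kernel : ∀ {n} → List (V n) → Subspace n
  kernel A = record
    { _∋_    = Kernel A
    ; _∋?_   = λ v → all? (λ a → dot a v ≟ᴷ 0#) A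
    ; zero∈  = All.universal dot-𝟎 A
    ; closed = λ c vs ws → All.zipWith (λ {a} (p , r) → trans (dot-∔ a _ c _) (trans (cong₂ (λ s t → s + c * t) p r) (trans (+-identityˡ _) (zeroʳ c)))) (vs , ws)
    }

  module Kernels {n} (A : List (V n)) = Dim (dimension (kernel A))

  corank : ∀ {n} → List (V n) → ℕ
  corank A = Kernels.dim A

  -- The codimension of the kernel, given as the size of an explicit set of independent columns.
  rk : ∀ {n} → List (V n) → ℕ
  rk A = ∣ Kernels.complement A ∣

  rk+corank : ∀ {n} (A : List (V n)) → rk A ℕ.+ corank A ≡ n
  rk+corank A = Kernels.∣∣+dim A

  count : ∀ {n} → List (Subset n) → ℕ → ℤ
  count S r = Σ⟨ Matrices S ⟩ (λ A → [ rk A ℕ.≟ r ])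

  -- The duality behind the double counting: a vector is a relation among the columns of X exactly
  -- if it is orthogonal to the rows of X. Hence the rows of X lie in the kernel of A exactly if
  -- every row of A is such a relation, and this is a separate condition on each row of A.
  combine≡ : ∀ {d n} (v : V d) (a : V n) (X : Config d n) → combine v a X ≡ zipWith (λ t r → t + dot a r) v (rows X)
  combine≡ v []       []      = base v
    where
    base : ∀ {d} (v : V d) → v ≡ zipWith (λ t r → t + dot [] r) v (replicate d [])
    base []      = refl
    base (a ∷ v) = cong₂ _∷_ (sym (+-identityʳ a)) (base v)
  combine≡ v (a ∷ as) (y ∷ X) = trans (combine≡ (v ∔ a ∙ y) as X) (shuffle v y (rows X))
    where
    shuffle : ∀ {d} (v y : V d) (R : Vec (V _) d) →
      zipWith (λ t r → t + dot as r) (v ∔ a ∙ y) R ≡ zipWith (λ t r → t + dot (a ∷ as) r) v (zipWith _∷_ y R)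
    shuffle []      []      []      = refl
    shuffle (b ∷ v) (c ∷ y) (r ∷ R) = cong₂ _∷_ (+-assoc b (a * c) (dot as r)) (shuffle v y R)

  orthogonal⇒ : ∀ {d n} (a : V n) (R : Vec (V n) d) → zipWith (λ t r → t + dot a r) 𝟎 R ≡ 𝟎 → VecAll.All (λ r → dot a r ≡ 0#) R
  orthogonal⇒ a []      _ = VecAll.[]
  orthogonal⇒ a (r ∷ R) e = trans (sym (+-identityˡ _)) (cong Vec.head e) VecAll.∷ orthogonal⇒ a R (cong Vec.tail e)

  orthogonal⇐ : ∀ {d n} (a : V n) (R : Vec (V n) d) → VecAll.All (λ r → dot a r ≡ 0#) R → zipWith (λ t r → t + dot a r) 𝟎 R ≡ 𝟎
  orthogonal⇐ a []      VecAll.[]       = refl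
  orthogonal⇐ a (r ∷ R) (p VecAll.∷ ps) = cong₂ _∷_ (trans (+-identityˡ _) p) (orthogonal⇐ a R ps)

  in-kernel⇒ : ∀ {d n} (A : List (V n)) (X : Config d n) → VecAll.All (Kernel A) (rows X) → All (λ a → combine 𝟎 a X ≡ 𝟎) A
  in-kernel⇒ []      X k = []
  in-kernel⇒ (a ∷ A) X k = trans (combine≡ 𝟎 a X) (orthogonal⇐ a (rows X) (VecAll.map All.head k)) ∷ in-kernel⇒ A X (VecAll.map All.tail k)

  in-kernel⇐ : ∀ {d n} (A : List (V n)) (X : Config d n) → All (λ a → combine 𝟎 a X ≡ 𝟎) A → VecAll.All (Kernel A) (rows X)
  in-kernel⇐ []      X []       = VecAll.universal (λ _ → []) (rows X)
  in-kernel⇐ (a ∷ A) X (p ∷ ps) = VecAll.map (λ (r , rs) → r ∷ rs)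
    (VecAll.zip (orthogonal⇒ a (rows X) (trans (sym (combine≡ 𝟎 a X)) p) , in-kernel⇐ A X ps))

  [all?]-Π : ∀ {A : Set} {P : A → Set} (P? : Decidable P) as → [ all? P? as ] ≡ Π⟨ as ⟩ (λ a → [ P? a ])
  [all?]-Π P? []       = refl
  [all?]-Π P? (a ∷ as) = trans ([]-cong (all? P? (a ∷ as)) (P? a ×-dec all? P? as) All.uncons (λ (p , ps) → p ∷ ps))
    (trans ([]-× (P? a) (all? P? as)) (cong ([ P? a ] ℤ.*_) ([all?]-Π P? as)))

  Σ-Matrices-Π : ∀ {n} (S : List (Subset n)) (h : V n → ℤ) → Σ⟨ Matrices S ⟩ (λ A → Π⟨ A ⟩ h) ≡ Π⟨ S ⟩ (λ s → Σ⟨ rowsOn s ⟩ h)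
  Σ-Matrices-Π []      h = refl
  Σ-Matrices-Π (s ∷ S) h = begin
    Σ⟨ cartesianProductWith _∷_ (rowsOn s) (Matrices S) ⟩ (λ A → Π⟨ A ⟩ h) ≡⟨ Σ-× _∷_ (rowsOn s) (Matrices S) _ ⟩
    Σ⟨ rowsOn s ⟩ (λ a → Σ⟨ Matrices S ⟩ (λ A → h a ℤ.* Π⟨ A ⟩ h)) ≡⟨ Σ-cong (rowsOn s) (λ a → Σ-*ˡ (Matrices S) (h a) _) ⟩
    Σ⟨ rowsOn s ⟩ (λ a → h a ℤ.* Σ⟨ Matrices S ⟩ (λ A → Π⟨ A ⟩ h)) ≡⟨ Σ-*ʳ (rowsOn s) (Σ⟨ Matrices S ⟩ (λ A → Π⟨ A ⟩ h)) h ⟩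
    Σ⟨ rowsOn s ⟩ h ℤ.* Σ⟨ Matrices S ⟩ (λ A → Π⟨ A ⟩ h) ≡⟨ cong (Σ⟨ rowsOn s ⟩ h ℤ.*_) (Σ-Matrices-Π S h) ⟩
    Σ⟨ rowsOn s ⟩ h ℤ.* Π⟨ S ⟩ (λ s → Σ⟨ rowsOn s ⟩ h) ∎

  Π-relations : ∀ {d n} (X : Config d n) {S} → All Nonempty S →
    Π⟨ S ⟩ (λ s → Σ⟨ rowsOn s ⟩ (λ a → [ combine 𝟎 a X ≟ⱽ 𝟎 ])) ≡ x ℤ.^ length S ℤ.* ⟦ polyProduct S (λ s → relationPoly s (typeOf X)) ⟧ x
  Π-relations X {[]}    []         = sym (trans (ℤ.*-identityˡ _) (⟦const⟧ 1ℤ x))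
  Π-relations X {s ∷ S} (ne ∷ nes) = begin
    Σ⟨ rowsOn s ⟩ h ℤ.* Π⟨ S ⟩ (λ s → Σ⟨ rowsOn s ⟩ h) ≡⟨ cong₂ ℤ._*_ (Σ-rowsOn-relations X ne) (Π-relations X nes) ⟩
    x ℤ.* p ℤ.* (x ℤ.^ length S ℤ.* r) ≡⟨ lemma x p (x ℤ.^ length S) r ⟩
    x ℤ.* x ℤ.^ length S ℤ.* (p ℤ.* r) ≡⟨ cong (x ℤ.^ length (s ∷ S) ℤ.*_) (⟦⊗⟧ (relationPoly s (typeOf X)) (polyProduct S (λ s → relationPoly s (typeOf X))) x) ⟨
    x ℤ.^ length (s ∷ S) ℤ.* ⟦ polyProduct (s ∷ S) (λ s → relationPoly s (typeOf X)) ⟧ x ∎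
    where
    h : V _ → ℤ
    h a = [ combine 𝟎 a X ≟ⱽ 𝟎 ]
    p = ⟦ relationPoly s (typeOf X) ⟧ x
    r = ⟦ polyProduct S (λ s → relationPoly s (typeOf X)) ⟧ x
    lemma : ∀ x p y r → x ℤ.* p ℤ.* (y ℤ.* r) ≡ x ℤ.* y ℤ.* (p ℤ.* r)
    lemma = solve-∀

  -- Double counting of the pairs (A , U) with U a k-dimensional subspace of ker A.
  Σ-gaussian : ∀ {n} → n ≤ 6 → (S : List (Subset n)) → All Nonempty S → ∀ k →
    Σ⟨ Matrices S ⟩ (λ A → ⟦ gaussian (corank A) k ⟧ x) ≡ x ℤ.^ length S ℤ.* ⟦ echelonSum k n (λ t → polyProduct S (λ s → relationPoly s t)) ⟧ x
  Σ-gaussian {n} n≤6 S ne k = begin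
    Σ⟨ Matrices S ⟩ (λ A → ⟦ gaussian (corank A) k ⟧ x) ≡⟨ Σ-cong (Matrices S) (λ A → Kernels.echelons≡ A k) ⟨
    Σ⟨ Matrices S ⟩ (λ A → Σ⟨ echelons k n ⟩ (λ X → [ VecAll.all? (kernel A ∋?_) (rows X) ])) ≡⟨ Σ-comm (Matrices S) (echelons k n) _ ⟩
    Σ⟨ echelons k n ⟩ (λ X → Σ⟨ Matrices S ⟩ (λ A → [ VecAll.all? (kernel A ∋?_) (rows X) ])) ≡⟨ Σ-cong (echelons k n) fixed ⟩
    Σ⟨ echelons k n ⟩ (λ X → x ℤ.^ length S ℤ.* ⟦ polyProduct S (λ s → relationPoly s (typeOf X)) ⟧ x) ≡⟨ Σ-*ˡ (echelons k n) (x ℤ.^ length S) _ ⟩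
    x ℤ.^ length S ℤ.* Σ⟨ echelons k n ⟩ (λ X → ⟦ polyProduct S (λ s → relationPoly s (typeOf X)) ⟧ x) ≡⟨ cong (x ℤ.^ length S ℤ.*_) (⟦echelonSum⟧ k n n≤6 (λ t → polyProduct S (λ s → relationPoly s t))) ⟩
    x ℤ.^ length S ℤ.* ⟦ echelonSum k n (λ t → polyProduct S (λ s → relationPoly s t)) ⟧ x ∎
    where
    fixed : ∀ X → Σ⟨ Matrices S ⟩ (λ A → [ VecAll.all? (kernel A ∋?_) (rows X) ]) ≡ x ℤ.^ length S ℤ.* ⟦ polyProduct S (λ s → relationPoly s (typeOf X)) ⟧ x
    fixed X = begin
      Σ⟨ Matrices S ⟩ (λ A → [ VecAll.all? (kernel A ∋?_) (rows X) ]) ≡⟨ Σ-cong (Matrices S) (λ A → trans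
        ([]-cong (VecAll.all? (kernel A ∋?_) (rows X)) (all? (λ a → combine 𝟎 a X ≟ⱽ 𝟎) A) (in-kernel⇒ A X) (in-kernel⇐ A X))
        ([all?]-Π (λ a → combine 𝟎 a X ≟ⱽ 𝟎) A)) ⟩
      Σ⟨ Matrices S ⟩ (λ A → Π⟨ A ⟩ (λ a → [ combine 𝟎 a X ≟ⱽ 𝟎 ])) ≡⟨ Σ-Matrices-Π S (λ a → [ combine 𝟎 a X ≟ⱽ 𝟎 ]) ⟩
      Π⟨ S ⟩ (λ s → Σ⟨ rowsOn s ⟩ (λ a → [ combine 𝟎 a X ≟ⱽ 𝟎 ])) ≡⟨ Π-relations X ne ⟩
      x ℤ.^ length S ℤ.* ⟦ polyProduct S (λ s → relationPoly s (typeOf X)) ⟧ x ∎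

  corank≡ : ∀ {n} (A : List (V n)) → corank A ≡ n ℕ.∸ rk A
  corank≡ A = trans (sym (ℕ.m+n∸m≡n (rk A) (corank A))) (cong (ℕ._∸ rk A) (rk+corank A))

  rk≤ : ∀ {n} (A : List (V n)) → rk A ≤ n
  rk≤ A = ℕ.≤-trans (ℕ.m≤m+n (rk A) (corank A)) (ℕ.≤-reflexive (rk+corank A))

  -- A matrix of rank above r has no kernel subspace of dimension n - r, and one of rank r has
  -- exactly one. As r varies, the equations for the counts form a unitriangular system.
  Σ-by-rank : ∀ {n} (S : List (Subset n)) r → r ≤ n →
    Σ⟨ Matrices S ⟩ (λ A → ⟦ gaussian (corank A) (n ℕ.∸ r) ⟧ x) ≡ Σ< r (λ i → count S i ℤ.* ⟦ gaussian (n ℕ.∸ i) (n ℕ.∸ r) ⟧ x) ℤ.+ count S r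
  Σ-by-rank {n} S r r≤n = begin
    Σ⟨ Matrices S ⟩ (λ A → ⟦ gaussian (corank A) (n ℕ.∸ r) ⟧ x) ≡⟨ Σ-cong (Matrices S) pointwise ⟩
    Σ⟨ Matrices S ⟩ (λ A → Σ< (suc r) (λ i → [ rk A ℕ.≟ i ] ℤ.* g i)) ≡⟨ Σ-Σ< (Matrices S) (suc r) _ ⟩
    Σ< (suc r) (λ i → Σ⟨ Matrices S ⟩ (λ A → [ rk A ℕ.≟ i ] ℤ.* g i)) ≡⟨ Σ<-cong (suc r) (λ i → Σ-*ʳ (Matrices S) (g i) _) ⟩
    Σ< r (λ i → count S i ℤ.* g i) ℤ.+ count S r ℤ.* g r ≡⟨ cong (λ z → Σ< r (λ i → count S i ℤ.* g i) ℤ.+ z)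
        (trans (cong (count S r ℤ.*_) (⟦gaussian⟧-≡ (n ℕ.∸ r) x)) (ℤ.*-identityʳ (count S r))) ⟩
    Σ< r (λ i → count S i ℤ.* g i) ℤ.+ count S r ∎
    where
    g : ℕ → ℤ
    g i = ⟦ gaussian (n ℕ.∸ i) (n ℕ.∸ r) ⟧ x
    pointwise : ∀ A → ⟦ gaussian (corank A) (n ℕ.∸ r) ⟧ x ≡ Σ< (suc r) (λ i → [ rk A ℕ.≟ i ] ℤ.* g i)
    pointwise A rewrite corank≡ A with rk A ℕ.≤? r
    ... | yes ≤r = sym (Σ<-select (suc r) (rk A) g (s≤s ≤r))
    ... | no ≰r  = trans (⟦gaussian⟧-> (n ℕ.∸ rk A) (n ℕ.∸ r) x (ℕ.∸-monoʳ-< (ℕ.≰⇒> ≰r) (rk≤ A))) (sym (Σ<-select-≥ (suc r) (rk A) g (ℕ.≰⇒> ≰r)))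

-- The exact count for at most six columns

q-1 : ∀ {q} → Field q → ℤ
q-1 {q} _ = ℤ.+ q ℤ.- 1ℤ

Family : Set
Family = ∀ {q} → Field q → ℤ

-- P is chosen before q and F, so a single polynomial serves all finite fields.
PolynomialMultiple : ℕ → Family → Set
PolynomialMultiple m f = ∃[ P ] (∀ {q} (F : Field q) → f F ≡ (q-1 F) ℤ.^ m ℤ.* ⟦ P ⟧ (q-1 F))

private
  Σ<-multiple : ∀ m n (f : ℕ → Family) (g : ℕ → Polynomial) → (∀ i → i < n → PolynomialMultiple m (f i)) →
    PolynomialMultiple m (λ F → Σ< n (λ i → f i F ℤ.* ⟦ g i ⟧ (q-1 F)))
  Σ<-multiple m zero    f g h = [] , λ F → sym (ℤ.*-zeroʳ ((q-1 F) ℤ.^ m))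
  Σ<-multiple m (suc n) f g h with Σ<-multiple m n f g (λ i i<n → h i (ℕ.m<n⇒m<1+n i<n)) | h n ℕ.≤-refl
  ... | P , eP | Q , eQ = P ⊕ Q ⊗ g n , λ F → let x = q-1 F in
    trans (cong₂ (λ u v → u ℤ.+ v ℤ.* ⟦ g n ⟧ x) (eP F) (eQ F))
      (trans (lemma (x ℤ.^ m) (⟦ P ⟧ x) (⟦ Q ⟧ x) (⟦ g n ⟧ x))
        (cong (x ℤ.^ m ℤ.*_) (sym (trans (⟦⊕⟧ P (Q ⊗ g n) x) (cong (λ z → ⟦ P ⟧ x ℤ.+ z) (⟦⊗⟧ Q (g n) x))))))
    where
    lemma : ∀ y p q g → y ℤ.* p ℤ.+ y ℤ.* q ℤ.* g ≡ y ℤ.* (p ℤ.+ q ℤ.* g)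
    lemma = solve-∀

-- The unitriangular system of `Σ-by-rank` is solved by strong induction on r. Its diagonal is 1, so
-- no denominators arise and the common factor (q - 1)^m of the right-hand sides from `Σ-gaussian`
-- survives.
count-polynomial : ∀ {n} → n ≤ 6 → (S : List (Subset n)) → All Nonempty S → ∀ r → PolynomialMultiple (length S) (λ F → Boards.count F S r)
count-polynomial {n} n≤6 S ne = <-rec _ solve
  where
  m = length S
  solve : ∀ r → (∀ {i} → i < r → PolynomialMultiple m (λ F → Boards.count F S i)) → PolynomialMultiple m (λ F → Boards.count F S r)
  solve r rec with r ℕ.≤? n
  ... | no r≰n = [] , λ F → let open Boards F in
    trans (trans (Σ-cong (Matrices S) (λ A → []-no (rk A ℕ.≟ r) (λ e → r≰n (subst (_≤ n) e (rk≤ A))))) (Σ-0 (Matrices S))) (sym (ℤ.*-zeroʳ (x ℤ.^ m)))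
  ... | yes r≤n with Σ<-multiple m r (λ i F → Boards.count F S i) (λ i → gaussian (n ℕ.∸ i) (n ℕ.∸ r)) (λ i → rec)
  ... | P , eP = E ⊕ const (ℤ.- 1ℤ) ⊗ P , λ F → let open Boards F using (x) in begin
    Boards.count F S r
      ≡⟨ cancel (Σ< r (λ i → Boards.count F S i ℤ.* ⟦ gaussian (n ℕ.∸ i) (n ℕ.∸ r) ⟧ x)) (Boards.count F S r) ⟩
    Σ< r (λ i → Boards.count F S i ℤ.* ⟦ gaussian (n ℕ.∸ i) (n ℕ.∸ r) ⟧ x) ℤ.+ Boards.count F S r ℤ.- Σ< r (λ i → Boards.count F S i ℤ.* ⟦ gaussian (n ℕ.∸ i) (n ℕ.∸ r) ⟧ x)
      ≡⟨ cong₂ ℤ._-_ (trans (sym (Boards.Σ-by-rank F S r r≤n)) (Boards.Σ-gaussian F n≤6 S ne (n ℕ.∸ r))) (eP F) ⟩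
    x ℤ.^ m ℤ.* ⟦ E ⟧ x ℤ.- x ℤ.^ m ℤ.* ⟦ P ⟧ x
      ≡⟨ factor (x ℤ.^ m) (⟦ E ⟧ x) (⟦ P ⟧ x) ⟩
    x ℤ.^ m ℤ.* (⟦ E ⟧ x ℤ.+ (ℤ.- 1ℤ) ℤ.* ⟦ P ⟧ x)
      ≡⟨ cong (x ℤ.^ m ℤ.*_) (trans (⟦⊕⟧ E (const (ℤ.- 1ℤ) ⊗ P) x) (cong (λ z → ⟦ E ⟧ x ℤ.+ z) (trans (⟦⊗⟧ (const (ℤ.- 1ℤ)) P x) (cong (ℤ._* ⟦ P ⟧ x) (⟦const⟧ (ℤ.- 1ℤ) x))))) ⟨
    x ℤ.^ m ℤ.* ⟦ E ⊕ const (ℤ.- 1ℤ) ⊗ P ⟧ x ∎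
    where
    E = echelonSum (n ℕ.∸ r) n (λ t → polyProduct S (λ s → relationPoly s t))
    cancel : ∀ a b → b ≡ a ℤ.+ b ℤ.- a
    cancel = solve-∀
    factor : ∀ y e p → y ℤ.* e ℤ.- y ℤ.* p ≡ y ℤ.* (e ℤ.+ (ℤ.- 1ℤ) ℤ.* p)
    factor = solve-∀

-- Rank under row permutations and column scalings

module Torus {q : ℕ} (F : Field q) where

  open Boards F public

  -- Rank and kernels

  image : ∀ {n} → (A : List (V n)) → V n → V (length A)
  image []      v = []
  image (a ∷ A) v = dot a v ∷ image A v

  image-∔ : ∀ {n} (A : List (V n)) v c w → image A (v ∔ c ∙ w) ≡ image A v ∔ c ∙ image A w
  image-∔ []      v c w = refl
  image-∔ (a ∷ A) v c w = cong₂ _∷_ (dot-∔ a v c w) (image-∔ A v c w)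

  image-𝟎 : ∀ {n} (A : List (V n)) → image A 𝟎 ≡ 𝟎
  image-𝟎 []      = refl
  image-𝟎 (a ∷ A) = cong₂ _∷_ (dot-𝟎 a) (image-𝟎 A)

  image≡𝟎⇒ : ∀ {n} (A : List (V n)) {v} → image A v ≡ 𝟎 → Kernel A v
  image≡𝟎⇒ []      e = []
  image≡𝟎⇒ (a ∷ A) e = cong Vec.head e ∷ image≡𝟎⇒ A (cong Vec.tail e)

  image≡𝟎⇐ : ∀ {n} (A : List (V n)) {v} → Kernel A v → image A v ≡ 𝟎
  image≡𝟎⇐ []      []       = refl
  image≡𝟎⇐ (a ∷ A) (p ∷ ps) = cong₂ _∷_ p (image≡𝟎⇐ A ps)

  range : ∀ {n} (A : List (V n)) → Subspace (length A)
  range {n} A = record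
    { _∋_    = λ w → ∃[ v ] image A v ≡ w
    ; _∋?_   = λ w → any-vector? n (λ v → image A v ≟ⱽ w)
    ; zero∈  = 𝟎 , image-𝟎 A
    ; closed = λ { c (v , refl) (w , refl) → v ∔ c ∙ w , image-∔ A v c w }
    }

  ∔-cancel : ∀ {n} (v w z : V n) → v ∔ 1# ∙ z ≡ w ∔ 1# ∙ z → v ≡ w
  ∔-cancel v w z e = trans (sym (∔-∙-neg v 1# z)) (trans (cong (_∔ - 1# ∙ z) e) (∔-∙-neg w 1# z))

  Σ-≡ : ∀ {n} (z : V n) → Σ⟨ vecs n ⟩ (λ w → [ z ≟ⱽ w ]) ≡ 1ℤ
  Σ-≡ {n} z = begin
    Σ⟨ vecs n ⟩ (λ w → [ z ≟ⱽ w ]) ≡⟨ Σ-translate n 1# z _ ⟨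
    Σ⟨ vecs n ⟩ (λ w → [ z ≟ⱽ (w ∔ 1# ∙ z) ]) ≡⟨ Σ-cong (vecs n) (λ w → []-cong (z ≟ⱽ (w ∔ 1# ∙ z)) (w ≟ⱽ 𝟎)
        (λ e → ∔-cancel w 𝟎 z (trans (sym e) (sym (𝟎-∔ z)))) (λ { refl → sym (𝟎-∔ z) })) ⟩
    Σ⟨ vecs n ⟩ (λ w → [ w ≟ⱽ 𝟎 ]) ≡⟨ Σ-𝟎 n ⟩
    1ℤ ∎

  -- Rank-nullity by counting: every nonempty fibre of `image A` is a translate of the kernel.
  card-range : ∀ {n} (A : List (V n)) → card (kernel A) ℤ.* card (range A) ≡ 𝒒 ℤ.^ n
  card-range {n} A = begin
    card (kernel A) ℤ.* card (range A) ≡⟨ Σ-*ˡ ws (card (kernel A)) _ ⟨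
    Σ⟨ ws ⟩ (λ w → card (kernel A) ℤ.* [ range A ∋? w ]) ≡⟨ Σ-cong ws (λ w → fibre w (range A ∋? w)) ⟨
    Σ⟨ ws ⟩ (λ w → Σ⟨ vs ⟩ (λ v → [ image A v ≟ⱽ w ])) ≡⟨ Σ-comm ws vs _ ⟩
    Σ⟨ vs ⟩ (λ v → Σ⟨ ws ⟩ (λ w → [ image A v ≟ⱽ w ])) ≡⟨ Σ-cong vs (λ v → Σ-≡ (image A v)) ⟩
    Σ⟨ vs ⟩ (λ _ → 1ℤ) ≡⟨ Σ-vectors-const n 1ℤ ⟩
    𝒒 ℤ.^ n ℤ.* 1ℤ ≡⟨ ℤ.*-identityʳ (𝒒 ℤ.^ n) ⟩
    𝒒 ℤ.^ n ∎
    where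
    vs = vecs n
    ws = vecs (length A)
    fibre : ∀ w (d : Dec (∃[ v ] image A v ≡ w)) → Σ⟨ vs ⟩ (λ v → [ image A v ≟ⱽ w ]) ≡ card (kernel A) ℤ.* [ d ]
    fibre w (no ∄v) = trans (trans (Σ-cong vs (λ v → []-no (image A v ≟ⱽ w) (λ e → ∄v (v , e)))) (Σ-0 vs)) (sym (ℤ.*-zeroʳ (card (kernel A))))
    fibre w (yes (u , refl)) = begin
      Σ⟨ vs ⟩ (λ v → [ image A v ≟ⱽ w ]) ≡⟨ Σ-translate n 1# u _ ⟨
      Σ⟨ vs ⟩ (λ v → [ image A (v ∔ 1# ∙ u) ≟ⱽ w ]) ≡⟨ Σ-cong vs (λ v → []-cong (image A (v ∔ 1# ∙ u) ≟ⱽ w) (kernel A ∋? v)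
        (λ e → image≡𝟎⇒ A (∔-cancel (image A v) 𝟎 w (trans (sym (image-∔ A v 1# u)) (trans e (sym (𝟎-∔ w))))))
        (λ k → trans (image-∔ A v 1# u) (trans (cong (_∔ 1# ∙ w) (image≡𝟎⇐ A k)) (𝟎-∔ w)))) ⟩
      card (kernel A) ≡⟨ ℤ.*-identityʳ (card (kernel A)) ⟨
      card (kernel A) ℤ.* 1ℤ ∎

  rk≤length : ∀ {n} (A : List (V n)) → rk A ≤ length A
  rk≤length {n} A = ℕ.≤-trans (ℕ.≤-reflexive rk≡) (ℕ.≤-trans (ℕ.m≤n+m R.dim ∣ R.complement ∣) (ℕ.≤-reflexive R.∣∣+dim))
    where
    module R = Dim (dimension (range A))
    rk≡ : rk A ≡ R.dim
    rk≡ = ℕ.+-cancelʳ-≡ (corank A) (rk A) R.dim (trans (rk+corank A) (trans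
      (^-injective n (corank A ℕ.+ R.dim) (trans (sym (card-range A)) (trans (cong₂ ℤ._*_ (Kernels.card≡ A) R.card≡) (sym (ℤ.^-distribˡ-+-* 𝒒 (corank A) R.dim)))))
      (ℕ.+-comm (corank A) R.dim)))

  rk-card : ∀ {n} (A B : List (V n)) → card (kernel A) ≡ card (kernel B) → rk A ≡ rk B
  rk-card A B e = ℕ.+-cancelʳ-≡ (corank A) (rk A) (rk B) (trans (rk+corank A) (trans (sym (rk+corank B)) (cong (rk B ℕ.+_)
    (^-injective (corank B) (corank A) (trans (sym (Kernels.card≡ B)) (trans (sym e) (Kernels.card≡ A)))))))

  rk-kernel : ∀ {n} (A B : List (V n)) → (∀ {v} → Kernel A v → Kernel B v) → (∀ {v} → Kernel B v → Kernel A v) → rk A ≡ rk B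
  rk-kernel A B f g = rk-card A B (card-cong (kernel A) (kernel B) f g)

  -- P holds rows that are already fixed. Along a chain the rows are summed one at a time, each
  -- passing from S into P.
  countWith : ∀ {n} → List (V n) → List (Subset n) → ℕ → ℤ
  countWith P S r = Σ⟨ Matrices S ⟩ (λ A → [ rk (A ++ P) ℕ.≟ r ])

  count≡countWith : ∀ {n} (S : List (Subset n)) r → count S r ≡ countWith [] S r
  count≡countWith S r = Σ-cong (Matrices S) (λ A → cong (λ B → [ rk B ℕ.≟ r ]) (sym (++-identityʳ A)))

  Kernel-shift⇒ : ∀ {n} (A : List (V n)) {a P v} → Kernel (a ∷ A ++ P) v → Kernel (A ++ a ∷ P) v
  Kernel-shift⇒ A (p ∷ k) = let (kA , kP) = All.++⁻ A k in All.++⁺ kA (p ∷ kP)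

  Kernel-shift⇐ : ∀ {n} (A : List (V n)) {a P v} → Kernel (A ++ a ∷ P) v → Kernel (a ∷ A ++ P) v
  Kernel-shift⇐ A k with All.++⁻ A k
  ... | kA , p ∷ kP = p ∷ All.++⁺ kA kP

  countWith-∷ : ∀ {n} P (s : Subset n) S r → countWith P (s ∷ S) r ≡ Σ⟨ rowsOn s ⟩ (λ a → countWith (a ∷ P) S r)
  countWith-∷ P s S r = trans (Σ-× _∷_ (rowsOn s) (Matrices S) _)
    (Σ-cong (rowsOn s) (λ a → Σ-cong (Matrices S) (λ A → cong (λ k → [ k ℕ.≟ r ])
      (rk-kernel (a ∷ A ++ P) (A ++ a ∷ P) (Kernel-shift⇒ A) (Kernel-shift⇐ A)))))

  countWith-swap : ∀ {n} (a b : V n) P S r → countWith (a ∷ b ∷ P) S r ≡ countWith (b ∷ a ∷ P) S r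
  countWith-swap a b P S r = Σ-cong (Matrices S) (λ A → cong (λ k → [ k ℕ.≟ r ])
    (rk-kernel (A ++ a ∷ b ∷ P) (A ++ b ∷ a ∷ P) (swap A) (swap A)))
    where
    swap : ∀ A {a b v} → Kernel (A ++ a ∷ b ∷ P) v → Kernel (A ++ b ∷ a ∷ P) v
    swap A k with All.++⁻ A k
    ... | kA , p ∷ p′ ∷ kP = All.++⁺ kA (p′ ∷ p ∷ kP)

  countWith-↭ : ∀ {n} P {S S′ : List (Subset n)} → S ↭ S′ → ∀ r → countWith P S r ≡ countWith P S′ r
  countWith-↭ P ↭.refl r = refl
  countWith-↭ P {s ∷ S} {.s ∷ S′} (↭.prep s σ) r = trans (countWith-∷ P s S r)
    (trans (Σ-cong (rowsOn s) (λ a → countWith-↭ (a ∷ P) σ r)) (sym (countWith-∷ P s S′ r)))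
  countWith-↭ P {s ∷ s′ ∷ S} {.s′ ∷ .s ∷ S′} (↭.swap s s′ σ) r = begin
    countWith P (s ∷ s′ ∷ S) r ≡⟨ two-rows s s′ S ⟩
    Σ⟨ rowsOn s ⟩ (λ a → Σ⟨ rowsOn s′ ⟩ (λ b → countWith (b ∷ a ∷ P) S r)) ≡⟨ Σ-comm (rowsOn s) (rowsOn s′) _ ⟩
    Σ⟨ rowsOn s′ ⟩ (λ b → Σ⟨ rowsOn s ⟩ (λ a → countWith (b ∷ a ∷ P) S r)) ≡⟨ Σ-cong (rowsOn s′) (λ b → Σ-cong (rowsOn s) (λ a →
        trans (countWith-swap b a P S r) (countWith-↭ (a ∷ b ∷ P) σ r))) ⟩
    Σ⟨ rowsOn s′ ⟩ (λ b → Σ⟨ rowsOn s ⟩ (λ a → countWith (a ∷ b ∷ P) S′ r)) ≡⟨ two-rows s′ s S′ ⟨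
    countWith P (s′ ∷ s ∷ S′) r ∎
    where
    two-rows : ∀ s s′ S → countWith P (s ∷ s′ ∷ S) r ≡ Σ⟨ rowsOn s ⟩ (λ a → Σ⟨ rowsOn s′ ⟩ (λ b → countWith (b ∷ a ∷ P) S r))
    two-rows s s′ S = trans (countWith-∷ P s (s′ ∷ S) r) (Σ-cong (rowsOn s) (λ a → countWith-∷ (a ∷ P) s′ S r))
  countWith-↭ P (↭.trans σ τ) r = trans (countWith-↭ P σ r) (countWith-↭ P τ r)

  Supported-mono : ∀ {n} {s C : Subset n} → s ≼ C → ∀ {a} → Supported s a → Supported C a
  Supported-mono {s = []}        {[]}        s≼C []      = []
  Supported-mono {s = true ∷ s}  {true ∷ C}  s≼C (on p)  = on (Supported-mono (s≼C ∘ suc) p)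
  Supported-mono {s = true ∷ s}  {false ∷ C} s≼C (on p)  with s≼C zero refl
  ... | ()
  Supported-mono {s = false ∷ s} {true ∷ C}  s≼C (off p) = on (Supported-mono (s≼C ∘ suc) p)
  Supported-mono {s = false ∷ s} {false ∷ C} s≼C (off p) = off (Supported-mono (s≼C ∘ suc) p)

  rowsOn-Supported : ∀ {n} (s : Subset n) {a} → a ∈ rowsOn s → Supported s a
  rowsOn-Supported []          (here refl) = []
  rowsOn-Supported (false ∷ s) a∈ with ∈-map⁻ (0# ∷_) a∈
  ... | a , a∈′ , refl = off (rowsOn-Supported s a∈′)
  rowsOn-Supported (true ∷ s)  a∈ with ∈-cartesianProductWith⁻ _∷_ units (rowsOn s) a∈
  ... | c , a , _ , a∈′ , refl = on (rowsOn-Supported s a∈′)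

  Matrices-Supported : ∀ {n} {C : Subset n} S → All (_≼ C) S → ∀ {A} → A ∈ Matrices S → All (Supported C) A
  Matrices-Supported []      []       (here refl) = []
  Matrices-Supported (s ∷ S) (p ∷ ps) A∈ with ∈-cartesianProductWith⁻ _∷_ (rowsOn s) (Matrices S) A∈
  ... | a , A , a∈ , A∈′ , refl = Supported-mono p (rowsOn-Supported s a∈) ∷ Matrices-Supported S ps A∈′

  -- The torus action by column scaling

  infixr 7 _⊙_
  _⊙_ : ∀ {n} → V n → V n → V n
  u ⊙ v = zipWith _*_ u v

  Units : ∀ {n} → V n → Set
  Units u = VecAll.All (_≢ 0#) u

  Units-replicate : ∀ n {c} → c ≢ 0# → Units (replicate n c)
  Units-replicate zero    c≢0 = VecAll.[]
  Units-replicate (suc n) c≢0 = c≢0 VecAll.∷ Units-replicate n c≢0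

  1⊙ : ∀ {n} (v : V n) → replicate n 1# ⊙ v ≡ v
  1⊙ []      = refl
  1⊙ (a ∷ v) = cong₂ _∷_ (*-identityˡ a) (1⊙ v)

  dot-⊙ : ∀ {n} (u a v : V n) → dot (u ⊙ a) v ≡ dot a (u ⊙ v)
  dot-⊙ []      []      []      = refl
  dot-⊙ (c ∷ u) (a ∷ as) (b ∷ v) = cong₂ _+_ (trans (cong (_* b) (*-comm c a)) (*-assoc a c b)) (dot-⊙ u as v)

  module _ {c : K} (c≢0 : c ≢ 0#) where

    private
      c⁻¹ = proj₁ (inverse c≢0)
      c⁻¹c≡1 : c⁻¹ * c ≡ 1#
      c⁻¹c≡1 = proj₂ (inverse c≢0)

    *-inverseˡ : ∀ a → c⁻¹ * (c * a) ≡ a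
    *-inverseˡ a = trans (sym (*-assoc c⁻¹ c a)) (trans (cong (_* a) c⁻¹c≡1) (*-identityˡ a))

    *-inverseʳ : ∀ a → c * (c⁻¹ * a) ≡ a
    *-inverseʳ a = trans (sym (*-assoc c c⁻¹ a)) (trans (cong (_* a) (trans (*-comm c c⁻¹) c⁻¹c≡1)) (*-identityˡ a))

    Σ-scalars-* : (h : K → ℤ) → Σ⟨ scalars ⟩ (λ a → h (c * a)) ≡ Σ⟨ scalars ⟩ h
    Σ-scalars-* = Σ-permute (c *_) (c⁻¹ *_) *-inverseʳ *-inverseˡ

    Σ-units-* : (h : K → ℤ) → Σ⟨ units ⟩ (λ a → h (c * a)) ≡ Σ⟨ units ⟩ h
    Σ-units-* h = begin
      Σ⟨ units ⟩ (λ a → h (c * a)) ≡⟨ Σ-filter nonzero? scalars _ ⟩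
      Σ⟨ scalars ⟩ (λ a → [ nonzero? a ] ℤ.* h (c * a)) ≡⟨ Σ-cong scalars (λ a → cong (ℤ._* h (c * a)) ([]-cong (nonzero? a) (nonzero? (c * a))
        (λ a≢0 e → a≢0 (*-cancelˡ-0 c≢0 e)) (λ { ca≢0 refl → ca≢0 (zeroʳ c) }))) ⟩
      Σ⟨ scalars ⟩ (λ a → [ nonzero? (c * a) ] ℤ.* h (c * a)) ≡⟨ Σ-scalars-* (λ a → [ nonzero? a ] ℤ.* h a) ⟩
      Σ⟨ scalars ⟩ (λ a → [ nonzero? a ] ℤ.* h a) ≡⟨ Σ-filter nonzero? scalars h ⟨
      Σ⟨ units ⟩ h ∎

  Σ-vectors-⊙ : ∀ {n} {u : V n} → Units u → (h : V n → ℤ) → Σ⟨ vecs n ⟩ (λ v → h (u ⊙ v)) ≡ Σ⟨ vecs n ⟩ h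
  Σ-vectors-⊙ {u = []}    VecAll.[]          h = refl
  Σ-vectors-⊙ {suc n} {c ∷ u} (c≢0 VecAll.∷ us) h = begin
    Σ⟨ vecs (suc n) ⟩ (λ v → h ((c ∷ u) ⊙ v)) ≡⟨ Σ-∷ n _ ⟩
    Σ⟨ scalars ⟩ (λ a → Σ⟨ vecs n ⟩ (λ v → h (c * a ∷ u ⊙ v))) ≡⟨ Σ-cong scalars (λ a → Σ-vectors-⊙ us (λ v → h (c * a ∷ v))) ⟩
    Σ⟨ scalars ⟩ (λ a → Σ⟨ vecs n ⟩ (λ v → h (c * a ∷ v))) ≡⟨ Σ-scalars-* c≢0 (λ a → Σ⟨ vecs n ⟩ (λ v → h (a ∷ v))) ⟩
    Σ⟨ scalars ⟩ (λ a → Σ⟨ vecs n ⟩ (λ v → h (a ∷ v))) ≡⟨ Σ-∷ n h ⟨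
    Σ⟨ vecs (suc n) ⟩ h ∎

  Σ-rowsOn-⊙ : ∀ {n} {u : V n} → Units u → (s : Subset n) (h : V n → ℤ) → Σ⟨ rowsOn s ⟩ (λ v → h (u ⊙ v)) ≡ Σ⟨ rowsOn s ⟩ h
  Σ-rowsOn-⊙ {u = []}    VecAll.[]          []          h = refl
  Σ-rowsOn-⊙ {u = c ∷ u} (c≢0 VecAll.∷ us) (false ∷ s) h = begin
    Σ⟨ map (0# ∷_) (rowsOn s) ⟩ (λ v → h ((c ∷ u) ⊙ v)) ≡⟨ Σ-map (0# ∷_) (rowsOn s) _ ⟩
    Σ⟨ rowsOn s ⟩ (λ v → h (c * 0# ∷ u ⊙ v)) ≡⟨ Σ-cong (rowsOn s) (λ v → cong (λ z → h (z ∷ u ⊙ v)) (zeroʳ c)) ⟩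
    Σ⟨ rowsOn s ⟩ (λ v → h (0# ∷ u ⊙ v)) ≡⟨ Σ-rowsOn-⊙ us s (λ v → h (0# ∷ v)) ⟩
    Σ⟨ rowsOn s ⟩ (λ v → h (0# ∷ v)) ≡⟨ Σ-map (0# ∷_) (rowsOn s) h ⟨
    Σ⟨ map (0# ∷_) (rowsOn s) ⟩ h ∎
  Σ-rowsOn-⊙ {u = c ∷ u} (c≢0 VecAll.∷ us) (true ∷ s)  h = begin
    Σ⟨ rowsOn (true ∷ s) ⟩ (λ v → h ((c ∷ u) ⊙ v)) ≡⟨ Σ-× _∷_ units (rowsOn s) _ ⟩
    Σ⟨ units ⟩ (λ a → Σ⟨ rowsOn s ⟩ (λ v → h (c * a ∷ u ⊙ v))) ≡⟨ Σ-cong units (λ a → Σ-rowsOn-⊙ us s (λ v → h (c * a ∷ v))) ⟩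
    Σ⟨ units ⟩ (λ a → Σ⟨ rowsOn s ⟩ (λ v → h (c * a ∷ v))) ≡⟨ Σ-units-* c≢0 (λ a → Σ⟨ rowsOn s ⟩ (λ v → h (a ∷ v))) ⟩
    Σ⟨ units ⟩ (λ a → Σ⟨ rowsOn s ⟩ (λ v → h (a ∷ v))) ≡⟨ Σ-× _∷_ units (rowsOn s) h ⟨
    Σ⟨ rowsOn (true ∷ s) ⟩ h ∎

  Σ-Matrices-⊙ : ∀ {n} {u : V n} → Units u → (S : List (Subset n)) (g : List (V n) → ℤ) → Σ⟨ Matrices S ⟩ (λ A → g (map (u ⊙_) A)) ≡ Σ⟨ Matrices S ⟩ g
  Σ-Matrices-⊙         us []      g = refl
  Σ-Matrices-⊙ {u = u} us (s ∷ S) g = begin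
    Σ⟨ Matrices (s ∷ S) ⟩ (λ A → g (map (u ⊙_) A)) ≡⟨ Σ-× _∷_ (rowsOn s) (Matrices S) _ ⟩
    Σ⟨ rowsOn s ⟩ (λ a → Σ⟨ Matrices S ⟩ (λ A → g (u ⊙ a ∷ map (u ⊙_) A))) ≡⟨ Σ-cong (rowsOn s) (λ a → Σ-Matrices-⊙ us S (λ A → g (u ⊙ a ∷ A))) ⟩
    Σ⟨ rowsOn s ⟩ (λ a → Σ⟨ Matrices S ⟩ (λ A → g (u ⊙ a ∷ A))) ≡⟨ Σ-rowsOn-⊙ us s (λ a → Σ⟨ Matrices S ⟩ (λ A → g (a ∷ A))) ⟩
    Σ⟨ rowsOn s ⟩ (λ a → Σ⟨ Matrices S ⟩ (λ A → g (a ∷ A))) ≡⟨ Σ-× _∷_ (rowsOn s) (Matrices S) g ⟨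
    Σ⟨ Matrices (s ∷ S) ⟩ g ∎

  rk-⊙ : ∀ {n} {u : V n} → Units u → (A : List (V n)) → rk (map (u ⊙_) A) ≡ rk A
  rk-⊙ {n} {u} us A = rk-card (map (u ⊙_) A) A (trans
    (Σ-cong (vecs n) (λ v → []-cong (kernel (map (u ⊙_) A) ∋? v) (kernel A ∋? (u ⊙ v))
      (λ k → All.map (λ {a} p → trans (sym (dot-⊙ u a v)) p) (All.map⁻ k))
      (λ k → All.map⁺ (All.map (λ {a} p → trans (dot-⊙ u a v) p) k))))
    (Σ-vectors-⊙ us (λ v → [ kernel A ∋? v ])))

  Σ-units-const : ∀ (h : K → ℤ) k → (∀ {c} → c ≢ 0# → h c ≡ k) → Σ⟨ units ⟩ h ≡ x ℤ.* k
  Σ-units-const h k e = trans (Σ-cong-∈ units (λ c∈ → e (proj₂ (∈-filter⁻ nonzero? {xs = scalars} c∈))))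
    (trans (+-cancel (Σ⟨ units ⟩ (λ _ → k)) k (trans (sym (Σ-scalars (λ _ → k))) (Σ-scalars-const k))) (distrib 𝒒 k))
    where
    +-cancel : ∀ a b {c} → a ℤ.+ b ≡ c → a ≡ c ℤ.- b
    +-cancel a b refl = lemma a b
      where
      lemma : ∀ a b → a ≡ a ℤ.+ b ℤ.- b
      lemma = solve-∀
    distrib : ∀ q k → q ℤ.* k ℤ.- k ≡ (q ℤ.- 1ℤ) ℤ.* k
    distrib = solve-∀

  ConstantOn : ∀ {n} → Subset n → K → V n → Set
  ConstantOn C c u = ∀ j → lookup C j ≡ true → lookup u j ≡ c

  ConstantOn-∷ : ∀ {n} {C : Subset n} {y c u} d → (y ≡ true → d ≡ c) → ConstantOn C c u → ConstantOn (y ∷ C) c (d ∷ u)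
  ConstantOn-∷ d e h zero    p = e p
  ConstantOn-∷ d e h (suc j) p = h j p

  -- C contains the columns met by the fixed rows. A column scaling that is constant on C multiplies
  -- those rows by a common scalar and so keeps their kernel. Columns outside C can be scaled
  -- independently.
  Invariant ScalarInvariant : ∀ {n} → Subset n → (V n → ℤ) → Set
  Invariant       C h = ∀ {u}   → Units u → ConstantOn C 1# u → ∀ a → h (u ⊙ a) ≡ h a
  ScalarInvariant C h = ∀ {u c} → Units u → c ≢ 0# → ConstantOn C c u → ∀ a → h (u ⊙ a) ≡ h a

  private
    -- An entry whose nonzero value does not affect the sum is set to 1, at the price of a factor q
    -- - 1.
    Σ-normalised : ∀ {n} (s : Subset n) (h : V (suc n) → ℤ) →
      (∀ {c} → c ≢ 0# → Σ⟨ rowsOn s ⟩ (h ∘ (c ∷_)) ≡ Σ⟨ rowsOn s ⟩ (h ∘ (1# ∷_))) →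
      Σ⟨ rowsOn (true ∷ s) ⟩ h ≡ x ℤ.* Σ⟨ rowsOn s ⟩ (h ∘ (1# ∷_))
    Σ-normalised s h e = trans (Σ-× _∷_ units (rowsOn s) h) (Σ-units-const (λ c → Σ⟨ rowsOn s ⟩ (h ∘ (c ∷_))) (Σ⟨ rowsOn s ⟩ (h ∘ (1# ∷_))) e)

    *-∣-* : ∀ e k {z} → x ℤ.^ e ℤ.* k ∣ z → x ℤ.^ suc e ℤ.* k ∣ x ℤ.* z
    *-∣-* e k d = subst (_∣ x ℤ.* _) (sym (ℤ.*-assoc x (x ℤ.^ e) k)) (*-monoʳ-∣ x d)

  -- Each column of s outside C has a scaling of its own, which normalises one entry; `k` is the
  -- divisor known for each single summand.
  columns-∣ : ∀ {n} (s C : Subset n) (h : V n → ℤ) k → Invariant C h → (∀ {a} → Supported s a → k ∣ h a) →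
              x ℤ.^ excess s C ℤ.* k ∣ Σ⟨ rowsOn s ⟩ h
  columns-∣ []          []          h k inv d = subst₂ _∣_ (sym (ℤ.*-identityˡ k)) (sym (ℤ.+-identityʳ (h []))) (d [])
  columns-∣ (false ∷ s) (y ∷ C)     h k inv d = subst (x ℤ.^ excess s C ℤ.* k ∣_) (sym (Σ-map (0# ∷_) (rowsOn s) h))
    (columns-∣ s C (h ∘ (0# ∷_)) k
      (λ {u} us const a → trans (cong (λ z → h (z ∷ u ⊙ a)) (sym (zeroʳ 1#))) (inv (1≢0 VecAll.∷ us) (ConstantOn-∷ {y = y} 1# (λ _ → refl) const) (0# ∷ a)))
      (d ∘ off))
  columns-∣ (true ∷ s)  (true ∷ C)  h k inv d = subst (x ℤ.^ excess s C ℤ.* k ∣_) (sym (Σ-× _∷_ units (rowsOn s) h))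
    (Σ-∣ units (x ℤ.^ excess s C ℤ.* k) (λ {c} _ → columns-∣ s C (h ∘ (c ∷_)) k
      (λ {u} us const a → trans (cong (λ z → h (z ∷ u ⊙ a)) (sym (*-identityˡ c))) (inv (1≢0 VecAll.∷ us) (ConstantOn-∷ {y = true} 1# (λ _ → refl) const) (c ∷ a)))
      (d ∘ on)))
  columns-∣ {suc n} (true ∷ s)  (false ∷ C) h k inv d = subst (x ℤ.^ suc (excess s C) ℤ.* k ∣_)
    (sym (Σ-normalised s h normalise))
    (*-∣-* (excess s C) k (columns-∣ s C (h ∘ (1# ∷_)) k
      (λ {u} us const a → trans (cong (λ z → h (z ∷ u ⊙ a)) (sym (*-identityˡ 1#))) (inv (1≢0 VecAll.∷ us) (ConstantOn-∷ {y = false} 1# (λ ()) const) (1# ∷ a)))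
      (d ∘ on)))
    where
    normalise : ∀ {c} → c ≢ 0# → Σ⟨ rowsOn s ⟩ (h ∘ (c ∷_)) ≡ Σ⟨ rowsOn s ⟩ (h ∘ (1# ∷_))
    normalise {c} c≢0 = Σ-cong (rowsOn s) (λ a → trans (cong₂ (λ z w → h (z ∷ w)) (sym (*-identityʳ c)) (sym (1⊙ a)))
      (inv (c≢0 VecAll.∷ Units-replicate n 1≢0) (ConstantOn-∷ {y = false} c (λ ()) (λ j _ → lookup-replicate j 1#)) (1# ∷ a)))

  -- The extra factor comes from one entry of s inside C, normalised by scaling all columns at once.
  -- From then on only scalings equal to 1 on C remain, and `columns-∣` takes over.
  columns-scalar-∣ : ∀ {n} (s C : Subset n) → Nonempty (s ∩ C) → (h : V n → ℤ) → ∀ k → ScalarInvariant C h → (∀ {a} → Supported s a → k ∣ h a) →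
                     x ℤ.^ suc (excess s C) ℤ.* k ∣ Σ⟨ rowsOn s ⟩ h
  columns-scalar-∣ {suc n} (true ∷ s)  (true ∷ C)  _ h k inv d = subst (x ℤ.^ suc (excess s C) ℤ.* k ∣_)
    (sym (Σ-normalised s h normalise))
    (*-∣-* (excess s C) k (columns-∣ s C (h ∘ (1# ∷_)) k
      (λ {u} us const a → trans (cong (λ z → h (z ∷ u ⊙ a)) (sym (*-identityˡ 1#))) (inv (1≢0 VecAll.∷ us) 1≢0 (ConstantOn-∷ {y = true} 1# (λ _ → refl) const) (1# ∷ a)))
      (d ∘ on)))
    where
    normalise : ∀ {c} → c ≢ 0# → Σ⟨ rowsOn s ⟩ (h ∘ (c ∷_)) ≡ Σ⟨ rowsOn s ⟩ (h ∘ (1# ∷_))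
    -- The scaling by c also changes the other entries of the row, but these are summed over, so
    -- `Σ-rowsOn-⊙` absorbs the change.
    normalise {c} c≢0 = trans (sym (Σ-rowsOn-⊙ (Units-replicate n c≢0) s (h ∘ (c ∷_))))
      (Σ-cong (rowsOn s) (λ a → trans (cong (λ z → h (z ∷ replicate n c ⊙ a)) (sym (*-identityʳ c)))
        (inv (Units-replicate (suc n) c≢0) c≢0 (λ j _ → lookup-replicate j c) (1# ∷ a))))
  columns-scalar-∣ {suc n} (true ∷ s)  (false ∷ C) (suc j , there j∈) h k inv d = subst (x ℤ.^ suc (suc (excess s C)) ℤ.* k ∣_)
    (sym (Σ-normalised s h normalise))
    (*-∣-* (suc (excess s C)) k (columns-scalar-∣ s C (j , j∈) (h ∘ (1# ∷_)) k
      (λ {u} us c≢0 const a → trans (cong (λ z → h (z ∷ u ⊙ a)) (sym (*-identityˡ 1#))) (inv (1≢0 VecAll.∷ us) c≢0 (ConstantOn-∷ {y = false} 1# (λ ()) const) (1# ∷ a)))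
      (d ∘ on)))
    where
    normalise : ∀ {c} → c ≢ 0# → Σ⟨ rowsOn s ⟩ (h ∘ (c ∷_)) ≡ Σ⟨ rowsOn s ⟩ (h ∘ (1# ∷_))
    normalise {c} c≢0 = Σ-cong (rowsOn s) (λ a → trans (cong₂ (λ z w → h (z ∷ w)) (sym (*-identityʳ c)) (sym (1⊙ a)))
      (inv (c≢0 VecAll.∷ Units-replicate n 1≢0) 1≢0 (ConstantOn-∷ {y = false} c (λ ()) (λ j _ → lookup-replicate j 1#)) (1# ∷ a)))
  columns-scalar-∣ (false ∷ s) (y ∷ C) (suc j , there j∈) h k inv d = subst (x ℤ.^ suc (excess s C) ℤ.* k ∣_) (sym (Σ-map (0# ∷_) (rowsOn s) h))
    (columns-scalar-∣ s C (j , j∈) (h ∘ (0# ∷_)) k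
      (λ {u} {c} us c≢0 const a → trans (cong (λ z → h (z ∷ u ⊙ a)) (sym (zeroʳ c))) (inv (c≢0 VecAll.∷ us) c≢0 (ConstantOn-∷ {y = y} c (λ _ → refl) const) (0# ∷ a)))
      (d ∘ off))

-- Chains of rows and connected components

-- An ordering of rows in which each row meets the columns reached before it, as in a traversal of
-- the bipartite graph of the support. Connectedness is used only in this form.
data Chain {n} : Subset n → List (Subset n) → Set where
  []  : ∀ {C} → Chain C []
  _∷_ : ∀ {C s S} → Nonempty (s ∩ C) → Chain (C ∪ s) S → Chain C (s ∷ S)

reach : ∀ {n} → Subset n → List (Subset n) → Subset n
reach C []      = C
reach C (s ∷ S) = reach (C ∪ s) S

-- The exponent of q − 1 contributed by scaling rows and columns along a chain.
torusRank : ∀ {n} → Subset n → List (Subset n) → ℕ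
torusRank C []      = 0
torusRank C (s ∷ S) = suc (excess s C) ℕ.+ torusRank (C ∪ s) S

≼-reach : ∀ {n} (C : Subset n) S → C ≼ reach C S
≼-reach C []      j p = p
≼-reach C (s ∷ S) j p = ≼-reach (C ∪ s) S j (∪-≼ˡ C s j p)

All-≼-reach : ∀ {n} (C : Subset n) S → All (_≼ reach C S) S
All-≼-reach C []      = []
All-≼-reach C (s ∷ S) = (λ j p → ≼-reach (C ∪ s) S j (∪-≼ʳ C s j p)) ∷ All-≼-reach (C ∪ s) S

∣∪∣ : ∀ {n} (C s : Subset n) → ∣ C ∪ s ∣ ≡ ∣ C ∣ ℕ.+ excess s C
∣∪∣ []          []          = refl
∣∪∣ (true ∷ C)  (true ∷ s)  = cong suc (∣∪∣ C s)
∣∪∣ (true ∷ C)  (false ∷ s) = cong suc (∣∪∣ C s)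
∣∪∣ (false ∷ C) (true ∷ s)  = trans (cong suc (∣∪∣ C s)) (sym (ℕ.+-suc ∣ C ∣ (excess s C)))
∣∪∣ (false ∷ C) (false ∷ s) = ∣∪∣ C s

-- Each row of the chain contributes one to `torusRank`, and so does each column when it is first
-- reached.
∣reach∣ : ∀ {n} (C : Subset n) S → ∣ reach C S ∣ ℕ.+ length S ≡ ∣ C ∣ ℕ.+ torusRank C S
∣reach∣ C []      = refl
∣reach∣ C (s ∷ S) = begin
  ∣ reach (C ∪ s) S ∣ ℕ.+ suc (length S) ≡⟨ ℕ.+-suc ∣ reach (C ∪ s) S ∣ (length S) ⟩
  suc (∣ reach (C ∪ s) S ∣ ℕ.+ length S) ≡⟨ cong suc (∣reach∣ (C ∪ s) S) ⟩
  suc (∣ C ∪ s ∣ ℕ.+ torusRank (C ∪ s) S) ≡⟨ cong (λ z → suc (z ℕ.+ torusRank (C ∪ s) S)) (∣∪∣ C s) ⟩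
  suc (∣ C ∣ ℕ.+ excess s C ℕ.+ torusRank (C ∪ s) S) ≡⟨ cong suc (ℕ.+-assoc ∣ C ∣ (excess s C) (torusRank (C ∪ s) S)) ⟩
  suc (∣ C ∣ ℕ.+ (excess s C ℕ.+ torusRank (C ∪ s) S)) ≡⟨ ℕ.+-suc ∣ C ∣ (excess s C ℕ.+ torusRank (C ∪ s) S) ⟨
  ∣ C ∣ ℕ.+ torusRank C (s ∷ S) ∎

excess-⊥ : ∀ {n} (s : Subset n) → excess s ⊥ ≡ ∣ s ∣
excess-⊥ []          = refl
excess-⊥ (true ∷ s)  = cong suc (excess-⊥ s)
excess-⊥ (false ∷ s) = excess-⊥ s

disjoint⇒≼∁ : ∀ {n} (s C : Subset n) → ¬ Nonempty (s ∩ C) → s ≼ ∁ C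
disjoint⇒≼∁ (true ∷ s)  (true ∷ C)  h zero    p = contradiction (zero , here) h
disjoint⇒≼∁ (true ∷ s)  (false ∷ C) h zero    p = refl
disjoint⇒≼∁ (_ ∷ s)     (_ ∷ C)     h (suc j) p = disjoint⇒≼∁ s C (λ (i , i∈) → h (suc i , there i∈)) j p

-- No row of `outside` uses a column reached by `inside`, so the matrix splits into two blocks
-- without common columns.
record Component {n} (C : Subset n) (S : List (Subset n)) : Set where
  field
    inside outside : List (Subset n)
    split          : S ↭ inside ++ outside
    chain          : Chain C inside
    separate       : All (_≼ ∁ (reach C inside)) outside

-- Any row meeting C is moved into the chain and its columns join C. `k` is fuel, decreasing with
-- the number of rows left.
component : ∀ {n} k (C : Subset n) S → length S ≤ k → Component C S
component k C S len with Any.any? (λ s → nonempty? (s ∩ C)) S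
... | no none = record
  { inside = [] ; outside = S ; split = ↭.refl ; chain = []
  ; separate = All.map (λ {s} → disjoint⇒≼∁ s C) (All.¬Any⇒All¬ S none) }
component zero    C [] z≤n | yes ()
component (suc k) C S  len | yes some with find some
... | s , s∈ , meets with ∈-∃++ s∈
... | xs , ys , refl = record
  { inside   = s ∷ R.inside
  ; outside  = R.outside
  ; split    = ↭.trans (↭-shift s xs ys) (↭.prep s R.split)
  ; chain    = meets ∷ R.chain
  ; separate = R.separate
  }
  where
  module R = Component (component k (C ∪ s) (xs ++ ys) (ℕ.≤-pred (subst (_≤ suc k) (↭-length (↭-shift s xs ys)) len)))

-- Deleting the columns outside C turns a component that meets few columns of a wide board into a
-- board with few columns.
compress : ∀ {A : Set} {n} (C : Subset n) → Vec A n → Vec A ∣ C ∣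
compress []          []      = []
compress (true ∷ C)  (a ∷ v) = a ∷ compress C v
compress (false ∷ C) (a ∷ v) = compress C v

Nonempty-compress : ∀ {n} (s C : Subset n) → s ≼ C → Nonempty s → Nonempty (compress C s)
Nonempty-compress (true ∷ s) (true ∷ C)  s≼C (zero , here)      = zero , here
Nonempty-compress (true ∷ s) (false ∷ C) s≼C (zero , here)      with s≼C zero refl
... | ()
Nonempty-compress (_ ∷ s)    (true ∷ C)  s≼C (suc j , there j∈) = let (i , i∈) = Nonempty-compress s C (s≼C ∘ suc) (j , j∈) in suc i , there i∈
Nonempty-compress (_ ∷ s)    (false ∷ C) s≼C (suc j , there j∈) = Nonempty-compress s C (s≼C ∘ suc) (j , j∈)

Nonempty-∩ˡ : ∀ {n} (s C : Subset n) → Nonempty (s ∩ C) → Nonempty s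
Nonempty-∩ˡ (true ∷ s) (true ∷ C) (zero , here)      = zero , here
Nonempty-∩ˡ (y ∷ s)    (z ∷ C)    (suc j , there j∈) = let (i , i∈) = Nonempty-∩ˡ s C (j , j∈) in suc i , there i∈

Chain-Nonempty : ∀ {n} {C : Subset n} {S} → Chain C S → All Nonempty S
Chain-Nonempty []                        = []
Chain-Nonempty {C = C} (_∷_ {s = s} m c) = Nonempty-∩ˡ s C m ∷ Chain-Nonempty c

-- Divisibility for components, and additivity of rank

module Components {q : ℕ} (F : Field q) where

  open Torus F public

  dot-constant : ∀ {n} {C : Subset n} {c} u → ConstantOn C c u → ∀ {p} → Supported C p → ∀ v → dot (u ⊙ p) v ≡ c * dot p v
  dot-constant {c = c} []      const []                 []      = sym (zeroʳ c)
  dot-constant {c = c} (d ∷ u) const {a ∷ p} (on s)  (b ∷ v) = trans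
    (cong₂ _+_ (trans (cong (λ z → z * a * b) (const zero refl)) (*-assoc c a b)) (dot-constant u (const ∘ suc) s v))
    (sym (distribˡ c (a * b) (dot p v)))
  dot-constant {c = c} (d ∷ u) const {_ ∷ p} (off s) (b ∷ v) = trans
    (cong₂ _+_ (trans (cong (_* b) (zeroʳ d)) (trans (zeroˡ b) (trans (sym (zeroʳ c)) (cong (c *_) (sym (zeroˡ b)))))) (dot-constant u (const ∘ suc) s v))
    (sym (distribˡ c (0# * b) (dot p v)))

  -- Scaling the columns of the whole matrix keeps its rank and permutes the choices for the varying
  -- rows. The rows in P are only multiplied by c, which does not change their kernel.
  countWith-invariant : ∀ {n} (C : Subset n) P S r → All (Supported C) P → ScalarInvariant C (λ a → countWith (a ∷ P) S r)
  countWith-invariant C P S r sup {u} {c} us c≢0 const a = trans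
    (sym (Σ-Matrices-⊙ us S (λ A → [ rk (A ++ u ⊙ a ∷ P) ℕ.≟ r ])))
    (Σ-cong (Matrices S) (λ A → cong (λ k → [ k ℕ.≟ r ]) (trans
      (rk-kernel (map (u ⊙_) A ++ u ⊙ a ∷ P) (map (u ⊙_) (A ++ a ∷ P)) (to A) (from A))
      (rk-⊙ us (A ++ a ∷ P)))))
    where
    P⇒ : ∀ {P v} → All (Supported C) P → Kernel P v → Kernel (map (u ⊙_) P) v
    P⇒ []        []       = []
    P⇒ (s ∷ ss) (p ∷ ps) = trans (dot-constant u const s _) (trans (cong (c *_) p) (zeroʳ c)) ∷ P⇒ ss ps
    P⇐ : ∀ {P v} → All (Supported C) P → Kernel (map (u ⊙_) P) v → Kernel P v
    P⇐ []        []       = []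
    P⇐ (s ∷ ss) (p ∷ ps) = *-cancelˡ-0 c≢0 (trans (sym (dot-constant u const s _)) p) ∷ P⇐ ss ps
    to : ∀ A {v} → Kernel (map (u ⊙_) A ++ u ⊙ a ∷ P) v → Kernel (map (u ⊙_) (A ++ a ∷ P)) v
    to A {v} k with All.++⁻ (map (u ⊙_) A) k
    ... | kA , ka ∷ kP = subst (λ B → Kernel B v) (sym (map-++ (u ⊙_) A (a ∷ P))) (All.++⁺ kA (ka ∷ P⇒ sup kP))
    from : ∀ A {v} → Kernel (map (u ⊙_) (A ++ a ∷ P)) v → Kernel (map (u ⊙_) A ++ u ⊙ a ∷ P) v
    from A {v} k with All.++⁻ (map (u ⊙_) A) (subst (λ B → Kernel B v) (map-++ (u ⊙_) A (a ∷ P)) k)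
    ... | kA , ka ∷ kP = All.++⁺ kA (ka ∷ P⇐ sup kP)

  chain-∣ : ∀ {n} {C : Subset n} {S} → Chain C S → ∀ P r → All (Supported C) P → x ℤ.^ torusRank C S ∣ countWith P S r
  chain-∣ []                                   P r sup = divides (countWith P [] r) (sym (ℤ.*-identityʳ _))
  chain-∣ {C = C} (_∷_ {s = s} {S} meets chain) P r sup = subst₂ _∣_
    (sym (ℤ.^-distribˡ-+-* x (suc (excess s C)) (torusRank (C ∪ s) S)))
    (sym (countWith-∷ P s S r))
    (columns-scalar-∣ s C meets (λ a → countWith (a ∷ P) S r) (x ℤ.^ torusRank (C ∪ s) S)
      (λ {u} → countWith-invariant C P S r sup {u})
      (λ {a} a∈ → chain-∣ chain (a ∷ P) r (Supported-mono (∪-≼ʳ C s) a∈ ∷ All.map (Supported-mono (∪-≼ˡ C s)) sup)))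

  -- The first row starts with no column reached, so column scalings normalise all its entries; the
  -- rest of the chain adds `torusRank s S`. With m = `suc (length S)` rows and n reached columns
  -- the total is m + n - 1.
  component-∣ : ∀ {n} (s : Subset n) {S} → Chain s S → ∀ r → x ℤ.^ (∣ reach s S ∣ ℕ.+ length S) ∣ count (s ∷ S) r
  component-∣ s {S} chain r = subst₂ _∣_
    (trans (sym (ℤ.^-distribˡ-+-* x (excess s ⊥) (torusRank s S))) (cong (x ℤ.^_) (trans (cong (ℕ._+ torusRank s S) (excess-⊥ s)) (sym (∣reach∣ s S)))))
    (sym (trans (count≡countWith (s ∷ S) r) (countWith-∷ [] s S r)))
    (columns-∣ s ⊥ (λ a → countWith (a ∷ []) S r) (x ℤ.^ torusRank s S)
      (λ us const → countWith-invariant ⊥ [] S r [] us 1≢0 const)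
      (λ {a} a∈ → chain-∣ chain (a ∷ []) r (a∈ ∷ [])))

  -- Block sums

  mask : ∀ {n} → Subset n → V n → V n
  mask []          []      = []
  mask (true ∷ C)  (a ∷ v) = a ∷ mask C v
  mask (false ∷ C) (a ∷ v) = 0# ∷ mask C v

  mask-complement : ∀ {n} (C : Subset n) v → v ∔ - 1# ∙ mask (∁ C) v ≡ mask C v
  mask-complement []          []      = refl
  mask-complement (true ∷ C)  (a ∷ v) = cong₂ _∷_ (trans (cong (a +_) (zeroʳ (- 1#))) (+-identityʳ a)) (mask-complement C v)
  mask-complement (false ∷ C) (a ∷ v) = cong₂ _∷_ (cong Vec.head (∔-self (a ∷ []))) (mask-complement C v)

  dot-mask : ∀ {n} (C : Subset n) {a} → Supported (∁ C) a → ∀ v → dot a (mask C v) ≡ 0#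
  dot-mask []          []          []      = refl
  dot-mask (true ∷ C)  (off s) (b ∷ v) = trans (cong₂ _+_ (zeroˡ b) (dot-mask C s v)) (+-identityˡ 0#)
  dot-mask (false ∷ C) (on s)  (b ∷ v) = trans (cong₂ _+_ (zeroʳ _) (dot-mask C s v)) (+-identityˡ 0#)

  dot-mask-∁ : ∀ {n} (C : Subset n) {a} → Supported C a → ∀ v → dot a (mask (∁ C) v) ≡ 0#
  dot-mask-∁ []          []      []      = refl
  dot-mask-∁ (true ∷ C)  (on s)  (b ∷ v) = trans (cong₂ _+_ (zeroʳ _) (dot-mask-∁ C s v)) (+-identityˡ 0#)
  dot-mask-∁ (false ∷ C) (off s) (b ∷ v) = trans (cong₂ _+_ (zeroˡ b) (dot-mask-∁ C s v)) (+-identityˡ 0#)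

  everything : ∀ {n} → Subspace n
  everything = record { _∋_ = λ _ → ⊤ ; _∋?_ = λ _ → yes tt ; zero∈ = tt ; closed = λ _ _ _ → tt }

  -- Masking writes every v as a part off C, killed by A, plus a part on C, killed by B. So the two
  -- kernels together span everything, and `card-modular` relates the coranks.
  rk-++ : ∀ {n} (C : Subset n) {A B} → All (Supported C) A → All (Supported (∁ C)) B → rk (A ++ B) ≡ rk A ℕ.+ rk B
  rk-++ {n} C {A} {B} As Bs = ℕ.+-cancelʳ-≡ (corank (A ++ B) ℕ.+ n) (rk (A ++ B)) (rk A ℕ.+ rk B) (begin
    rk (A ++ B) ℕ.+ (corank (A ++ B) ℕ.+ n) ≡⟨ ℕ.+-assoc (rk (A ++ B)) (corank (A ++ B)) n ⟨
    rk (A ++ B) ℕ.+ corank (A ++ B) ℕ.+ n ≡⟨ cong (ℕ._+ n) (rk+corank (A ++ B)) ⟩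
    n ℕ.+ n ≡⟨ cong₂ ℕ._+_ (rk+corank A) (rk+corank B) ⟨
    rk A ℕ.+ corank A ℕ.+ (rk B ℕ.+ corank B) ≡⟨ interchange (rk A) (corank A) (rk B) (corank B) ⟩
    rk A ℕ.+ rk B ℕ.+ (corank A ℕ.+ corank B) ≡⟨ cong (rk A ℕ.+ rk B ℕ.+_) coranks ⟨
    rk A ℕ.+ rk B ℕ.+ (corank (A ++ B) ℕ.+ n) ∎)
    where
    open import Algebra.Properties.CommutativeSemigroup ℕ.+-commutativeSemigroup using (interchange)
    coranks : corank (A ++ B) ℕ.+ n ≡ corank A ℕ.+ corank B
    coranks = ^-injective _ _ (begin
      𝒒 ℤ.^ (corank (A ++ B) ℕ.+ n) ≡⟨ ℤ.^-distribˡ-+-* 𝒒 (corank (A ++ B)) n ⟩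
      𝒒 ℤ.^ corank (A ++ B) ℤ.* 𝒒 ℤ.^ n ≡⟨ cong₂ ℤ._*_ (Kernels.card≡ (A ++ B)) (trans (Σ-vectors-const n 1ℤ) (ℤ.*-identityʳ (𝒒 ℤ.^ n))) ⟨
      card (kernel (A ++ B)) ℤ.* card (everything {n}) ≡⟨ cong (ℤ._* card (everything {n})) (card-cong (kernel (A ++ B)) (kernel A ⋒ kernel B) (All.++⁻ A) (λ (k , l) → All.++⁺ k l)) ⟩
      card (kernel A ⋒ kernel B) ℤ.* card (everything {n}) ≡⟨ card-modular (kernel A) (kernel B) everything (λ {v} _ → mask (∁ C) v ,
          All.map (λ s → dot-mask-∁ C s v) As ,
          All.map (λ {b} s → trans (cong (dot b) (mask-complement C v)) (dot-mask C s v)) Bs) (λ _ _ → tt) ⟩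
      card (kernel A) ℤ.* card (kernel B) ≡⟨ cong₂ ℤ._*_ (Kernels.card≡ A) (Kernels.card≡ B) ⟩
      𝒒 ℤ.^ corank A ℤ.* 𝒒 ℤ.^ corank B ≡⟨ ℤ.^-distribˡ-+-* 𝒒 (corank A) (corank B) ⟨
      𝒒 ℤ.^ (corank A ℕ.+ corank B) ∎)

  Σ-Matrices-++ : ∀ {n} (S S′ : List (Subset n)) (g : List (V n) → ℤ) →
    Σ⟨ Matrices (S ++ S′) ⟩ g ≡ Σ⟨ Matrices S ⟩ (λ A → Σ⟨ Matrices S′ ⟩ (λ B → g (A ++ B)))
  Σ-Matrices-++ []      S′ g = sym (ℤ.+-identityʳ (Σ⟨ Matrices S′ ⟩ g))
  Σ-Matrices-++ (s ∷ S) S′ g = begin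
    Σ⟨ Matrices (s ∷ S ++ S′) ⟩ g ≡⟨ Σ-× _∷_ (rowsOn s) (Matrices (S ++ S′)) g ⟩
    Σ⟨ rowsOn s ⟩ (λ a → Σ⟨ Matrices (S ++ S′) ⟩ (λ A → g (a ∷ A))) ≡⟨ Σ-cong (rowsOn s) (λ a → Σ-Matrices-++ S S′ (λ A → g (a ∷ A))) ⟩
    Σ⟨ rowsOn s ⟩ (λ a → Σ⟨ Matrices S ⟩ (λ A → Σ⟨ Matrices S′ ⟩ (λ B → g (a ∷ A ++ B)))) ≡⟨ Σ-× _∷_ (rowsOn s) (Matrices S) _ ⟨
    Σ⟨ Matrices (s ∷ S) ⟩ (λ A → Σ⟨ Matrices S′ ⟩ (λ B → g (A ++ B))) ∎

  private
    [+≟] : ∀ a b r → [ a ℕ.+ b ℕ.≟ r ] ≡ Σ< (suc r) (λ i → [ a ℕ.≟ i ] ℤ.* [ b ℕ.≟ r ℕ.∸ i ])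
    [+≟] a b r with a ℕ.≤? r
    ... | yes a≤r = trans ([]-cong (a ℕ.+ b ℕ.≟ r) (b ℕ.≟ r ℕ.∸ a)
        (λ { refl → sym (ℕ.m+n∸m≡n a b) }) (λ e → trans (cong (a ℕ.+_) e) (ℕ.m+[n∸m]≡n a≤r)))
        (sym (Σ<-select (suc r) a (λ i → [ b ℕ.≟ r ℕ.∸ i ]) (s≤s a≤r)))
    ... | no a≰r  = trans ([]-no (a ℕ.+ b ℕ.≟ r) (λ { refl → a≰r (ℕ.m≤m+n a b) }))
        (sym (Σ<-select-≥ (suc r) a (λ i → [ b ℕ.≟ r ℕ.∸ i ]) (ℕ.≰⇒> a≰r)))

  count-++ : ∀ {n} (C : Subset n) S S′ → All (_≼ C) S → All (_≼ ∁ C) S′ → ∀ r →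
             count (S ++ S′) r ≡ Σ< (suc r) (λ i → count S i ℤ.* count S′ (r ℕ.∸ i))
  count-++ C S S′ S≼ S′≼ r = begin
    count (S ++ S′) r
      ≡⟨ Σ-Matrices-++ S S′ (λ A → [ rk A ℕ.≟ r ]) ⟩
    Σ⟨ Matrices S ⟩ (λ A → Σ⟨ Matrices S′ ⟩ (λ B → [ rk (A ++ B) ℕ.≟ r ]))
      ≡⟨ Σ-cong-∈ (Matrices S) (λ {A} A∈ → Σ-cong-∈ (Matrices S′) (λ {B} B∈ →
        trans (cong (λ k → [ k ℕ.≟ r ]) (rk-++ C (Matrices-Supported S S≼ A∈) (Matrices-Supported S′ S′≼ B∈))) ([+≟] (rk A) (rk B) r))) ⟩
    Σ⟨ Matrices S ⟩ (λ A → Σ⟨ Matrices S′ ⟩ (λ B → Σ< (suc r) (λ i → [ rk A ℕ.≟ i ] ℤ.* [ rk B ℕ.≟ r ℕ.∸ i ])))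
      ≡⟨ Σ-cong (Matrices S) (λ A → trans (Σ-Σ< (Matrices S′) (suc r) _)
        (Σ<-cong (suc r) (λ i → Σ-*ˡ (Matrices S′) [ rk A ℕ.≟ i ] (λ B → [ rk B ℕ.≟ r ℕ.∸ i ])))) ⟩
    Σ⟨ Matrices S ⟩ (λ A → Σ< (suc r) (λ i → [ rk A ℕ.≟ i ] ℤ.* count S′ (r ℕ.∸ i)))
      ≡⟨ Σ-Σ< (Matrices S) (suc r) _ ⟩
    Σ< (suc r) (λ i → Σ⟨ Matrices S ⟩ (λ A → [ rk A ℕ.≟ i ] ℤ.* count S′ (r ℕ.∸ i)))
      ≡⟨ Σ<-cong (suc r) (λ i → Σ-*ʳ (Matrices S) (count S′ (r ℕ.∸ i)) _) ⟩
    Σ< (suc r) (λ i → count S i ℤ.* count S′ (r ℕ.∸ i)) ∎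

  Σ-rowsOn-compress : ∀ {n} (s C : Subset n) → s ≼ C → (h : V ∣ C ∣ → ℤ) → Σ⟨ rowsOn s ⟩ (h ∘ compress C) ≡ Σ⟨ rowsOn (compress C s) ⟩ h
  Σ-rowsOn-compress []          []          s≼C h = refl
  Σ-rowsOn-compress (true ∷ s)  (false ∷ C) s≼C h with s≼C zero refl
  ... | ()
  Σ-rowsOn-compress (true ∷ s)  (true ∷ C)  s≼C h = trans (Σ-× _∷_ units (rowsOn s) _)
    (trans (Σ-cong units (λ c → Σ-rowsOn-compress s C (s≼C ∘ suc) (h ∘ (c ∷_)))) (sym (Σ-× _∷_ units (rowsOn (compress C s)) h)))
  Σ-rowsOn-compress (false ∷ s) (true ∷ C)  s≼C h = trans (Σ-map (0# ∷_) (rowsOn s) _)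
    (trans (Σ-rowsOn-compress s C (s≼C ∘ suc) (h ∘ (0# ∷_))) (sym (Σ-map (0# ∷_) (rowsOn (compress C s)) h)))
  Σ-rowsOn-compress (false ∷ s) (false ∷ C) s≼C h = trans (Σ-map (0# ∷_) (rowsOn s) _) (Σ-rowsOn-compress s C (s≼C ∘ suc) h)

  Σ-Matrices-compress : ∀ {n} (C : Subset n) S → All (_≼ C) S → (g : List (V ∣ C ∣) → ℤ) →
    Σ⟨ Matrices S ⟩ (g ∘ map (compress C)) ≡ Σ⟨ Matrices (map (compress C) S) ⟩ g
  Σ-Matrices-compress C []      []       g = refl
  Σ-Matrices-compress C (s ∷ S) (p ∷ ps) g = begin
    Σ⟨ Matrices (s ∷ S) ⟩ (g ∘ map (compress C)) ≡⟨ Σ-× _∷_ (rowsOn s) (Matrices S) _ ⟩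
    Σ⟨ rowsOn s ⟩ (λ a → Σ⟨ Matrices S ⟩ (λ A → g (compress C a ∷ map (compress C) A))) ≡⟨ Σ-cong (rowsOn s) (λ a → Σ-Matrices-compress C S ps (λ A → g (compress C a ∷ A))) ⟩
    Σ⟨ rowsOn s ⟩ (λ a → Σ⟨ Matrices (map (compress C) S) ⟩ (λ A → g (compress C a ∷ A))) ≡⟨ Σ-rowsOn-compress s C p (λ a → Σ⟨ Matrices (map (compress C) S) ⟩ (λ A → g (a ∷ A))) ⟩
    Σ⟨ rowsOn (compress C s) ⟩ (λ a → Σ⟨ Matrices (map (compress C) S) ⟩ (λ A → g (a ∷ A))) ≡⟨ Σ-× _∷_ (rowsOn (compress C s)) (Matrices (map (compress C) S)) g ⟨
    Σ⟨ Matrices (map (compress C) (s ∷ S)) ⟩ g ∎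

  dot-compress : ∀ {n} {C : Subset n} {a} → Supported C a → ∀ v → dot a v ≡ dot (compress C a) (compress C v)
  dot-compress []             []      = refl
  dot-compress (on {a = a} s) (b ∷ v) = cong (a * b +_) (dot-compress s v)
  dot-compress (off s)        (b ∷ v) = trans (cong₂ _+_ (zeroˡ b) (dot-compress s v)) (+-identityˡ _)

  -- Each fibre of `compress C` has q^(n - c) elements, c the size of C; the factor q^c on the left
  -- avoids the subtraction.
  Σ-vectors-compress : ∀ {n} (C : Subset n) (h : V ∣ C ∣ → ℤ) →
    𝒒 ℤ.^ ∣ C ∣ ℤ.* Σ⟨ vecs n ⟩ (h ∘ compress C) ≡ 𝒒 ℤ.^ n ℤ.* Σ⟨ vecs ∣ C ∣ ⟩ h
  Σ-vectors-compress []          h = refl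
  Σ-vectors-compress {suc n} (true ∷ C) h = begin
    𝒒 ℤ.* qᶜ ℤ.* Σ⟨ vecs (suc n) ⟩ (h ∘ compress (true ∷ C)) ≡⟨ cong (𝒒 ℤ.* qᶜ ℤ.*_) (Σ-∷ n _) ⟩
    𝒒 ℤ.* qᶜ ℤ.* Σ⟨ scalars ⟩ (λ a → Σ⟨ vecs n ⟩ (λ v → h (a ∷ compress C v))) ≡⟨ pull qᶜ (λ a → Σ⟨ vecs n ⟩ (λ v → h (a ∷ compress C v))) ⟩
    𝒒 ℤ.* Σ⟨ scalars ⟩ (λ a → qᶜ ℤ.* Σ⟨ vecs n ⟩ (λ v → h (a ∷ compress C v))) ≡⟨ cong (𝒒 ℤ.*_) (Σ-cong scalars (λ a → Σ-vectors-compress C (h ∘ (a ∷_)))) ⟩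
    𝒒 ℤ.* Σ⟨ scalars ⟩ (λ a → 𝒒 ℤ.^ n ℤ.* Σ⟨ vecs ∣ C ∣ ⟩ (λ v → h (a ∷ v))) ≡⟨ pull (𝒒 ℤ.^ n) (λ a → Σ⟨ vecs ∣ C ∣ ⟩ (λ v → h (a ∷ v))) ⟨
    𝒒 ℤ.* 𝒒 ℤ.^ n ℤ.* Σ⟨ scalars ⟩ (λ a → Σ⟨ vecs ∣ C ∣ ⟩ (λ v → h (a ∷ v))) ≡⟨ cong (𝒒 ℤ.* 𝒒 ℤ.^ n ℤ.*_) (Σ-∷ ∣ C ∣ h) ⟨
    𝒒 ℤ.* 𝒒 ℤ.^ n ℤ.* Σ⟨ vecs (suc ∣ C ∣) ⟩ h ∎
    where
    qᶜ = 𝒒 ℤ.^ ∣ C ∣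
    pull : ∀ k (f : K → ℤ) → 𝒒 ℤ.* k ℤ.* Σ⟨ scalars ⟩ f ≡ 𝒒 ℤ.* Σ⟨ scalars ⟩ (λ a → k ℤ.* f a)
    pull k f = trans (ℤ.*-assoc 𝒒 k (Σ⟨ scalars ⟩ f)) (cong (𝒒 ℤ.*_) (sym (Σ-*ˡ scalars k f)))
  Σ-vectors-compress {suc n} (false ∷ C) h = begin
    qᶜ ℤ.* Σ⟨ vecs (suc n) ⟩ (h ∘ compress (false ∷ C)) ≡⟨ cong (qᶜ ℤ.*_) (Σ-∷ n _) ⟩
    qᶜ ℤ.* Σ⟨ scalars ⟩ (λ _ → Σ⟨ vecs n ⟩ (h ∘ compress C)) ≡⟨ cong (qᶜ ℤ.*_) (Σ-scalars-const _) ⟩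
    qᶜ ℤ.* (𝒒 ℤ.* Σ⟨ vecs n ⟩ (h ∘ compress C)) ≡⟨ lemma qᶜ 𝒒 (Σ⟨ vecs n ⟩ (h ∘ compress C)) ⟩
    𝒒 ℤ.* (qᶜ ℤ.* Σ⟨ vecs n ⟩ (h ∘ compress C)) ≡⟨ cong (𝒒 ℤ.*_) (Σ-vectors-compress C h) ⟩
    𝒒 ℤ.* (𝒒 ℤ.^ n ℤ.* Σ⟨ vecs ∣ C ∣ ⟩ h) ≡⟨ ℤ.*-assoc 𝒒 (𝒒 ℤ.^ n) (Σ⟨ vecs ∣ C ∣ ⟩ h) ⟨
    𝒒 ℤ.* 𝒒 ℤ.^ n ℤ.* Σ⟨ vecs ∣ C ∣ ⟩ h ∎
    where
    qᶜ = 𝒒 ℤ.^ ∣ C ∣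
    lemma : ∀ a b c → a ℤ.* (b ℤ.* c) ≡ b ℤ.* (a ℤ.* c)
    lemma = solve-∀

  rk-compress : ∀ {n} (C : Subset n) {A} → All (Supported C) A → rk A ≡ rk (map (compress C) A)
  rk-compress {n} C {A} As = ℕ.+-cancelʳ-≡ (corank A ℕ.+ ∣ C ∣) (rk A) (rk A′) (begin
    rk A ℕ.+ (corank A ℕ.+ ∣ C ∣) ≡⟨ ℕ.+-assoc (rk A) (corank A) ∣ C ∣ ⟨
    rk A ℕ.+ corank A ℕ.+ ∣ C ∣ ≡⟨ cong (ℕ._+ ∣ C ∣) (rk+corank A) ⟩
    n ℕ.+ ∣ C ∣ ≡⟨ ℕ.+-comm n ∣ C ∣ ⟩
    ∣ C ∣ ℕ.+ n ≡⟨ cong (ℕ._+ n) (rk+corank A′) ⟨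
    rk A′ ℕ.+ corank A′ ℕ.+ n ≡⟨ ℕ.+-assoc (rk A′) (corank A′) n ⟩
    rk A′ ℕ.+ (corank A′ ℕ.+ n) ≡⟨ cong (rk A′ ℕ.+_) (trans (ℕ.+-comm (corank A′) n) (trans (sym coranks) (ℕ.+-comm ∣ C ∣ (corank A)))) ⟩
    rk A′ ℕ.+ (corank A ℕ.+ ∣ C ∣) ∎)
    where
    A′ = map (compress C) A
    to : ∀ {A} → All (Supported C) A → ∀ {v} → Kernel A v → Kernel (map (compress C) A) (compress C v)
    to []       []       = []
    to (s ∷ ss) (p ∷ ps) = trans (sym (dot-compress s _)) p ∷ to ss ps
    from : ∀ {A} → All (Supported C) A → ∀ {v} → Kernel (map (compress C) A) (compress C v) → Kernel A v
    from []       []       = []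
    from (s ∷ ss) (p ∷ ps) = trans (dot-compress s _) p ∷ from ss ps
    coranks : ∣ C ∣ ℕ.+ corank A ≡ n ℕ.+ corank A′
    coranks = ^-injective _ _ (begin
      𝒒 ℤ.^ (∣ C ∣ ℕ.+ corank A) ≡⟨ ℤ.^-distribˡ-+-* 𝒒 ∣ C ∣ (corank A) ⟩
      𝒒 ℤ.^ ∣ C ∣ ℤ.* 𝒒 ℤ.^ corank A ≡⟨ cong (𝒒 ℤ.^ ∣ C ∣ ℤ.*_) (Kernels.card≡ A) ⟨
      𝒒 ℤ.^ ∣ C ∣ ℤ.* card (kernel A) ≡⟨ cong (𝒒 ℤ.^ ∣ C ∣ ℤ.*_) (Σ-cong (vecs n) (λ v → []-cong (kernel A ∋? v) (kernel A′ ∋? compress C v) (to As) (from As))) ⟩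
      𝒒 ℤ.^ ∣ C ∣ ℤ.* Σ⟨ vecs n ⟩ (λ v → [ kernel A′ ∋? compress C v ]) ≡⟨ Σ-vectors-compress C (λ v → [ kernel A′ ∋? v ]) ⟩
      𝒒 ℤ.^ n ℤ.* card (kernel A′) ≡⟨ cong (𝒒 ℤ.^ n ℤ.*_) (Kernels.card≡ A′) ⟩
      𝒒 ℤ.^ n ℤ.* 𝒒 ℤ.^ corank A′ ≡⟨ ℤ.^-distribˡ-+-* 𝒒 n (corank A′) ⟨
      𝒒 ℤ.^ (n ℕ.+ corank A′) ∎)

  count-compress : ∀ {n} (C : Subset n) S → All (_≼ C) S → ∀ r → count S r ≡ count (map (compress C) S) r
  count-compress C S S≼ r = trans
    (Σ-cong-∈ (Matrices S) (λ A∈ → cong (λ k → [ k ℕ.≟ r ]) (rk-compress C (Matrices-Supported S S≼ A∈))))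
    (Σ-Matrices-compress C S S≼ (λ A → [ rk A ℕ.≟ r ]))

  Σ-rowsOn-⊥ : ∀ {n} (h : V n → ℤ) → Σ⟨ rowsOn ⊥ ⟩ h ≡ h 𝟎
  Σ-rowsOn-⊥ {zero}  h = ℤ.+-identityʳ (h [])
  Σ-rowsOn-⊥ {suc n} h = trans (Σ-map (0# ∷_) (rowsOn ⊥) h) (Σ-rowsOn-⊥ (h ∘ (0# ∷_)))

  count-⊥∷ : ∀ {n} (S : List (Subset n)) r → count (⊥ ∷ S) r ≡ count S r
  count-⊥∷ S r = trans (Σ-× _∷_ (rowsOn ⊥) (Matrices S) (λ A → [ rk A ℕ.≟ r ]))
    (trans (Σ-rowsOn-⊥ (λ a → Σ⟨ Matrices S ⟩ (λ A → [ rk (a ∷ A) ℕ.≟ r ])))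
      (Σ-cong (Matrices S) (λ A → cong (λ k → [ k ℕ.≟ r ]) (rk-kernel (𝟎 ∷ A) A All.tail (λ {v} k → dot-0 v ∷ k)))))
    where
    dot-0 : ∀ {n} (v : V n) → dot 𝟎 v ≡ 0#
    dot-0 []      = refl
    dot-0 (a ∷ v) = trans (cong₂ _+_ (zeroˡ a) (dot-0 v)) (+-identityˡ 0#)

  count->length : ∀ {n} (S : List (Subset n)) r → length S < r → count S r ≡ 0ℤ
  count->length S r S<r = trans (Σ-cong-∈ (Matrices S) (λ {A} A∈ → []-no (rk A ℕ.≟ r) (λ e →
    ℕ.<⇒≱ S<r (subst (_≤ length S) e (ℕ.≤-trans (rk≤length A) (ℕ.≤-reflexive (lengths S A∈))))))) (Σ-0 (Matrices S))
    where
    lengths : ∀ S {A} → A ∈ Matrices S → length A ≡ length S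
    lengths []      (here refl) = refl
    lengths (s ∷ S) A∈ with ∈-cartesianProductWith⁻ _∷_ (rowsOn s) (Matrices S) A∈
    ... | a , A , _ , A∈′ , refl = cong suc (lengths S A∈′)

  count-[] : ∀ {n} → count {n} [] 0 ≡ 1ℤ
  count-[] {n} = trans (ℤ.+-identityʳ [ rk {n} [] ℕ.≟ 0 ]) ([]-yes (rk {n} [] ℕ.≟ 0) (ℕ.n≤0⇒n≡0 (rk≤length {n} [])))

-- Congruences modulo (q - 1)^(r + 6)

-- Relative precision: f is divisible by x^r, x = q - 1, and the cofactor is polynomial modulo x^6.
Tame : ℕ → Family → Set
Tame r f = ∃[ P ] (∀ {q} (F : Field q) → let x = q-1 F in x ℤ.^ (r ℕ.+ 6) ∣ f F ℤ.- x ℤ.^ r ℤ.* ⟦ P ⟧ x)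

^-∣-^ : ∀ x {a b} → a ≤ b → x ℤ.^ a ∣ x ℤ.^ b
^-∣-^ x {a} {b} a≤b = divides (x ℤ.^ (b ℕ.∸ a)) (trans (cong (x ℤ.^_) (sym (ℕ.m∸n+n≡m a≤b))) (ℤ.^-distribˡ-+-* x (b ℕ.∸ a) a))

tame-cong : ∀ r {f g : Family} → (∀ {q} (F : Field q) → f F ≡ g F) → Tame r g → Tame r f
tame-cong r e (P , d) = P , λ F → subst (λ z → (q-1 F) ℤ.^ (r ℕ.+ 6) ∣ z ℤ.- (q-1 F) ℤ.^ r ℤ.* ⟦ P ⟧ (q-1 F)) (sym (e F)) (d F)

tame-∣ : ∀ r (f : Family) → (∀ {q} (F : Field q) → (q-1 F) ℤ.^ (r ℕ.+ 6) ∣ f F) → Tame r f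
tame-∣ r f d = [] , λ F → subst ((q-1 F) ℤ.^ (r ℕ.+ 6) ∣_)
  (sym (trans (cong (λ z → f F ℤ.- z) (ℤ.*-zeroʳ ((q-1 F) ℤ.^ r))) (ℤ.+-identityʳ (f F)))) (d F)

tame-0 : ∀ r {f : Family} → (∀ {q} (F : Field q) → f F ≡ 0ℤ) → Tame r f
tame-0 r {f} e = tame-∣ r f (λ F → subst (_ ∣_) (sym (e F)) (divides 0ℤ refl))

tame-multiple : ∀ r m {f : Family} → r ≤ m → PolynomialMultiple m f → Tame r f
tame-multiple r m {f} r≤m (P , e) = List.replicate (m ℕ.∸ r) 0ℤ ++ P , λ F → divides 0ℤ (trans (cong₂ ℤ._-_ (e F) (shifted (q-1 F))) (ℤ.+-inverseʳ ((q-1 F) ℤ.^ m ℤ.* ⟦ P ⟧ (q-1 F))))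
  where
  shifted : ∀ x → x ℤ.^ r ℤ.* ⟦ List.replicate (m ℕ.∸ r) 0ℤ ++ P ⟧ x ≡ x ℤ.^ m ℤ.* ⟦ P ⟧ x
  shifted x = begin
    x ℤ.^ r ℤ.* ⟦ List.replicate (m ℕ.∸ r) 0ℤ ++ P ⟧ x ≡⟨ cong (x ℤ.^ r ℤ.*_) (⟦shift⟧ (m ℕ.∸ r) P x) ⟩
    x ℤ.^ r ℤ.* (x ℤ.^ (m ℕ.∸ r) ℤ.* ⟦ P ⟧ x) ≡⟨ ℤ.*-assoc (x ℤ.^ r) (x ℤ.^ (m ℕ.∸ r)) (⟦ P ⟧ x) ⟨
    x ℤ.^ r ℤ.* x ℤ.^ (m ℕ.∸ r) ℤ.* ⟦ P ⟧ x ≡⟨ cong (ℤ._* ⟦ P ⟧ x) (ℤ.^-distribˡ-+-* x r (m ℕ.∸ r)) ⟨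
    x ℤ.^ (r ℕ.+ (m ℕ.∸ r)) ℤ.* ⟦ P ⟧ x ≡⟨ cong (λ k → x ℤ.^ k ℤ.* ⟦ P ⟧ x) (ℕ.m+[n∸m]≡n r≤m) ⟩
    x ℤ.^ m ℤ.* ⟦ P ⟧ x ∎

tame-+ : ∀ r {f g : Family} → Tame r f → Tame r g → Tame r (λ F → f F ℤ.+ g F)
tame-+ r {f} {g} (P , d) (Q , e) = P ⊕ Q , λ F → let x = q-1 F in
  subst (x ℤ.^ (r ℕ.+ 6) ∣_) (trans (lemma (f F) (g F) (x ℤ.^ r) (⟦ P ⟧ x) (⟦ Q ⟧ x)) (cong (λ z → f F ℤ.+ g F ℤ.- x ℤ.^ r ℤ.* z) (sym (⟦⊕⟧ P Q x))))
    (∣m∣n⇒∣m+n (d F) (e F))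
  where
  lemma : ∀ f g y p r → (f ℤ.- y ℤ.* p) ℤ.+ (g ℤ.- y ℤ.* r) ≡ f ℤ.+ g ℤ.- y ℤ.* (p ℤ.+ r)
  lemma = solve-∀

-- With X = x^i, Y = x^j and Z = x^6, write u = X p + a X Z and v = Y r + b Y Z. Every term of u v
-- other than X Y p r contains X Y Z, and the witness collects their cofactors.
tame-* : ∀ i j {f g : Family} → Tame i f → Tame j g → Tame (i ℕ.+ j) (λ F → f F ℤ.* g F)
tame-* i j {f} {g} (P , d) (Q , e) = P ⊗ Q , λ F → product (q-1 F) (f F) (g F) (d F) (e F)
  where
  product : ∀ x u v → x ℤ.^ (i ℕ.+ 6) ∣ u ℤ.- x ℤ.^ i ℤ.* ⟦ P ⟧ x → x ℤ.^ (j ℕ.+ 6) ∣ v ℤ.- x ℤ.^ j ℤ.* ⟦ Q ⟧ x →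
            x ℤ.^ (i ℕ.+ j ℕ.+ 6) ∣ u ℤ.* v ℤ.- x ℤ.^ (i ℕ.+ j) ℤ.* ⟦ P ⊗ Q ⟧ x
  product x u v (divides a ea) (divides b eb) = divides (a ℤ.* r ℤ.+ a ℤ.* b ℤ.* Z ℤ.+ p ℤ.* b) (begin
    u ℤ.* v ℤ.- x ℤ.^ (i ℕ.+ j) ℤ.* ⟦ P ⊗ Q ⟧ x ≡⟨ cong₂ (λ y z → u ℤ.* v ℤ.- y ℤ.* z) (ℤ.^-distribˡ-+-* x i j) (⟦⊗⟧ P Q x) ⟩
    u ℤ.* v ℤ.- X ℤ.* Y ℤ.* (p ℤ.* r) ≡⟨ expand₁ u v X Y p r ⟩
    (u ℤ.- X ℤ.* p) ℤ.* (Y ℤ.* r ℤ.+ (v ℤ.- Y ℤ.* r)) ℤ.+ X ℤ.* p ℤ.* (v ℤ.- Y ℤ.* r)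
      ≡⟨ cong₂ (λ s t → s ℤ.* (Y ℤ.* r ℤ.+ t) ℤ.+ X ℤ.* p ℤ.* t) (trans ea (cong (a ℤ.*_) (ℤ.^-distribˡ-+-* x i 6))) (trans eb (cong (b ℤ.*_) (ℤ.^-distribˡ-+-* x j 6))) ⟩
    (a ℤ.* (X ℤ.* Z)) ℤ.* (Y ℤ.* r ℤ.+ b ℤ.* (Y ℤ.* Z)) ℤ.+ X ℤ.* p ℤ.* (b ℤ.* (Y ℤ.* Z)) ≡⟨ collect a b X Y Z p r ⟩
    (a ℤ.* r ℤ.+ a ℤ.* b ℤ.* Z ℤ.+ p ℤ.* b) ℤ.* (X ℤ.* Y ℤ.* Z) ≡⟨ cong ((a ℤ.* r ℤ.+ a ℤ.* b ℤ.* Z ℤ.+ p ℤ.* b) ℤ.*_)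
        (trans (ℤ.^-distribˡ-+-* x (i ℕ.+ j) 6) (cong (ℤ._* Z) (ℤ.^-distribˡ-+-* x i j))) ⟨
    (a ℤ.* r ℤ.+ a ℤ.* b ℤ.* Z ℤ.+ p ℤ.* b) ℤ.* x ℤ.^ (i ℕ.+ j ℕ.+ 6) ∎)
    where
    X = x ℤ.^ i
    Y = x ℤ.^ j
    Z = x ℤ.^ 6
    p = ⟦ P ⟧ x
    r = ⟦ Q ⟧ x
    expand₁ : ∀ u v X Y p r → u ℤ.* v ℤ.- X ℤ.* Y ℤ.* (p ℤ.* r) ≡ (u ℤ.- X ℤ.* p) ℤ.* (Y ℤ.* r ℤ.+ (v ℤ.- Y ℤ.* r)) ℤ.+ X ℤ.* p ℤ.* (v ℤ.- Y ℤ.* r)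
    expand₁ = solve-∀
    collect : ∀ a b X Y Z p r → (a ℤ.* (X ℤ.* Z)) ℤ.* (Y ℤ.* r ℤ.+ b ℤ.* (Y ℤ.* Z)) ℤ.+ X ℤ.* p ℤ.* (b ℤ.* (Y ℤ.* Z)) ≡ (a ℤ.* r ℤ.+ a ℤ.* b ℤ.* Z ℤ.+ p ℤ.* b) ℤ.* (X ℤ.* Y ℤ.* Z)
    collect = solve-∀

tame-Σ< : ∀ r n (f : ℕ → Family) → (∀ i → i < n → Tame r (f i)) → Tame r (λ F → Σ< n (λ i → f i F))
tame-Σ< r zero    f h = tame-0 r (λ _ → refl)
tame-Σ< r (suc n) f h = tame-+ r {λ F → Σ< n (λ i → f i F)} {f n} (tame-Σ< r n f (λ i i<n → h i (ℕ.m<n⇒m<1+n i<n))) (h n ℕ.≤-refl)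

tame-Σ : ∀ {A : Set} r (as : List A) (f : A → Family) → (∀ a → Tame r (f a)) → Tame r (λ F → Σ⟨ as ⟩ (λ a → f a F))
tame-Σ r []       f h = tame-0 r (λ _ → refl)
tame-Σ r (a ∷ as) f h = tame-+ r {f a} {λ F → Σ⟨ as ⟩ (λ a → f a F)} (h a) (tame-Σ r as f h)

-- With at least seven columns the torus of the component already has rank at least r + 6.
count-connected : ∀ {n} {s : Subset n} {S} → Nonempty s → Chain s S → ∀ r → Tame r (λ F → Boards.count F (s ∷ S) r)
count-connected {n} {s} {S} ne chain r with r ℕ.≤? suc (length S) | ∣ reach s S ∣ ℕ.≤? 6
... | no r≰  | _       = tame-0 r (λ F → Components.count->length F (s ∷ S) r (ℕ.≰⇒> r≰))
... | yes r≤ | no C≰6  = tame-∣ r (λ F → Boards.count F (s ∷ S) r) (λ F → ∣-trans (^-∣-^ (q-1 F) exponents) (Components.component-∣ F s chain r))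
  where
  exponents : r ℕ.+ 6 ≤ ∣ reach s S ∣ ℕ.+ length S
  exponents = ℕ.≤-trans (ℕ.+-monoˡ-≤ 6 r≤) (ℕ.≤-trans (ℕ.≤-reflexive (trans (sym (ℕ.+-suc (length S) 6)) (ℕ.+-comm (length S) 7))) (ℕ.+-monoˡ-≤ (length S) (ℕ.≰⇒> C≰6)))
... | yes r≤ | yes C≤6 = tame-cong r (λ F → Components.count-compress F C (s ∷ S) S≼C r)
  (tame-multiple r (length (map (compress C) (s ∷ S))) (subst (r ≤_) (sym (length-map (compress C) (s ∷ S))) r≤)
    (count-polynomial C≤6 (map (compress C) (s ∷ S)) (All.map⁺ (All.zipWith (λ {t} (t≼C , t≢∅) → Nonempty-compress t C t≼C t≢∅) (S≼C , ne ∷ Chain-Nonempty chain))) r))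
  where
  C = reach s S
  S≼C : All (_≼ C) (s ∷ S)
  S≼C = ≼-reach s S ∷ All-≼-reach s S

-- The component of the first row is split off, and the rank is distributed over it and the rest.
-- `k` bounds the number of rows and drives the recursion, because `outside` is related to S only
-- through a permutation.
count-tame : ∀ k {n} (S : List (Subset n)) → length S ≤ k → ∀ r → Tame r (λ F → Boards.count F S r)
count-tame k {n} [] _ zero    = const 1ℤ , λ F → divides 0ℤ (cong₂ ℤ._-_ (Components.count-[] F {n}) (trans (ℤ.*-identityˡ _) (⟦const⟧ 1ℤ (q-1 F))))
count-tame k {n} [] _ (suc r) = tame-0 (suc r) (λ F → Components.count->length F {n} [] (suc r) (s≤s z≤n))
count-tame (suc k) {n} (s ∷ S) (s≤s len) r with nonempty? s
... | no s≡∅ = tame-cong r (λ F → trans (cong (λ t → Boards.count F (t ∷ S) r) (Empty-unique s≡∅)) (Components.count-⊥∷ F S r)) (count-tame k S len r)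
... | yes ne = tame-cong r decompose (tame-Σ< r (suc r) (λ i F → Boards.count F (s ∷ inside) i ℤ.* Boards.count F outside (r ℕ.∸ i))
    (λ { i (s≤s i≤r) → subst (λ k → Tame k (λ F → Boards.count F (s ∷ inside) i ℤ.* Boards.count F outside (r ℕ.∸ i))) (ℕ.m+[n∸m]≡n i≤r)
      (tame-* i (r ℕ.∸ i) {λ F → Boards.count F (s ∷ inside) i} {λ F → Boards.count F outside (r ℕ.∸ i)} (count-connected ne chain i) (count-tame k outside shorter (r ℕ.∸ i))) }))
  where
  open Component (component (length S) s S ℕ.≤-refl)
  shorter : length outside ≤ k
  shorter = ℕ.≤-trans (ℕ.m≤n+m (length outside) (length inside))
    (ℕ.≤-trans (ℕ.≤-reflexive (trans (sym (length-++ inside)) (sym (↭-length split)))) len)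
  decompose : ∀ {q} (F : Field q) → Boards.count F (s ∷ S) r ≡ Σ< (suc r) (λ i → Boards.count F (s ∷ inside) i ℤ.* Boards.count F outside (r ℕ.∸ i))
  decompose F = trans (trans (count≡countWith (s ∷ S) r) (trans (countWith-↭ [] (↭.prep s split) r) (sym (count≡countWith (s ∷ inside ++ outside) r))))
    (count-++ (reach s inside) (s ∷ inside) outside (≼-reach s inside ∷ All-≼-reach s inside) separate r)
    where open Components F using (count≡countWith; countWith-↭; count-++)

-- Exact supports inside a board

subsets : ∀ {n} → Subset n → List (Subset n)
subsets []          = [] ∷ []
subsets (true ∷ b)  = map (true ∷_) (subsets b) ++ map (false ∷_) (subsets b)
subsets (false ∷ b) = map (false ∷_) (subsets b)

-- The possible exact supports, row by row, of the matrices supported on the board.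
subBoards : ∀ {m n} → Vec (Subset n) m → List (List (Subset n))
subBoards []       = [] ∷ []
subBoards (b ∷ bs) = cartesianProductWith _∷_ (subsets b) (subBoards bs)

-- From finite fields on setoids to fields on Fin q

module Transport {q : ℕ} (F : FiniteField q) where

  private
    module H = HeytingField (FiniteField.heytingField F)
    module C = CommutativeRing (FiniteField.commutativeRing F)
    module E = Inverse (FiniteField.enumeration F)
    open FiniteField F using (_≈_)
    open E using (to; from)

    to-from : ∀ a → to (from a) ≈ a
    to-from = E.strictlyInverseˡ

    to-injective : ∀ {a b} → to a ≈ to b → a ≡ b
    to-injective {a} {b} e = trans (sym (E.strictlyInverseʳ a)) (trans (E.from-cong e) (E.strictlyInverseʳ b))

  transport : Field q
  transport = record
    { _+_ = add ; _*_ = mul ; -_ = neg ; 0# = from H.0# ; 1# = from H.1#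
    ; isCommutativeRing = RingMonomorphism.isCommutativeRing monomorphism C.isCommutativeRing
    ; inverse = inverse′
    ; 1≢0 = λ e → H.#-irrefl (H.trans (H.sym (to-from H.1#)) (H.trans (H.reflexive (cong to e)) (to-from H.0#))) 1#0
    }
    where
    add mul : Fin q → Fin q → Fin q
    add a b = from (to a H.+ to b)
    mul a b = from (to a H.* to b)
    neg : Fin q → Fin q
    neg a = from (H.- to a)
    monomorphism : IsRingMonomorphism
      (record { Carrier = Fin q ; _≈_ = _≡_ ; _+_ = add ; _*_ = mul ; -_ = neg ; 0# = from H.0# ; 1# = from H.1# })
      C.rawRing to
    monomorphism = record
      { isRingHomomorphism = record
        { isSemiringHomomorphism = record
          { isNearSemiringHomomorphism = record
            { +-isMonoidHomomorphism = record
              { isMagmaHomomorphism = record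
                { isRelHomomorphism = record { cong = λ e → H.reflexive (cong to e) }
                ; homo = λ _ _ → to-from _ }
              ; ε-homo = to-from _ }
            ; *-homo = λ _ _ → to-from _ }
          ; 1#-homo = to-from _ }
        ; -‿homo = λ _ → to-from _ }
      ; injective = to-injective
      }
    open import Algebra.Properties.Ring C.ring using (-0#≈0#)
    -- Apartness in a Heyting field means that the difference is invertible, so being apart from 0
    -- speaks of a - 0.
    a-0 : ∀ a → a H.- H.0# ≈ a
    a-0 a = H.trans (H.+-congˡ -0#≈0#) (H.+-identityʳ a)
    1#0 : H.1# H.# H.0#
    1#0 = H.invertible⇒# (H.1# , H.trans (H.*-identityˡ _) (a-0 H.1#) , H.trans (H.*-identityʳ _) (a-0 H.1#))
    inverse′ : ∀ {a} → a ≢ from H.0# → ∃[ b ] mul b a ≡ from H.1#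
    -- Searching `Fin q` decides whether an inverse exists. If there is none, a is not apart from 0,
    -- and tightness makes it equal to 0.
    inverse′ {a} a≢0 with any? (λ b → mul b a ≟F from H.1#)
    ... | yes inv = inv
    ... | no none = contradiction (to-injective (H.trans (proj₁ (H.tight (to a) H.0#) not#) (H.sym (to-from H.0#)))) a≢0
      where
      not# : ¬ to a H.# H.0#
      not# a#0 with H.#⇒invertible a#0
      ... | y , ya≈1 , _ = none (from y , E.from-cong (H.trans (H.*-cong (to-from y) (H.sym (a-0 (to a)))) ya≈1))

  open Components transport
  open import Algebra.Properties.Semiring.Sum C.semiring using (sum; sum-cong-≋)

  -- Recursion with `Vector._∷_` yields vectors definitionally equal to those that `vectors` builds;
  -- for `e ∘ lookup v` this would take function extensionality.
  embed : ∀ {A B : Set} {n} → (A → B) → Vec A n → Vector B n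
  embed e []      = Vector.[]
  embed e (a ∷ v) = e a Vector.∷ embed e v

  embed-lookup : ∀ {A B : Set} {n} (e : A → B) (v : Vec A n) i → embed e v i ≡ e (lookup v i)
  embed-lookup e (a ∷ v) zero    = refl
  embed-lookup e (a ∷ v) (suc i) = embed-lookup e v i

  Σ-vectors : ∀ {A B : Set} (e : A → B) as bs → (∀ (h : B → ℤ) → Σ⟨ bs ⟩ h ≡ Σ⟨ as ⟩ (h ∘ e)) →
              ∀ n (h : Vector B n → ℤ) → Σ⟨ vectors bs n ⟩ h ≡ Σ⟨ power as n ⟩ (h ∘ embed e)
  Σ-vectors e as bs eq zero    h = refl
  Σ-vectors e as bs eq (suc n) h = begin
    Σ⟨ vectors bs (suc n) ⟩ h ≡⟨ Σ-× Vector._∷_ bs (vectors bs n) h ⟩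
    Σ⟨ bs ⟩ (λ b → Σ⟨ vectors bs n ⟩ (λ v → h (b Vector.∷ v))) ≡⟨ eq (λ b → Σ⟨ vectors bs n ⟩ (λ v → h (b Vector.∷ v))) ⟩
    Σ⟨ as ⟩ (λ a → Σ⟨ vectors bs n ⟩ (λ v → h (e a Vector.∷ v))) ≡⟨ Σ-cong as (λ a → Σ-vectors e as bs eq n (λ v → h (e a Vector.∷ v))) ⟩
    Σ⟨ as ⟩ (λ a → Σ⟨ power as n ⟩ (λ v → h (embed e (a ∷ v)))) ≡⟨ Σ-× _∷_ as (power as n) _ ⟨
    Σ⟨ power as (suc n) ⟩ (h ∘ embed e) ∎

  embedMatrix : ∀ {m n} → Vec (V n) m → Matrix F m n
  embedMatrix = embed (embed to)

  Σ-matrices : ∀ m n (h : Matrix F m n → ℤ) → Σ⟨ matrices F m n ⟩ h ≡ Σ⟨ power (vecs n) m ⟩ (h ∘ embedMatrix)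
  Σ-matrices m n = Σ-vectors (embed to) (vecs n) (vectors (map to (allFin q)) n)
    (Σ-vectors to scalars (map to (allFin q)) (Σ-map to (allFin q)) n) m

  entry : ∀ {m n} (A : Vec (V n) m) i j → embedMatrix A i j ≡ to (lookup (lookup A i) j)
  entry A i j = trans (cong (λ r → r j) (embed-lookup (embed to) A i)) (embed-lookup to (lookup A i) j)

  supported? : ∀ {n} (s : Subset n) → Decidable (Supported s)
  supported? []          []      = yes []
  supported? (true ∷ s)  (a ∷ v) = map′ on (λ { (on p) → p }) (supported? s v)
  supported? (false ∷ s) (a ∷ v) = map′ (λ { (refl , p) → off p }) (λ { (off p) → refl , p }) ((a ≟F 0#) ×-dec supported? s v)

  Supported⇒ : ∀ {n} {s : Subset n} {v} → Supported s v → ∀ j → lookup s j ≡ false → lookup v j ≡ 0#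
  Supported⇒ (off p) zero    _ = refl
  Supported⇒ (on p)  (suc j) e = Supported⇒ p j e
  Supported⇒ (off p) (suc j) e = Supported⇒ p j e

  Supported⇐ : ∀ {n} (s : Subset n) v → (∀ j → lookup s j ≡ false → lookup v j ≡ 0#) → Supported s v
  Supported⇐ []          []      h = []
  Supported⇐ (true ∷ s)  (a ∷ v) h = on (Supported⇐ s v (h ∘ suc))
  Supported⇐ (false ∷ s) (a ∷ v) h rewrite h zero refl = off (Supported⇐ s v (h ∘ suc))

  ∉⇒false : ∀ {n} (s : Subset n) j → j ∉ˢ s → lookup s j ≡ false
  ∉⇒false s j j∉ with lookup s j in eq
  ... | true  = contradiction (lookup⇒[]= j s eq) j∉
  ... | false = refl

  false⇒∉ : ∀ {n} (s : Subset n) j → lookup s j ≡ false → j ∉ˢ s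
  false⇒∉ s j e j∈ with trans (sym ([]=⇒lookup j∈)) e
  ... | ()

  to-0 : ∀ {a} → a ≡ 0# → to a ≈ H.0#
  to-0 refl = to-from H.0#

  0-to : ∀ {a} → to a ≈ H.0# → a ≡ 0#
  0-to e = to-injective (H.trans e (H.sym (to-from H.0#)))

  SupportedOn⇒ : ∀ {m n} (B : Board m n) A → SupportedOn F B (embedMatrix A) → Pointwise Supported (tabulate B) A
  SupportedOn⇒ B []      h = []
  SupportedOn⇒ B (a ∷ A) h = Supported⇐ (B zero) a zeros ∷ SupportedOn⇒ (B ∘ suc) A (h ∘ suc)
    where
    zeros : ∀ j → lookup (B zero) j ≡ false → lookup a j ≡ 0#
    zeros j j∉ with lookup a j ≟F 0#
    ... | yes e = e
    ... | no a≢0 = contradiction (h zero j (λ e → a≢0 (0-to (subst (_≈ H.0#) (embed-lookup to a j) e)))) (false⇒∉ (B zero) j j∉)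

  SupportedOn⇐ : ∀ {m n} (B : Board m n) A → Pointwise Supported (tabulate B) A → SupportedOn F B (embedMatrix A)
  SupportedOn⇐ B (a ∷ A) (p ∷ ps) zero    j a≉0 with lookup (B zero) j in eq
  ... | true  = lookup⇒[]= j (B zero) eq
  ... | false = contradiction (subst (_≈ H.0#) (sym (embed-lookup to a j)) (to-0 (Supported⇒ p j eq))) a≉0
  SupportedOn⇐ B (a ∷ A) (p ∷ ps) (suc i) j a≉0 = SupportedOn⇐ (B ∘ suc) A ps i j a≉0

  Independent : ∀ {n} → List (V n) → Subset n → Set
  Independent A S = ∀ {v} → Kernel A v → Supported S v → v ≡ 𝟎

  coordinates : ∀ {n} → Subset n → Subspace n
  coordinates S = record
    { _∋_    = Supported S
    ; _∋?_   = supported? S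
    ; zero∈  = zero-Supported S
    ; closed = closed-Supported
    }
    where
    zero-Supported : ∀ {n} (S : Subset n) → Supported S 𝟎
    zero-Supported []          = []
    zero-Supported (true ∷ S)  = on (zero-Supported S)
    zero-Supported (false ∷ S) = off (zero-Supported S)
    closed-Supported : ∀ {n} {S : Subset n} c {v w} → Supported S v → Supported S w → Supported S (v ∔ c ∙ w)
    closed-Supported c []      []      = []
    closed-Supported c (on p)  (on r)  = on (closed-Supported c p r)
    closed-Supported c (off {S = S} {v} p) (off {v = w} r) =
      subst (λ a → Supported (false ∷ S) (a ∷ v ∔ c ∙ w)) (sym (trans (+-identityˡ _) (zeroʳ c))) (off (closed-Supported c p r))

  Σ-supported : ∀ {n} (b : Subset n) (h : V n → ℤ) → Σ⟨ vecs n ⟩ (λ v → [ supported? b v ] ℤ.* h v) ≡ Σ⟨ supportedIn b ⟩ h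
  Σ-supported []          h = cong (ℤ._+ 0ℤ) (ℤ.*-identityˡ (h []))
  Σ-supported {suc n} (true ∷ b)  h = begin
    Σ⟨ vecs (suc n) ⟩ (λ v → [ supported? (true ∷ b) v ] ℤ.* h v) ≡⟨ Σ-∷ n _ ⟩
    Σ⟨ scalars ⟩ (λ c → Σ⟨ vecs n ⟩ (λ v → [ supported? b v ] ℤ.* h (c ∷ v))) ≡⟨ Σ-cong scalars (λ c → Σ-supported b (h ∘ (c ∷_))) ⟩
    Σ⟨ scalars ⟩ (λ c → Σ⟨ supportedIn b ⟩ (h ∘ (c ∷_))) ≡⟨ Σ-× _∷_ scalars (supportedIn b) h ⟨
    Σ⟨ supportedIn (true ∷ b) ⟩ h ∎
  Σ-supported {suc n} (false ∷ b) h = begin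
    Σ⟨ vecs (suc n) ⟩ (λ v → [ supported? (false ∷ b) v ] ℤ.* h v) ≡⟨ Σ-∷ n _ ⟩
    Σ⟨ scalars ⟩ (λ c → Σ⟨ vecs n ⟩ (λ v → [ (c ≟F 0#) ×-dec supported? b v ] ℤ.* h (c ∷ v))) ≡⟨ Σ-cong scalars (λ c → Σ-cong (vecs n) (λ v →
        trans (cong (ℤ._* h (c ∷ v)) ([]-× (c ≟F 0#) (supported? b v))) (ℤ.*-assoc [ c ≟F 0# ] [ supported? b v ] (h (c ∷ v))))) ⟩
    Σ⟨ scalars ⟩ (λ c → Σ⟨ vecs n ⟩ (λ v → [ c ≟F 0# ] ℤ.* ([ supported? b v ] ℤ.* h (c ∷ v)))) ≡⟨ Σ-cong scalars (λ c →
        trans (Σ-*ˡ (vecs n) [ c ≟F 0# ] (λ v → [ supported? b v ] ℤ.* h (c ∷ v))) (cong ([ c ≟F 0# ] ℤ.*_) (Σ-supported b (h ∘ (c ∷_))))) ⟩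
    Σ⟨ scalars ⟩ (λ c → [ c ≟F 0# ] ℤ.* Σ⟨ supportedIn b ⟩ (h ∘ (c ∷_))) ≡⟨ Σ-delta 0# (λ c → Σ⟨ supportedIn b ⟩ (h ∘ (c ∷_))) ⟩
    Σ⟨ supportedIn b ⟩ (h ∘ (0# ∷_)) ≡⟨ Σ-map (0# ∷_) (supportedIn b) h ⟨
    Σ⟨ supportedIn (false ∷ b) ⟩ h ∎

  card-coordinates : ∀ {n} (S : Subset n) → card (coordinates S) ≡ 𝒒 ℤ.^ ∣ S ∣
  card-coordinates {n} S = trans (Σ-cong (vecs n) (λ v → sym (ℤ.*-identityʳ [ supported? S v ])))
    (trans (Σ-supported S (λ _ → 1ℤ)) (Σ-supportedIn-1 S))

  _⊞_ : ∀ {n} → Subspace n → Subspace n → Subspace n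
  _⊞_ {n} U W = record
    { _∋_    = λ v → ∃[ u ] U ∋ u × W ∋ (v ∔ - 1# ∙ u)
    ; _∋?_   = λ v → any-vector? n (λ u → (U ∋? u) ×-dec (W ∋? (v ∔ - 1# ∙ u)))
    ; zero∈  = 𝟎 , zero∈ U , subst (W ∋_) (sym (∔-𝟎 𝟎 (- 1#))) (zero∈ W)
    ; closed = λ { c {v} {w} (u , u∈ , p) (u′ , u′∈ , p′) → u ∔ c ∙ u′ , closed U c u∈ u′∈ , subst (W ∋_) (eq c v w u u′) (closed W c p p′) }
    }
    where
    eq : ∀ c v w u u′ → v ∔ - 1# ∙ u ∔ c ∙ (w ∔ - 1# ∙ u′) ≡ v ∔ c ∙ w ∔ - 1# ∙ (u ∔ c ∙ u′)
    eq c v w u u′ = begin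
      v ∔ - 1# ∙ u ∔ c ∙ (w ∔ - 1# ∙ u′) ≡⟨ ∔-nest (v ∔ - 1# ∙ u) c w (- 1#) u′ ⟩
      v ∔ - 1# ∙ u ∔ c ∙ w ∔ c * - 1# ∙ u′ ≡⟨ cong₂ (λ z d → z ∔ d ∙ u′) (∔-swap v (- 1#) u c w) (*-comm c (- 1#)) ⟩
      v ∔ c ∙ w ∔ - 1# ∙ u ∔ - 1# * c ∙ u′ ≡⟨ ∔-nest (v ∔ c ∙ w) (- 1#) u c u′ ⟨
      v ∔ c ∙ w ∔ - 1# ∙ (u ∔ c ∙ u′) ∎

  -- The coordinate subspace on S meets the kernel only in 0, so their sum has dimension ∣ S ∣ +
  -- corank, which is at most n.
  independent-≤-rk : ∀ {n} (A : List (V n)) S → Independent A S → ∣ S ∣ ≤ rk A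
  independent-≤-rk {n} A S indep = ℕ.+-cancelʳ-≤ (corank A) ∣ S ∣ (rk A) (ℕ.≤-trans (ℕ.≤-reflexive dims)
    (ℕ.≤-trans (ℕ.m≤n+m D.dim ∣ D.complement ∣) (ℕ.≤-reflexive (trans D.∣∣+dim (sym (rk+corank A))))))
    where
    U = coordinates S
    W = kernel A
    module D = Dim (dimension (U ⊞ W))
    dims : ∣ S ∣ ℕ.+ corank A ≡ D.dim
    dims = ^-injective _ _ (begin
      𝒒 ℤ.^ (∣ S ∣ ℕ.+ corank A) ≡⟨ ℤ.^-distribˡ-+-* 𝒒 ∣ S ∣ (corank A) ⟩
      𝒒 ℤ.^ ∣ S ∣ ℤ.* 𝒒 ℤ.^ corank A ≡⟨ cong₂ ℤ._*_ (card-coordinates S) (Kernels.card≡ A) ⟨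
      card U ℤ.* card W ≡⟨ card-modular U W (U ⊞ W) id (λ {u} {w} u∈ w∈ → u , u∈ , subst (W ∋_) (sym (∔-∙-neg w 1# u)) w∈) ⟨
      card (U ⋒ W) ℤ.* card (U ⊞ W) ≡⟨ cong₂ ℤ._*_ (trans (Σ-cong (vecs n) (λ v → []-cong ((U ⋒ W) ∋? v) (v ≟ⱽ 𝟎)
        (λ (s , k) → indep k s) (λ { refl → zero∈ (U ⋒ W) }))) (Σ-𝟎 n)) D.card≡ ⟩
      1ℤ ℤ.* 𝒒 ℤ.^ D.dim ≡⟨ ℤ.*-identityˡ (𝒒 ℤ.^ D.dim) ⟩
      𝒒 ℤ.^ D.dim ∎)

  lookup≡0⇒ : ∀ {n} (v : V n) → (∀ j → lookup v j ≡ 0#) → v ≡ 𝟎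
  lookup≡0⇒ []      h = refl
  lookup≡0⇒ (a ∷ v) h = cong₂ _∷_ (h zero) (lookup≡0⇒ v (h ∘ suc))

  to-dot : ∀ {n} (a v : V n) → sum (λ j → to (lookup v j) H.* to (lookup a j)) ≈ to (dot a v)
  to-dot []       []      = H.sym (to-from H.0#)
  to-dot (a ∷ as) (b ∷ v) = H.trans (H.+-cong (H.trans (H.*-comm (to b) (to a)) (H.sym (to-from _))) (to-dot as v)) (H.sym (to-from _))

  combination : ∀ {m n} (A : Vec (V n) m) (v : V n) (c : Vector H.Carrier n) → (∀ j → c j ≈ to (lookup v j)) → ∀ i →
                sum (λ j → c j H.* embedMatrix A i j) ≈ to (dot (lookup A i) v)
  combination A v c e i = H.trans (sum-cong-≋ (λ j → H.*-cong (e j) (H.reflexive (entry A i j)))) (to-dot (lookup A i) v)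

  Kernel-lookup⇒ : ∀ {m n} (A : Vec (V n) m) {v} → Kernel (toList A) v → ∀ i → dot (lookup A i) v ≡ 0#
  Kernel-lookup⇒ (a ∷ A) (p ∷ ps) zero    = p
  Kernel-lookup⇒ (a ∷ A) (p ∷ ps) (suc i) = Kernel-lookup⇒ A ps i

  Kernel-lookup⇐ : ∀ {m n} (A : Vec (V n) m) {v} → (∀ i → dot (lookup A i) v ≡ 0#) → Kernel (toList A) v
  Kernel-lookup⇐ []      h = []
  Kernel-lookup⇐ (a ∷ A) h = h zero ∷ Kernel-lookup⇐ A (h ∘ suc)

  independent⇒ : ∀ {m n} (A : Vec (V n) m) S → IndependentColumns F (embedMatrix A) S → Independent (toList A) S
  independent⇒ A S indep {v} k s = lookup≡0⇒ v (λ j → 0-to (indep (λ j → to (lookup v j))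
    (λ j j∉ → to-0 (Supported⇒ s j (∉⇒false S j j∉)))
    (λ i → H.trans (combination A v (λ j → to (lookup v j)) (λ _ → H.refl) i) (to-0 (Kernel-lookup⇒ A k i))) j))

  independent⇐ : ∀ {m n} (A : Vec (V n) m) S → Independent (toList A) S → IndependentColumns F (embedMatrix A) S
  independent⇐ {n = n} A S indep c out rel j = H.trans (c≈ j) (to-0 (trans (cong (λ w → lookup w j) v≡𝟎) (lookup-replicate j 0#)))
    where
    v : V n
    v = tabulate (from ∘ c)
    c≈ : ∀ j → c j ≈ to (lookup v j)
    c≈ j = H.trans (H.sym (to-from (c j))) (H.reflexive (cong to (sym (lookup∘tabulate (from ∘ c) j))))
    v≡𝟎 : v ≡ 𝟎
    v≡𝟎 = indep
      (Kernel-lookup⇐ A (λ i → 0-to (H.trans (H.sym (combination A v c c≈ i)) (rel i))))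
      (Supported⇐ S v (λ j e → 0-to (H.trans (H.sym (c≈ j)) (out j (false⇒∉ S j e)))))

  -- The coordinate complement of the kernel is an independent set of `rk` columns, and by
  -- `independent-≤-rk` no independent set is larger.
  HasRank⇒ : ∀ {m n} r (A : Vec (V n) m) → HasRank F r (embedMatrix A) → rk (toList A) ≡ r
  HasRank⇒ r A ((S , indep , ∣S∣≡r) , maximal) = ℕ.≤-antisym
    (maximal (Kernels.complement (toList A)) (independent⇐ A _ (Kernels.transversal (toList A))))
    (subst (_≤ rk (toList A)) ∣S∣≡r (independent-≤-rk (toList A) S (independent⇒ A S indep)))

  HasRank⇐ : ∀ {m n} r (A : Vec (V n) m) → rk (toList A) ≡ r → HasRank F r (embedMatrix A)
  HasRank⇐ r A e = (Kernels.complement (toList A) , independent⇐ A _ (Kernels.transversal (toList A)) , e) ,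
    λ S indep → subst (∣ S ∣ ≤_) e (independent-≤-rk (toList A) S (independent⇒ A S indep))

  Σ-subsets : ∀ {n} (b : Subset n) (h : V n → ℤ) → Σ⟨ supportedIn b ⟩ h ≡ Σ⟨ subsets b ⟩ (λ s → Σ⟨ rowsOn s ⟩ h)
  Σ-subsets []          h = sym (ℤ.+-identityʳ _)
  Σ-subsets (false ∷ b) h = begin
    Σ⟨ map (0# ∷_) (supportedIn b) ⟩ h ≡⟨ Σ-map (0# ∷_) (supportedIn b) h ⟩
    Σ⟨ supportedIn b ⟩ (h ∘ (0# ∷_)) ≡⟨ Σ-subsets b (h ∘ (0# ∷_)) ⟩
    Σ⟨ subsets b ⟩ (λ s → Σ⟨ rowsOn s ⟩ (h ∘ (0# ∷_))) ≡⟨ Σ-cong (subsets b) (λ s → Σ-map (0# ∷_) (rowsOn s) h) ⟨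
    Σ⟨ subsets b ⟩ (λ s → Σ⟨ rowsOn (false ∷ s) ⟩ h) ≡⟨ Σ-map (false ∷_) (subsets b) _ ⟨
    Σ⟨ subsets (false ∷ b) ⟩ (λ s → Σ⟨ rowsOn s ⟩ h) ∎
  Σ-subsets (true ∷ b)  h = begin
    Σ⟨ scalars ⊠ (supportedIn b) ⟩ h ≡⟨ Σ-× _∷_ scalars (supportedIn b) h ⟩
    Σ⟨ scalars ⟩ (λ c → Σ⟨ supportedIn b ⟩ (h ∘ (c ∷_))) ≡⟨ Σ-cong scalars (λ c → Σ-subsets b (h ∘ (c ∷_))) ⟩
    Σ⟨ scalars ⟩ (λ c → Σ⟨ subsets b ⟩ (λ s → Σ⟨ rowsOn s ⟩ (h ∘ (c ∷_)))) ≡⟨ Σ-scalars (λ c → Σ⟨ subsets b ⟩ (λ s → Σ⟨ rowsOn s ⟩ (h ∘ (c ∷_)))) ⟩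
    Σ⟨ units ⟩ (λ c → Σ⟨ subsets b ⟩ (λ s → Σ⟨ rowsOn s ⟩ (h ∘ (c ∷_)))) ℤ.+ Σ⟨ subsets b ⟩ (λ s → Σ⟨ rowsOn s ⟩ (h ∘ (0# ∷_)))
      ≡⟨ cong₂ ℤ._+_ (trans (Σ-comm units (subsets b) _) (Σ-cong (subsets b) (λ s → sym (Σ-× _∷_ units (rowsOn s) h))))
        (Σ-cong (subsets b) (λ s → sym (Σ-map (0# ∷_) (rowsOn s) h))) ⟩
    Σ⟨ subsets b ⟩ (λ s → Σ⟨ rowsOn (true ∷ s) ⟩ h) ℤ.+ Σ⟨ subsets b ⟩ (λ s → Σ⟨ rowsOn (false ∷ s) ⟩ h)
      ≡⟨ cong₂ ℤ._+_ (Σ-map (true ∷_) (subsets b) _) (Σ-map (false ∷_) (subsets b) _) ⟨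
    Σ⟨ map (true ∷_) (subsets b) ⟩ (λ s → Σ⟨ rowsOn s ⟩ h) ℤ.+ Σ⟨ map (false ∷_) (subsets b) ⟩ (λ s → Σ⟨ rowsOn s ⟩ h)
      ≡⟨ Σ-++ (map (true ∷_) (subsets b)) (map (false ∷_) (subsets b)) _ ⟨
    Σ⟨ subsets (true ∷ b) ⟩ (λ s → Σ⟨ rowsOn s ⟩ h) ∎

  rows-supported? : ∀ {m n} (bs : Vec (Subset n) m) (A : Vec (V n) m) → Dec (Pointwise Supported bs A)
  rows-supported? []       []      = yes []
  rows-supported? (b ∷ bs) (a ∷ A) = map′ (λ (p , ps) → p ∷ ps) (λ { (p ∷ ps) → p , ps }) (supported? b a ×-dec rows-supported? bs A)

  Σ-subBoards : ∀ {m n} (bs : Vec (Subset n) m) (g : List (V n) → ℤ) →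
    Σ⟨ power (vecs n) m ⟩ (λ A → [ rows-supported? bs A ] ℤ.* g (toList A)) ≡ Σ⟨ subBoards bs ⟩ (λ S → Σ⟨ Matrices S ⟩ g)
  Σ-subBoards []       g = cong (ℤ._+ 0ℤ) (trans (ℤ.*-identityˡ (g [])) (sym (ℤ.+-identityʳ (g []))))
  Σ-subBoards {suc m} {n} (b ∷ bs) g = begin
    Σ⟨ power (vecs n) (suc m) ⟩ (λ A → [ rows-supported? (b ∷ bs) A ] ℤ.* g (toList A))
      ≡⟨ Σ-× _∷_ (vecs n) (power (vecs n) m) _ ⟩
    Σ⟨ vecs n ⟩ (λ a → Σ⟨ power (vecs n) m ⟩ (λ A → [ supported? b a ×-dec rows-supported? bs A ] ℤ.* g (a ∷ toList A)))
      ≡⟨ Σ-cong (vecs n) (λ a → trans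
        (Σ-cong (power (vecs n) m) (λ A → trans (cong (ℤ._* g (a ∷ toList A)) ([]-× (supported? b a) (rows-supported? bs A)))
        (ℤ.*-assoc [ supported? b a ] [ rows-supported? bs A ] (g (a ∷ toList A)))))
        (trans (Σ-*ˡ (power (vecs n) m) [ supported? b a ] (λ A → [ rows-supported? bs A ] ℤ.* g (a ∷ toList A)))
        (cong ([ supported? b a ] ℤ.*_) (Σ-subBoards bs (g ∘ (a ∷_)))))) ⟩
    Σ⟨ vecs n ⟩ (λ a → [ supported? b a ] ℤ.* G a)
      ≡⟨ trans (Σ-supported b G) (Σ-subsets b G) ⟩
    Σ⟨ subsets b ⟩ (λ s → Σ⟨ rowsOn s ⟩ G)
      ≡⟨ Σ-cong (subsets b) (λ s → trans (Σ-comm (rowsOn s) (subBoards bs) _)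
        (Σ-cong (subBoards bs) (λ S → sym (Σ-× _∷_ (rowsOn s) (Matrices S) g)))) ⟩
    Σ⟨ subsets b ⟩ (λ s → Σ⟨ subBoards bs ⟩ (λ S → Σ⟨ Matrices (s ∷ S) ⟩ g))
      ≡⟨ Σ-× _∷_ (subsets b) (subBoards bs) _ ⟨
    Σ⟨ subBoards (b ∷ bs) ⟩ (λ S → Σ⟨ Matrices S ⟩ g) ∎
    where
    G : V n → ℤ
    G a = Σ⟨ subBoards bs ⟩ (λ S → Σ⟨ Matrices S ⟩ (g ∘ (a ∷_)))

  𝔪≡Σcount : ∀ {m n} d (B : Board m n) → ℤ.+ 𝔪 F d B ≡ Σ⟨ subBoards (tabulate B) ⟩ (λ S → count S d)
  𝔪≡Σcount {m} {n} d B = begin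
    ℤ.+ 𝔪 F d B ≡⟨ length-filter test (matrices F m n) ⟩
    Σ⟨ matrices F m n ⟩ (λ A → [ test A ]) ≡⟨ Σ-matrices m n (λ A → [ test A ]) ⟩
    Σ⟨ power (vecs n) m ⟩ (λ A → [ test (embedMatrix A) ]) ≡⟨ Σ-cong (power (vecs n) m) pointwise ⟩
    Σ⟨ power (vecs n) m ⟩ (λ A → [ rows-supported? (tabulate B) A ] ℤ.* [ rk (toList A) ℕ.≟ d ]) ≡⟨ Σ-subBoards (tabulate B) (λ A → [ rk A ℕ.≟ d ]) ⟩
    Σ⟨ subBoards (tabulate B) ⟩ (λ S → count S d) ∎
    where
    test : Decidable (λ A → SupportedOn F B A × HasRank F d A)
    test A = supportedOn? F B A ×-dec hasRank? F d A
    pointwise : ∀ A → [ test (embedMatrix A) ] ≡ [ rows-supported? (tabulate B) A ] ℤ.* [ rk (toList A) ℕ.≟ d ]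
    pointwise A = trans ([]-× (supportedOn? F B (embedMatrix A)) (hasRank? F d (embedMatrix A))) (cong₂ ℤ._*_
      ([]-cong (supportedOn? F B (embedMatrix A)) (rows-supported? (tabulate B) A) (SupportedOn⇒ B A) (SupportedOn⇐ B A))
      ([]-cong (hasRank? F d (embedMatrix A)) (rk (toList A) ℕ.≟ d) (HasRank⇒ d A) (HasRank⇐ d A)))

-- Truncation to degree d + 5

open import Data.Integer.Base using (+_; _-_; _^_)
open import Data.Nat.Base using (_+_)

theorem3p13 : ∀ (m n : ℕ) (B : Board m n) (d : ℕ) →
    ∃[ P ] DegreeAtMost (d + 5) P ×
    (∀ (q : ℕ) → PrimePower q → (F : FiniteField q) →
    (+ q - 1ℤ) ^ (d + 6) ∣ + 𝔪 F d B - ⟦ P ⟧ (+ q - 1ℤ))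
theorem3p13 m n B d
  with tame-Σ d (subBoards (tabulate B)) (λ S F → Boards.count F S d) (λ S → count-tame (length S) S ℕ.≤-refl d)
-- L stands for x^d R. Its coefficients from degree d + 6 on contribute a multiple of x^(d + 6), so
-- cutting them off keeps the congruence and bounds the degree by d + 5.
... | R , e = take (d + 6) L
            , (λ i d+5<i → coeff-take (d + 6) L i (subst (ℕ._≤ i) (sym (ℕ.+-suc d 5)) d+5<i))
            , λ q _ F → divides-take (+ q - 1ℤ) (Transport.𝔪≡Σcount F d B) (e (Transport.transport F))
  where
  L : Polynomial
  L = List.replicate d 0ℤ ++ R
  divides-take : ∀ x {f g} → f ≡ g → x ^ (d + 6) ∣ g - x ^ d ℤ.* ⟦ R ⟧ x → x ^ (d + 6) ∣ f - ⟦ take (d + 6) L ⟧ x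
  divides-take x {f} refl h = subst (x ^ (d + 6) ∣_) eq
    (∣m∣n⇒∣m+n h (divides (⟦ drop (d + 6) L ⟧ x) (ℤ.*-comm (x ^ (d + 6)) (⟦ drop (d + 6) L ⟧ x))))
    where
    lemma : ∀ f t r → f - (t ℤ.+ r) ℤ.+ r ≡ f - t
    lemma = solve-∀
    eq : f - x ^ d ℤ.* ⟦ R ⟧ x ℤ.+ x ^ (d + 6) ℤ.* ⟦ drop (d + 6) L ⟧ x ≡ f - ⟦ take (d + 6) L ⟧ x
    eq = trans (cong (λ z → f - z ℤ.+ x ^ (d + 6) ℤ.* ⟦ drop (d + 6) L ⟧ x) (trans (sym (⟦shift⟧ d R x)) (⟦take⟧ (d + 6) L x)))
      (lemma f (⟦ take (d + 6) L ⟧ x) (x ^ (d + 6) ℤ.* ⟦ drop (d + 6) L ⟧ x))
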